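{- There is an absolute constant $c>0$ such that for all sufficiently large $n$ there exists a convex set $S\subseteq\{0,\pm1\}^n$ with influence $\mathbb{I}(S)\ge c\,n^{3/4}$; that is, $\mathbb{I}(S)=\Omega(n^{3/4})$.
   Context: A set $S\subseteq\{0,\pm1\}^n$ is called convex (discrete convex) if $S=\mathrm{Conv}(S)\cap\{0,\pm1\}^n$, where $\mathrm{Conv}(S)\subseteq\mathbb{R}^n$ is the convex hull. The edge set of the ternary hypercube is the set $E$ of pairs $(x,y)$ of points of $\{0,\pm1\}^n$ with $\sum_{i=1}^n|x_i-y_i|=1$, each edge being counted once, so that $|E|=2n\cdot 3^{n-1}$. Identify $S$ with its indicator function ($S(x)=1$ if $x\in S$, else $0$). The influence of $S$ is $$\mathbb{I}(S)=\frac{1}{3^n}\,\bigl|\{(u,v)\in E: S(u)\ne S(v)\}\bigr|.$$ -}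

module Defs where

open import Data.Bool.Base using (Bool; true)
import Data.Bool.Properties as Bool
open import Data.Fin.Base using (Fin)
open import Data.Integer.Base as ℤ using (ℤ; +_; 0ℤ; 1ℤ; -1ℤ)
import Data.Integer.Properties as ℤ
open import Data.List.Base as List using (List; []; _∷_; _++_)
open import Data.Nat.Base as ℕ using (ℕ; zero; suc; z≤n; s≤s)
import Data.Nat.Properties as ℕ
open import Data.Integer.Solver as ℤ-Solver using ()
open import Data.Nat.Solver as ℕ-Solver using ()
open import Data.Product.Base using (Σ-syntax; ∃-syntax; _×_; _,_; proj₁; proj₂)
open import Data.Rational.Base as ℚ using (ℚ; 0ℚ; 1ℚ; ½; _/_)
import Data.Rational.Properties as ℚ
open import Data.Rational.Solver using (module +-*-Solver)
import Data.Rational.Unnormalised.Base as ℚᵘ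
import Data.Rational.Unnormalised.Properties as ℚᵘ
open import Data.Sum.Base using (inj₁; inj₂)
open import Data.Vec.Base as Vec using (Vec)
open import Data.Vec.Functional as Vector using (Vector)
open import Function.Bundles using (_⇔_)
open import Relation.Binary.PropositionalEquality
  using (_≡_; refl; sym; trans; cong; cong₂; subst; subst₂)
open import Relation.Nullary using (yes; no; ¬?; contradiction)

------------------------------------------------------------------------
-- Real numbers, as Cauchy sequences of rationals

Eventually : (ℕ → Set) → Set
Eventually P = ∃[ N ] ∀ n → N ℕ.≤ n → P n

IsCauchy : (ℕ → ℚ) → Set
IsCauchy f = ∀ ε → 0ℚ ℚ.< ε →
  ∃[ N ] ∀ m n → N ℕ.≤ m → N ℕ.≤ n → ℚ.∣ f m ℚ.- f n ∣ ℚ.≤ ε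

record ℝ : Set where
  constructor mkℝ
  field
    seq    : ℕ → ℚ
    cauchy : IsCauchy seq

open ℝ public

infix 4 _≈ᴿ_ _≤ᴿ_ _<ᴿ_

_≈ᴿ_ : ℝ → ℝ → Set
x ≈ᴿ y = ∀ ε → 0ℚ ℚ.< ε → Eventually λ n → ℚ.∣ seq x n ℚ.- seq y n ∣ ℚ.≤ ε

_≤ᴿ_ : ℝ → ℝ → Set
x ≤ᴿ y = ∀ ε → 0ℚ ℚ.< ε → Eventually λ n → seq x n ℚ.≤ seq y n ℚ.+ ε

_<ᴿ_ : ℝ → ℝ → Set
x <ᴿ y = ∃[ ε ] 0ℚ ℚ.< ε × Eventually λ n → seq x n ℚ.+ ε ℚ.≤ seq y n

fromℚ : ℚ → ℝ
fromℚ q = mkℝ (λ _ → q) λ ε 0<ε → 0 , λ _ _ _ _ →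
  subst (ℚ._≤ ε) (sym (cong ℚ.∣_∣ (ℚ.+-inverseʳ q))) (ℚ.<⇒≤ 0<ε)

0ᴿ 1ᴿ : ℝ
0ᴿ = fromℚ 0ℚ
1ᴿ = fromℚ 1ℚ

half-pos : ∀ {ε} → 0ℚ ℚ.< ε → 0ℚ ℚ.< ½ ℚ.* ε
half-pos {ε} 0<ε =
  subst (ℚ._< ½ ℚ.* ε) (ℚ.*-zeroʳ ½) (ℚ.*-monoʳ-<-pos ½ 0<ε)

half+half : ∀ ε → ½ ℚ.* ε ℚ.+ ½ ℚ.* ε ≡ ε
half+half ε = trans (sym (ℚ.*-distribʳ-+ ε ½ ½)) (ℚ.*-identityˡ ε)

+-diff : ∀ a b c d →
  (a ℚ.+ b) ℚ.- (c ℚ.+ d) ≡ (a ℚ.- c) ℚ.+ (b ℚ.- d)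
+-diff = solve 4 (λ a b c d → (a :+ b) :- (c :+ d) := (a :- c) :+ (b :- d)) refl
  where open +-*-Solver

*-diff : ∀ a b c d →
  a ℚ.* b ℚ.- c ℚ.* d ≡ a ℚ.* (b ℚ.- d) ℚ.+ (a ℚ.- c) ℚ.* d
*-diff = solve 4
  (λ a b c d → a :* b :- c :* d := a :* (b :- d) :+ (a :- c) :* d) refl
  where open +-*-Solver

split : ∀ a b → a ≡ b ℚ.+ (a ℚ.- b)
split = solve 2 (λ a b → a := b :+ (a :- b)) refl
  where open +-*-Solver

*-mono-≤-nonNeg : ∀ {a b c d} → 0ℚ ℚ.≤ c → 0ℚ ℚ.≤ b →
                  a ℚ.≤ b → c ℚ.≤ d → a ℚ.* c ℚ.≤ b ℚ.* d
*-mono-≤-nonNeg {b = b} {c = c} 0≤c 0≤b a≤b c≤d = ℚ.≤-trans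
  (ℚ.*-monoʳ-≤-nonNeg c {{ℚ.nonNegative 0≤c}} a≤b)
  (ℚ.*-monoˡ-≤-nonNeg b {{ℚ.nonNegative 0≤b}} c≤d)

0≤∣_∣ : ∀ p → 0ℚ ℚ.≤ ℚ.∣ p ∣
0≤∣ p ∣ = ℚ.nonNegative⁻¹ ℚ.∣ p ∣ {{ℚ.∣-∣-nonNeg p}}

bounded : ∀ x → ∃[ B ] 0ℚ ℚ.< B × Eventually λ n → ℚ.∣ seq x n ∣ ℚ.≤ B
bounded x with cauchy x 1ℚ (ℚ.positive⁻¹ 1ℚ)
... | N , close = ℚ.∣ seq x N ∣ ℚ.+ 1ℚ
  , ℚ.+-mono-≤-< 0≤∣ seq x N ∣ (ℚ.positive⁻¹ 1ℚ)
  , N , λ n N≤n → begin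
    ℚ.∣ seq x n ∣
      ≡⟨ cong ℚ.∣_∣ (split (seq x n) (seq x N)) ⟩
    ℚ.∣ seq x N ℚ.+ (seq x n ℚ.- seq x N) ∣
      ≤⟨ ℚ.∣p+q∣≤∣p∣+∣q∣ (seq x N) (seq x n ℚ.- seq x N) ⟩
    ℚ.∣ seq x N ∣ ℚ.+ ℚ.∣ seq x n ℚ.- seq x N ∣
      ≤⟨ ℚ.+-monoʳ-≤ ℚ.∣ seq x N ∣ (close n N N≤n ℕ.≤-refl) ⟩
    ℚ.∣ seq x N ∣ ℚ.+ 1ℚ ∎
  where open ℚ.≤-Reasoning

⊔-lub₁ : ∀ {a b n} → a ℕ.⊔ b ℕ.≤ n → a ℕ.≤ n
⊔-lub₁ {a} {b} = ℕ.≤-trans (ℕ.m≤m⊔n a b)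

⊔-lub₂ : ∀ {a b n} → a ℕ.⊔ b ℕ.≤ n → b ℕ.≤ n
⊔-lub₂ {a} {b} = ℕ.≤-trans (ℕ.m≤n⊔m a b)

infixl 6 _+ᴿ_
infixl 7 _*ᴿ_

_+ᴿ_ : ℝ → ℝ → ℝ
x +ᴿ y = mkℝ (λ n → seq x n ℚ.+ seq y n) isCauchy
  where
  isCauchy : IsCauchy (λ n → seq x n ℚ.+ seq y n)
  isCauchy ε 0<ε with cauchy x _ (half-pos 0<ε) | cauchy y _ (half-pos 0<ε)
  ... | M , closeX | N , closeY = M ℕ.⊔ N , λ m n ≤m ≤n → begin
      ℚ.∣ (seq x m ℚ.+ seq y m) ℚ.- (seq x n ℚ.+ seq y n) ∣
        ≡⟨ cong ℚ.∣_∣ (+-diff (seq x m) (seq y m) (seq x n) (seq y n)) ⟩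
      ℚ.∣ (seq x m ℚ.- seq x n) ℚ.+ (seq y m ℚ.- seq y n) ∣
        ≤⟨ ℚ.∣p+q∣≤∣p∣+∣q∣ (seq x m ℚ.- seq x n) (seq y m ℚ.- seq y n) ⟩
      ℚ.∣ seq x m ℚ.- seq x n ∣ ℚ.+ ℚ.∣ seq y m ℚ.- seq y n ∣
        ≤⟨ ℚ.+-mono-≤ (closeX m n (⊔-lub₁ ≤m) (⊔-lub₁ ≤n))
                      (closeY m n (⊔-lub₂ {M} ≤m) (⊔-lub₂ {M} ≤n)) ⟩
      ½ ℚ.* ε ℚ.+ ½ ℚ.* ε
        ≡⟨ half+half ε ⟩
      ε ∎
    where open ℚ.≤-Reasoning

_*ᴿ_ : ℝ → ℝ → ℝ
x *ᴿ y = mkℝ (λ n → seq x n ℚ.* seq y n) isCauchy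
  where
  isCauchy : IsCauchy (λ n → seq x n ℚ.* seq y n)
  isCauchy ε 0<ε = go (bounded x) (bounded y)
    where
    open ℚ.≤-Reasoning
    go : (∃[ B ] 0ℚ ℚ.< B × Eventually λ n → ℚ.∣ seq x n ∣ ℚ.≤ B) →
         (∃[ C ] 0ℚ ℚ.< C × Eventually λ n → ℚ.∣ seq y n ∣ ℚ.≤ C) →
         ∃[ N ] ∀ m n → N ℕ.≤ m → N ℕ.≤ n →
           ℚ.∣ seq x m ℚ.* seq y m ℚ.- seq x n ℚ.* seq y n ∣ ℚ.≤ ε
    go (B , 0<B , K , x≤B) (C , 0<C , L , y≤C) =
      (K ℕ.⊔ L) ℕ.⊔ (M ℕ.⊔ N) , λ m n ≤m ≤n → begin
        ℚ.∣ seq x m ℚ.* seq y m ℚ.- seq x n ℚ.* seq y n ∣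
          ≡⟨ cong ℚ.∣_∣ (*-diff (seq x m) (seq y m) (seq x n) (seq y n)) ⟩
        ℚ.∣ seq x m ℚ.* Δy m n ℚ.+ Δx m n ℚ.* seq y n ∣
          ≤⟨ ℚ.∣p+q∣≤∣p∣+∣q∣ (seq x m ℚ.* Δy m n) (Δx m n ℚ.* seq y n) ⟩
        ℚ.∣ seq x m ℚ.* Δy m n ∣ ℚ.+ ℚ.∣ Δx m n ℚ.* seq y n ∣
          ≡⟨ cong₂ ℚ._+_ (ℚ.∣p*q∣≡∣p∣*∣q∣ (seq x m) (Δy m n))
                         (ℚ.∣p*q∣≡∣p∣*∣q∣ (Δx m n) (seq y n)) ⟩
        ℚ.∣ seq x m ∣ ℚ.* ℚ.∣ Δy m n ∣ ℚ.+ ℚ.∣ Δx m n ∣ ℚ.* ℚ.∣ seq y n ∣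
          ≤⟨ ℚ.+-mono-≤
               (*-mono-≤-nonNeg 0≤∣ Δy m n ∣ (ℚ.<⇒≤ 0<B)
                 (x≤B m (⊔-lub₁ (⊔-lub₁ ≤m)))
                 (closeY m n (⊔-lub₂ {M} (⊔-lub₂ {K ℕ.⊔ L} ≤m))
                             (⊔-lub₂ {M} (⊔-lub₂ {K ℕ.⊔ L} ≤n))))
               (*-mono-≤-nonNeg 0≤∣ seq y n ∣ (ℚ.<⇒≤ 0<δ)
                 (closeX m n (⊔-lub₁ (⊔-lub₂ {K ℕ.⊔ L} ≤m))
                             (⊔-lub₁ (⊔-lub₂ {K ℕ.⊔ L} ≤n)))
                 (y≤C n (⊔-lub₂ {K} (⊔-lub₁ ≤n)))) ⟩
        B ℚ.* δ ℚ.+ δ ℚ.* C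
          ≡⟨ cong (ℚ._+ δ ℚ.* C) (ℚ.*-comm B δ) ⟩
        δ ℚ.* B ℚ.+ δ ℚ.* C
          ≡⟨ sym (ℚ.*-distribˡ-+ δ B C) ⟩
        ε ℚ.* (ℚ.1/ (B ℚ.+ C)) ℚ.* (B ℚ.+ C)
          ≡⟨ ℚ.*-assoc ε (ℚ.1/ (B ℚ.+ C)) (B ℚ.+ C) ⟩
        ε ℚ.* (ℚ.1/ (B ℚ.+ C) ℚ.* (B ℚ.+ C))
          ≡⟨ cong (ε ℚ.*_) (ℚ.*-inverseˡ (B ℚ.+ C)) ⟩
        ε ℚ.* 1ℚ
          ≡⟨ ℚ.*-identityʳ ε ⟩
        ε ∎
      where
      Δx Δy : ℕ → ℕ → ℚ
      Δx m n = seq x m ℚ.- seq x n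
      Δy m n = seq y m ℚ.- seq y n
      instance
        B+C>0 : ℚ.Positive (B ℚ.+ C)
        B+C>0 = ℚ.positive (ℚ.+-mono-< 0<B 0<C)
        B+C≢0 : ℚ.NonZero (B ℚ.+ C)
        B+C≢0 = ℚ.pos⇒nonZero (B ℚ.+ C)
      δ : ℚ
      δ = ε ℚ.* ℚ.1/ (B ℚ.+ C)
      0<δ : 0ℚ ℚ.< δ
      0<δ = ℚ.positive⁻¹ δ
        {{ℚ.pos*pos⇒pos ε {{ℚ.positive 0<ε}} (ℚ.1/ (B ℚ.+ C))
            {{ℚ.1/pos⇒pos (B ℚ.+ C)}}}}
      M N : ℕ
      M = proj₁ (cauchy x δ 0<δ)
      N = proj₁ (cauchy y δ 0<δ)
      closeX : ∀ m n → M ℕ.≤ m → M ℕ.≤ n → ℚ.∣ Δx m n ∣ ℚ.≤ δ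
      closeX = proj₂ (cauchy x δ 0<δ)
      closeY : ∀ m n → N ℕ.≤ m → N ℕ.≤ n → ℚ.∣ Δy m n ∣ ℚ.≤ δ
      closeY = proj₂ (cauchy y δ 0<δ)

∑ : ∀ {k} → Vector ℝ k → ℝ
∑ = Vector.foldr _+ᴿ_ 0ᴿ

------------------------------------------------------------------------
-- The real number n^(3/4)

-- ⌊ m^(1/4) ⌋
⌊∜_⌋ : ℕ → ℕ
⌊∜ zero ⌋ = 0
⌊∜ suc m ⌋ with suc ⌊∜ m ⌋ ℕ.^ 4 ℕ.≤? suc m
... | yes _ = suc ⌊∜ m ⌋
... | no  _ = ⌊∜ m ⌋

⌊∜⌋-lower : ∀ m → ⌊∜ m ⌋ ℕ.^ 4 ℕ.≤ m
⌊∜⌋-lower zero = z≤n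
⌊∜⌋-lower (suc m) with suc ⌊∜ m ⌋ ℕ.^ 4 ℕ.≤? suc m
... | yes p = p
... | no  _ = ℕ.m≤n⇒m≤1+n (⌊∜⌋-lower m)

⌊∜⌋-upper : ∀ m → m ℕ.< suc ⌊∜ m ⌋ ℕ.^ 4
⌊∜⌋-upper zero = s≤s z≤n
⌊∜⌋-upper (suc m) with suc ⌊∜ m ⌋ ℕ.^ 4 ℕ.≤? suc m
... | yes _ = ℕ.≤-<-trans (⌊∜⌋-upper m) (ℕ.^-monoˡ-< 4 (ℕ.n<1+n (suc ⌊∜ m ⌋)))
... | no ¬p = ℕ.≰⇒> ¬p

-- The greatest multiple of 1/(k+1) that is at most n^(3/4).
¾-approx : ℕ → ℕ → ℚ
¾-approx n k = + ⌊∜ n ℕ.^ 3 ℕ.* suc k ℕ.^ 4 ⌋ / suc k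

^4-cancel-< : ∀ {a b} → a ℕ.^ 4 ℕ.< b ℕ.^ 4 → a ℕ.< b
^4-cancel-< {a} {b} lt with a ℕ.<? b
... | yes p = p
... | no ¬p = contradiction (ℕ.^-monoˡ-≤ 4 (ℕ.≮⇒≥ ¬p)) (ℕ.<⇒≱ lt)

*-^4 : ∀ a b → (a ℕ.* b) ℕ.^ 4 ≡ a ℕ.^ 4 ℕ.* b ℕ.^ 4
*-^4 = solve 2 (λ a b → (a :* b) :^ 4 := (a :^ 4) :* (b :^ 4)) refl
  where open ℕ-Solver.+-*-Solver

⌊∜⌋-ratio : ∀ c j k → ⌊∜ c ℕ.* suc j ℕ.^ 4 ⌋ ℕ.* suc k
                ℕ.≤ suc ⌊∜ c ℕ.* suc k ℕ.^ 4 ⌋ ℕ.* suc j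
⌊∜⌋-ratio c j k = ℕ.<⇒≤ (^4-cancel-< (begin-strict
  (a ℕ.* suc k) ℕ.^ 4
    ≡⟨ *-^4 a (suc k) ⟩
  a ℕ.^ 4 ℕ.* K
    ≤⟨ ℕ.*-monoˡ-≤ K (⌊∜⌋-lower (c ℕ.* J)) ⟩
  c ℕ.* J ℕ.* K
    ≡⟨ xy∙z≈xz∙y c J K ⟩
  c ℕ.* K ℕ.* J
    <⟨ ℕ.*-monoˡ-< J {{ℕ.m^n≢0 (suc j) 4}} (⌊∜⌋-upper (c ℕ.* K)) ⟩
  suc b ℕ.^ 4 ℕ.* J
    ≡⟨ sym (*-^4 (suc b) (suc j)) ⟩
  (suc b ℕ.* suc j) ℕ.^ 4 ∎))
  where
  open ℕ.≤-Reasoning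
  open import Algebra.Properties.CommutativeSemigroup ℕ.*-commutativeSemigroup
    using (xy∙z≈xz∙y)
  J K a b : ℕ
  J = suc j ℕ.^ 4
  K = suc k ℕ.^ 4
  a = ⌊∜ c ℕ.* J ⌋
  b = ⌊∜ c ℕ.* K ⌋

/-≤ : ∀ a j b k → a ℕ.* suc k ℕ.≤ b ℕ.* suc j → + a / suc j ℚ.≤ + b / suc k
/-≤ a j b k le = ℚ.toℚᵘ-cancel-≤
  (ℚᵘ.≤-respˡ-≃ (ℚᵘ.≃-sym (ℚ.toℚᵘ-fromℚᵘ (ℚᵘ.mkℚᵘ (+ a) j)))
  (ℚᵘ.≤-respʳ-≃ (ℚᵘ.≃-sym (ℚ.toℚᵘ-fromℚᵘ (ℚᵘ.mkℚᵘ (+ b) k)))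
  (ℚᵘ.*≤* (subst₂ ℤ._≤_ (ℤ.pos-* a (suc k)) (ℤ.pos-* b (suc j)) (ℤ.+≤+ le)))))

suc-/ : ∀ b k → + suc b / suc k ≡ + b / suc k ℚ.+ 1ℤ / suc k
suc-/ b k = ℚ.toℚᵘ-injective (begin
  ℚ.toℚᵘ (+ suc b / suc k)
    ≈⟨ ℚ.toℚᵘ-fromℚᵘ (ℚᵘ.mkℚᵘ (+ suc b) k) ⟩
  ℚᵘ.mkℚᵘ (+ suc b) k
    ≈⟨ ℚᵘ.*≡* (eq (+ b) (+ suc k)) ⟩
  ℚᵘ.mkℚᵘ (+ b) k ℚᵘ.+ ℚᵘ.mkℚᵘ 1ℤ k
    ≈⟨ ℚᵘ.+-cong (ℚ.toℚᵘ-fromℚᵘ (ℚᵘ.mkℚᵘ (+ b) k))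
                 (ℚ.toℚᵘ-fromℚᵘ (ℚᵘ.mkℚᵘ 1ℤ k)) ⟨
  ℚ.toℚᵘ (+ b / suc k) ℚᵘ.+ ℚ.toℚᵘ (1ℤ / suc k)
    ≈⟨ ℚ.toℚᵘ-homo-+ (+ b / suc k) (1ℤ / suc k) ⟨
  ℚ.toℚᵘ (+ b / suc k ℚ.+ 1ℤ / suc k) ∎)
  where
  open ℚᵘ.≃-Reasoning
  eq : ∀ x y → (1ℤ ℤ.+ x) ℤ.* (y ℤ.* y) ≡ (x ℤ.* y ℤ.+ 1ℤ ℤ.* y) ℤ.* y
  eq = solve 2 (λ x y → (con 1ℤ :+ x) :* (y :* y)
                     := (x :* y :+ con 1ℤ :* y) :* y) refl
    where open ℤ-Solver.+-*-Solver

¾-approx-close : ∀ n j k → ¾-approx n j ℚ.≤ ¾-approx n k ℚ.+ 1ℤ / suc k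
¾-approx-close n j k = subst (¾-approx n j ℚ.≤_) (suc-/ b k)
  (/-≤ ⌊∜ n ℕ.^ 3 ℕ.* suc j ℕ.^ 4 ⌋ j (suc b) k (⌊∜⌋-ratio (n ℕ.^ 3) j k))
  where
  b : ℕ
  b = ⌊∜ n ℕ.^ 3 ℕ.* suc k ℕ.^ 4 ⌋

archimedean : ∀ ε → 0ℚ ℚ.< ε → ∃[ N ] ∀ k → N ℕ.≤ k → 1ℤ / suc k ℚ.≤ ε
archimedean ε 0<ε = go ε {{ℚ.positive 0<ε}}
  where
  go : ∀ ε → .{{ℚ.Positive ε}} → ∃[ N ] ∀ k → N ℕ.≤ k → 1ℤ / suc k ℚ.≤ ε
  go ε@(ℚ.mkℚ (+ suc c) d _) = d , λ k d≤k →
    subst (1ℤ / suc k ℚ.≤_) (ℚ.↥p/↧p≡p ε)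
      (/-≤ 1 k (suc c) d (ℕ.*-mono-≤ (s≤s (z≤n {c})) (s≤s d≤k)))

-‿≤ : ∀ {p q ε} → p ℚ.≤ q ℚ.+ ε → p ℚ.- q ℚ.≤ ε
-‿≤ {p} {q} {ε} p≤ = subst (p ℚ.- q ℚ.≤_) (cancel q ε) (ℚ.+-monoˡ-≤ (ℚ.- q) p≤)
  where
  open +-*-Solver
  cancel : ∀ q ε → (q ℚ.+ ε) ℚ.- q ≡ ε
  cancel = solve 2 (λ q ε → (q :+ ε) :- q := ε) refl

∣-∣-≤ : ∀ {p q ε} → p ℚ.≤ q ℚ.+ ε → q ℚ.≤ p ℚ.+ ε → ℚ.∣ p ℚ.- q ∣ ℚ.≤ ε
∣-∣-≤ {p} {q} {ε} p≤ q≤ with ℚ.∣p∣≡p∨∣p∣≡-p (p ℚ.- q)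
... | inj₁ eq = subst (ℚ._≤ ε) (sym eq) (-‿≤ p≤)
... | inj₂ eq = subst (ℚ._≤ ε) (trans (flip-diff p q) (sym eq)) (-‿≤ q≤)
  where
  open +-*-Solver
  flip-diff : ∀ p q → q ℚ.- p ≡ ℚ.- (p ℚ.- q)
  flip-diff = solve 2 (λ p q → q :- p := :- (p :- q)) refl

infix 8 _^¾

_^¾ : ℕ → ℝ
n ^¾ = mkℝ (¾-approx n) λ ε 0<ε →
  let N , small = archimedean ε 0<ε in
  N , λ j k N≤j N≤k → ∣-∣-≤
    (ℚ.≤-trans (¾-approx-close n j k) (ℚ.+-monoʳ-≤ (¾-approx n k) (small k N≤k)))
    (ℚ.≤-trans (¾-approx-close n k j) (ℚ.+-monoʳ-≤ (¾-approx n j) (small j N≤j)))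

------------------------------------------------------------------------
-- The ternary hypercube {0,±1}ⁿ

data Trit : Set where
  -1ᵗ 0ᵗ 1ᵗ : Trit

⟦_⟧ : Trit → ℤ
⟦ -1ᵗ ⟧ = -1ℤ
⟦ 0ᵗ  ⟧ = 0ℤ
⟦ 1ᵗ  ⟧ = 1ℤ

Cube : ℕ → Set
Cube n = Vec Trit n

points : ∀ n → List (Cube n)
points zero    = Vec.[] ∷ []
points (suc n) =
  List.cartesianProductWith Vec._∷_ (-1ᵗ ∷ 0ᵗ ∷ 1ᵗ ∷ []) (points n)

embed : ∀ {n} → Cube n → Vector ℝ n
embed x i = fromℚ (⟦ Vec.lookup x i ⟧ / 1)

-- Σᵢ |xᵢ - yᵢ|
dist : ∀ {n} → Cube n → Cube n → ℕ
dist x y = Vec.sum (Vec.zipWith (λ a b → ℤ.∣ ⟦ a ⟧ ℤ.- ⟦ b ⟧ ∣) x y)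

-- All pairs of entries at distinct positions, each unordered pair once.
pairs : ∀ {A : Set} → List A → List (A × A)
pairs []       = []
pairs (x ∷ xs) = List.map (x ,_) xs ++ pairs xs

edges : ∀ n → List (Cube n × Cube n)
edges n = List.filter (λ (x , y) → dist x y ℕ.≟ 1) (pairs (points n))

-- Subsets of the cube are given by their indicator functions.
CubeSubset : ℕ → Set
CubeSubset n = Cube n → Bool

boundary : ∀ {n} → CubeSubset n → List (Cube n × Cube n)
boundary {n} S = List.filter (λ (u , v) → ¬? (S u Bool.≟ S v)) (edges n)

influence : ∀ {n} → CubeSubset n → ℚ
influence {n} S = _/_ (+ List.length (boundary S)) (3 ℕ.^ n) {{ℕ.m^n≢0 3 n}}

------------------------------------------------------------------------
-- Convexity

Conv : ∀ {n} → (Vector ℝ n → Set) → Vector ℝ n → Set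
Conv {n} A x =
  ∃[ k ] Σ[ w ∈ Vector ℝ k ] Σ[ p ∈ Vector (Vector ℝ n) k ]
    (∀ j → 0ᴿ ≤ᴿ w j) ×
    ∑ w ≈ᴿ 1ᴿ ×
    (∀ j → A (p j)) ×
    (∀ i → ∑ (λ j → w j *ᴿ p j i) ≈ᴿ x i)

-- S as a subset of ℝⁿ.
image : ∀ {n} → CubeSubset n → Vector ℝ n → Set
image S y = ∃[ s ] S s ≡ true × (∀ i → y i ≈ᴿ embed s i)

Convex : ∀ {n} → CubeSubset n → Set
Convex S = ∀ x → S x ≡ true ⇔ Conv (image S) (embed x)

{-# OPTIONS --safe #-}

-- The set consists of the x with ⟨v, x⟩ < 2q³ for each v of a suitable family of m sign
-- vectors, where q is a small multiple of n^{1/4}; the family is found by averaging over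
-- all families.  For random signs v the probability that ⟨v, x⟩ ≥ 2q³ depends only on the
-- weight k of x, the number of its nonzero coordinates.  Since 2q³ = O(n^{3/4}), it changes
-- only by a bounded factor while k stays within O(√n) of its mean 2n/3, as it does for most
-- x by Chebyshev's inequality; m is taken to be a small multiple of its inverse.  By the
-- exact identity Σ_{j≥s} (2j − k) C(k,j) = s C(k,s), a random cap that contains x has x on
-- its border with probability of order at least n^{-1/4}.  Hence every edge at x that
-- leads to higher weight is cut by exactly one of the m caps, and missed by the others,
-- with probability of order at least n^{-1/4}, and there are about 2n/3 such edges.

module Submission where

open import Defs
open import Data.Bool.Base using (Bool; true; false; not; _∧_; _∨_; _xor_; if_then_else_)
open import Data.Bool.Properties as Bool using (T-≡; xor-comm)
open import Data.Fin.Base as Fin using (Fin)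
open import Data.Integer.Base as ℤ using (ℤ; -[1+_]; ∣_∣; 1ℤ) renaming (+_ to pos)
import Data.Integer.Properties as ℤ
import Data.Integer.Tactic.RingSolver as ℤ-Ring
open import Data.List.Base as List using (List; []; _∷_; _++_)
open import Data.Nat.Base as ℕ
open import Data.Nat.Combinatorics using (_C_; nCk+nC[k+1]≡[n+1]C[k+1])
open import Data.Nat.DivMod
open import Data.Nat.Properties as ℕ
open import Algebra.Properties.CommutativeSemigroup ℕ.+-commutativeSemigroup
  using () renaming (interchange to +-interchange)
open import Data.Nat.Tactic.RingSolver using (solve-∀)
open import Data.Product.Base as Product using (Σ-syntax; ∃-syntax; _×_; _,_; proj₁; proj₂)
open import Data.Rational.Base as ℚ using (ℚ; 0ℚ; 1ℚ; ½)
import Data.Rational.Properties as ℚ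
open import Data.Rational.Solver using () renaming (module +-*-Solver to ℚ-Solver)
import Data.Rational.Unnormalised.Base as ℚᵘ
import Data.Rational.Unnormalised.Properties as ℚᵘ
open import Data.Sum.Base using (_⊎_; inj₁; inj₂)
open import Data.Vec.Base as Vec using (Vec; []; _∷_)
open import Data.Vec.Functional as Vector using (Vector)
open import Function.Base using (_∘_)
open import Function.Bundles using (Equivalence; mk⇔)
open import Relation.Binary.PropositionalEquality
open import Relation.Nullary using (¬_; ¬?; yes; no; does; contradiction)
open import Relation.Unary using (Decidable)

-- The exponent 3/4 settles a conflict over the threshold t of the caps. Among the caps that reach
-- x, the share with x on the border is of order t/n, so higher caps cut more edges for each point
-- that they remove. But for weight k a cap has probability about exp(-t²/2k), and fluctuations of k
-- by √n change the exponent by about t² n^(-3/2). This stays bounded only for t = O(n^(3/4)).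
-- Beyond that no single m suits most weights: a family that is too large covers a typical point
-- many times over, one that is too small cuts few edges. No normal approximation is used. Cap
-- probabilities of different weights are compared by adding two signs at a time: the required
-- number of agreements then rises by exactly one and t stays fixed. Odd weights are squeezed
-- between even ones. The reference weight 2κ is placed below all central weights, so that the
-- comparison runs in one direction only. Probabilities appear as counts, with all denominators
-- cleared.

𝟙 : Bool → ℕ
𝟙 b = if b then 1 else 0

𝟙≤1 : ∀ b → 𝟙 b ≤ 1
𝟙≤1 true  = s≤s z≤n
𝟙≤1 false = z≤n

≤-by : ∀ {m n} d → m + d ≡ n → m ≤ n
≤-by {m} d eq = subst (m ≤_) eq (m≤m+n m d)

-- Binomial tails

-- This is Σ_j C(k,j) f(j). The recursion splits on one binary choice, as summation over sign
-- vectors does, so `∑-agree` follows coordinate by coordinate without binomial coefficients.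
binomialSum : ℕ → (ℕ → ℕ) → ℕ
binomialSum zero    f = f 0
binomialSum (suc k) f = binomialSum k f + binomialSum k (f ∘ suc)

binomialSum-cong : ∀ k {f g} → (∀ j → f j ≡ g j) → binomialSum k f ≡ binomialSum k g
binomialSum-cong zero    f≗g = f≗g 0
binomialSum-cong (suc k) f≗g = cong₂ _+_ (binomialSum-cong k f≗g) (binomialSum-cong k (f≗g ∘ suc))

binomialSum-+ : ∀ k f g → binomialSum k (λ j → f j + g j) ≡ binomialSum k f + binomialSum k g
binomialSum-+ zero    f g = refl
binomialSum-+ (suc k) f g = trans
  (cong₂ _+_ (binomialSum-+ k f g) (binomialSum-+ k (f ∘ suc) (g ∘ suc)))
  (+-interchange (binomialSum k f) (binomialSum k g) _ _)

binomialSum-const : ∀ k c → binomialSum k (λ _ → c) ≡ 2 ^ k * c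
binomialSum-const zero    c = sym (*-identityˡ c)
binomialSum-const (suc k) c = trans
  (cong₂ _+_ (binomialSum-const k c) (binomialSum-const k c)) (double (2 ^ k) c)
  where
  double : ∀ p c → p * c + p * c ≡ 2 * p * c
  double = solve-∀

binomialSum-mono : ∀ k {f g} → (∀ j → f j ≤ g j) → binomialSum k f ≤ binomialSum k g
binomialSum-mono zero    f≤g = f≤g 0
binomialSum-mono (suc k) f≤g = +-mono-≤ (binomialSum-mono k f≤g) (binomialSum-mono k (f≤g ∘ suc))

binomialSum-point : ∀ k s → binomialSum k (λ j → 𝟙 (j ≡ᵇ s)) ≡ k C s
binomialSum-point zero    zero    = refl
binomialSum-point zero    (suc s) = refl
binomialSum-point (suc k) zero    = cong₂ _+_ (binomialSum-point k zero)
  (trans (binomialSum-const k 0) (*-zeroʳ (2 ^ k)))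
binomialSum-point (suc k) (suc s) = trans
  (cong₂ _+_ (binomialSum-point k (suc s)) (binomialSum-point k s))
  (trans (+-comm (k C suc s) (k C s)) (nCk+nC[k+1]≡[n+1]C[k+1] k s))

-- The condition s ≤ j is written as not (j <ᵇ s) because suc j <ᵇ suc s reduces to j <ᵇ s.
binomialTail : ℕ → ℕ → ℕ
binomialTail k s = binomialSum k (λ j → 𝟙 (not (j <ᵇ s)))

binomialTail-step : ∀ k s → binomialTail k s ≡ k C s + binomialTail k (suc s)
binomialTail-step k s = begin
  binomialTail k s
    ≡⟨ binomialSum-cong k (λ j → peel j s) ⟩
  binomialSum k (λ j → 𝟙 (j ≡ᵇ s) + 𝟙 (not (j <ᵇ suc s)))
    ≡⟨ binomialSum-+ k _ _ ⟩
  binomialSum k (λ j → 𝟙 (j ≡ᵇ s)) + binomialTail k (suc s)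
    ≡⟨ cong (_+ binomialTail k (suc s)) (binomialSum-point k s) ⟩
  k C s + binomialTail k (suc s) ∎
  where
  open ≡-Reasoning
  peel : ∀ j s → 𝟙 (not (j <ᵇ s)) ≡ 𝟙 (j ≡ᵇ s) + 𝟙 (not (j <ᵇ suc s))
  peel zero    zero    = refl
  peel zero    (suc s) = refl
  peel (suc j) zero    = refl
  peel (suc j) (suc s) = peel j s

binomialTail-zero : ∀ k → binomialTail k 0 ≡ 2 ^ k
binomialTail-zero k = trans (binomialSum-const k 1) (*-identityʳ (2 ^ k))

binomialTail≤2^ : ∀ k s → binomialTail k s ≤ 2 ^ k
binomialTail≤2^ k s = subst (binomialTail k s ≤_) (binomialTail-zero k) (binomialSum-mono k (λ j → 𝟙≤1 (not (j <ᵇ s))))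

binomialTail≡0 : ∀ k s → k < s → binomialTail k s ≡ 0
binomialTail≡0 zero    (suc s) _         = refl
binomialTail≡0 (suc k) (suc s) (s≤s k<s) =
  cong₂ _+_ (binomialTail≡0 k (suc s) (m<n⇒m<1+n k<s)) (binomialTail≡0 k s k<s)

binomialTail>0 : ∀ k s → s ≤ k → 0 < binomialTail k s
binomialTail>0 k       zero    _         = subst (0 <_) (sym (binomialTail-zero k)) (m^n>0 2 k)
binomialTail>0 (suc k) (suc s) (s≤s s≤k) =
  <-≤-trans (binomialTail>0 k s s≤k) (m≤n+m (binomialTail k s) (binomialTail k (suc s)))

-- k − s is not truncated: it is moved to the other side.
C-absorb : ∀ k s → suc s * (k C suc s) + s * (k C s) ≡ k * (k C s)
C-absorb zero    zero    = refl
C-absorb zero    (suc s) = trans (cong₂ _+_ (*-zeroʳ (suc (suc s))) (*-zeroʳ (suc s))) refl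
C-absorb (suc k) zero    = begin
  1 * (suc k C 1) + 0 * 1
    ≡⟨ cong (λ a → 1 * a + 0 * 1) (nCk+nC[k+1]≡[n+1]C[k+1] k 0) ⟨
  1 * (1 + k C 1) + 0 * 1
    ≡⟨ regroup (k C 1) ⟩
  1 + (1 * (k C 1) + 0 * 1)
    ≡⟨ cong suc (C-absorb k 0) ⟩
  suc k * 1 ∎
  where
  open ≡-Reasoning
  regroup : ∀ a → 1 * (1 + a) + 0 * 1 ≡ 1 + (1 * a + 0 * 1)
  regroup = solve-∀
C-absorb (suc k) (suc s) = begin
  suc (suc s) * (suc k C suc (suc s)) + suc s * (suc k C suc s)
    ≡⟨ cong₂ (λ a b → suc (suc s) * a + suc s * b)
         (nCk+nC[k+1]≡[n+1]C[k+1] k (suc s)) (nCk+nC[k+1]≡[n+1]C[k+1] k s) ⟨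
  suc (suc s) * (b + c) + suc s * (a + b)
    ≡⟨ regroup s a b c ⟩
  (suc (suc s) * c + suc s * b) + (suc s * b + s * a) + (a + b)
    ≡⟨ cong₂ (λ x y → x + y + (a + b)) (C-absorb k (suc s)) (C-absorb k s) ⟩
  k * b + k * a + (a + b)
    ≡⟨ collect k a b ⟩
  suc k * (a + b)
    ≡⟨ cong (suc k *_) (nCk+nC[k+1]≡[n+1]C[k+1] k s) ⟩
  suc k * (suc k C suc s) ∎
  where
  open ≡-Reasoning
  a = k C s
  b = k C suc s
  c = k C suc (suc s)
  regroup : ∀ s a b c → suc (suc s) * (b + c) + suc s * (a + b)
          ≡ (suc (suc s) * c + suc s * b) + (suc s * b + s * a) + (a + b)
  regroup = solve-∀
  collect : ∀ k a b → k * b + k * a + (a + b) ≡ suc k * (a + b)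
  collect = solve-∀

-- `C-absorb` with k = 2s + 1 - d: past the middle, the step from s to s + 1 loses exactly the
-- fraction d/(s + 1) of C(k,s). Both monotonicity and slow decay are read off from this.
C-drop : ∀ k s d → k + d ≡ suc (s + s) →
         suc s * (k C s) ≡ suc s * (k C suc s) + d * (k C s)
C-drop k s d eq = +-cancelˡ-≡ (s * (k C s)) _ _ (begin
  s * a + suc s * a
    ≡⟨ regroup s a ⟩
  suc (s + s) * a
    ≡⟨ cong (_* a) eq ⟨
  (k + d) * a
    ≡⟨ *-distribʳ-+ a k d ⟩
  k * a + d * a
    ≡⟨ cong (_+ d * a) (C-absorb k s) ⟨
  suc s * b + s * a + d * a
    ≡⟨ collect (suc s * b) (s * a) (d * a) ⟩
  s * a + (suc s * b + d * a) ∎)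
  where
  open ≡-Reasoning
  a = k C s
  b = k C suc s
  regroup : ∀ s a → s * a + suc s * a ≡ suc (s + s) * a
  regroup = solve-∀
  collect : ∀ x y z → x + y + z ≡ y + (x + z)
  collect = solve-∀

C-antitone : ∀ k s → k ≤ suc (s + s) → k C suc s ≤ k C s
C-antitone k s k≤ with m≤n⇒∃[o]m+o≡n k≤
... | d , eq = *-cancelˡ-≤ (suc s) (≤-by (d * (k C s)) (sym (C-drop k s d eq)))

C-antitone-+ : ∀ k s j → k ≤ suc (s + s) → k C (s + j) ≤ k C s
C-antitone-+ k s zero    k≤ = ≤-reflexive (cong (k C_) (+-identityʳ s))
C-antitone-+ k s (suc j) k≤ = begin
  k C (s + suc j)  ≡⟨ cong (k C_) (+-suc s j) ⟩
  k C suc (s + j)  ≤⟨ C-antitone k (s + j) (≤-trans k≤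
                        (s≤s (+-mono-≤ (m≤m+n s j) (m≤m+n s j)))) ⟩
  k C (s + j)      ≤⟨ C-antitone-+ k s j k≤ ⟩
  k C s            ∎
  where open ≤-Reasoning

-- Past the middle the j terms at s, ..., s + j - 1 are all at least the term that follows them.
binomialTail-lower : ∀ k s j → k ≤ suc (s + s) → j * (k C (s + j)) ≤ binomialTail k s
binomialTail-lower k s zero    k≤ = z≤n
binomialTail-lower k s (suc j) k≤ = begin
  k C (s + suc j) + j * (k C (s + suc j))
    ≤⟨ +-mono-≤ (C-antitone-+ k s (suc j) k≤) (≤-reflexive (cong (λ i → j * (k C i)) (+-suc s j))) ⟩
  k C s + j * (k C (suc s + j))
    ≤⟨ +-monoʳ-≤ (k C s) (binomialTail-lower k (suc s) j
         (≤-trans k≤ (s≤s (+-mono-≤ (n≤1+n s) (n≤1+n s))))) ⟩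
  k C s + binomialTail k (suc s)
    ≡⟨ binomialTail-step k s ⟨
  binomialTail k s ∎
  where open ≤-Reasoning

-- Σ_{j≥s} (2j − k) C(k,j) telescopes to s C(k,s).
binomialTail-upper : ∀ k s d → k + d ≡ s + s → d * binomialTail k s ≤ s * (k C s)
binomialTail-upper k s d = go (suc k) s d (m≤m+n (suc k) s)
  where
  open ≤-Reasoning
  -- The induction climbs from s towards s > k, where the tail is empty; `f` counts the remaining
  -- steps. Each step raises d = 2s - k by 2.
  go : ∀ f s d → k < f + s → k + d ≡ s + s → d * binomialTail k s ≤ s * (k C s)
  go zero    s d k<s _  = subst (λ a → d * a ≤ s * (k C s)) (sym (binomialTail≡0 k s k<s))
                            (subst (_≤ s * (k C s)) (sym (*-zeroʳ d)) z≤n)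
  go (suc f) s d k<  eq = begin
    d * binomialTail k s
      ≡⟨ cong (d *_) (binomialTail-step k s) ⟩
    d * (a + binomialTail k (suc s))
      ≡⟨ *-distribˡ-+ d a _ ⟩
    d * a + d * binomialTail k (suc s)
      ≤⟨ +-monoʳ-≤ (d * a) (*-monoˡ-≤ (binomialTail k (suc s)) (m≤n+m d 2)) ⟩
    d * a + suc (suc d) * binomialTail k (suc s)
      ≤⟨ +-monoʳ-≤ (d * a) (go f (suc s) (suc (suc d))
           (subst (k <_) (sym (+-suc f s)) k<) eq′) ⟩
    d * a + suc s * (k C suc s)
      ≡⟨ sum-eq ⟩
    s * a ∎
    where
    a = k C s
    regroup : ∀ k d → k + suc (suc d) ≡ suc (suc (k + d))
    regroup = solve-∀
    eq′ : k + suc (suc d) ≡ suc s + suc s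
    eq′ = trans (regroup k d) (trans (cong (suc ∘ suc) eq) (cong suc (sym (+-suc s s))))
    collect : ∀ x y z → x + (y + z) ≡ z + x + y
    collect = solve-∀
    sum-eq : d * a + suc s * (k C suc s) ≡ s * a
    sum-eq = +-cancelʳ-≡ (suc s * a) _ _ (begin-equality
      d * a + suc s * (k C suc s) + suc s * a
        ≡⟨ collect′ (d * a) (suc s * (k C suc s)) a s ⟩
      (suc s * (k C suc s) + suc d * a) + s * a
        ≡⟨ cong (_+ s * a) (C-drop k s (suc d) (trans (+-suc k d) (cong suc eq))) ⟨
      suc s * a + s * a
        ≡⟨ +-comm (suc s * a) (s * a) ⟩
      s * a + suc s * a ∎)
      where
      collect′ : ∀ x y a s → x + y + suc s * a ≡ (y + (a + x)) + s * a
      collect′ = solve-∀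

-- By `C-drop` the step at i ≥ s loses d/(i + 1) of C(k,i), which is at most b/(s + 1) of C(k,s),
-- because b bounds d = 2i + 1 - k on the whole range. The j losses are simply added.
C-decay : ∀ k s b j → k ≤ suc (s + s) → suc ((s + j) + (s + j)) ≤ k + b →
          suc s * (k C s) ≤ suc s * (k C (s + j)) + j * b * (k C s)
C-decay k s b zero    k≤ ≤b = ≤-reflexive (sym (trans (+-identityʳ _)
  (cong (λ i → suc s * (k C i)) (+-identityʳ s))))
C-decay k s b (suc j) k≤ ≤b = begin
  suc s * C₀
    ≤⟨ C-decay k s b j k≤ (≤-trans (s≤s (+-mono-≤ i≤ i≤)) ≤b) ⟩
  suc s * Cᵢ + j * b * C₀
    ≤⟨ +-monoˡ-≤ (j * b * C₀) (step (m≤n⇒∃[o]m+o≡n (C-antitone k i k≤i))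
                                    (m≤n⇒∃[o]m+o≡n k≤i)) ⟩
  suc s * (k C suc i) + b * C₀ + j * b * C₀
    ≡⟨ regroup (suc s * (k C suc i)) b C₀ j ⟩
  suc s * (k C suc i) + suc j * b * C₀
    ≡⟨ cong (λ m → suc s * (k C m) + suc j * b * C₀) (+-suc s j) ⟨
  suc s * (k C (s + suc j)) + suc j * b * C₀ ∎
  where
  open ≤-Reasoning
  i = s + j
  C₀ = k C s
  Cᵢ = k C i
  i≤ : s + j ≤ s + suc j
  i≤ = +-monoʳ-≤ s (n≤1+n j)
  k≤i : k ≤ suc (i + i)
  k≤i = ≤-trans k≤ (s≤s (+-mono-≤ (m≤m+n s j) (m≤m+n s j)))
  regroup : ∀ x b c j → x + b * c + j * b * c ≡ x + suc j * b * c
  regroup = solve-∀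
  step : (∃[ e ] k C suc i + e ≡ Cᵢ) → (∃[ d ] k + d ≡ suc (i + i)) →
         suc s * Cᵢ ≤ suc s * (k C suc i) + b * C₀
  step (e , Ceq) (d , keq) = begin
    suc s * Cᵢ
      ≡⟨ cong (suc s *_) Ceq ⟨
    suc s * (k C suc i + e)
      ≡⟨ *-distribˡ-+ (suc s) (k C suc i) e ⟩
    suc s * (k C suc i) + suc s * e
      ≤⟨ +-monoʳ-≤ _ (begin
        suc s * e ≤⟨ *-monoˡ-≤ e (s≤s (m≤m+n s j)) ⟩
        suc i * e ≡⟨ +-cancelˡ-≡ (suc i * (k C suc i)) _ _ (trans
                       (sym (*-distribˡ-+ (suc i) (k C suc i) e))
                       (trans (cong (suc i *_) Ceq) (C-drop k i d keq))) ⟩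
        d * Cᵢ    ≤⟨ *-mono-≤ d≤b (C-antitone-+ k s j k≤) ⟩
        b * C₀ ∎) ⟩
    suc s * (k C suc i) + b * C₀ ∎
    where
    d≤b : d ≤ b
    d≤b = +-cancelˡ-≤ k d b (≤-trans (≤-reflexive keq)
            (≤-trans (s≤s (+-mono-≤ i≤ i≤)) ≤b))

C-halving : ∀ k s b j → k ≤ suc (s + s) → suc ((s + j) + (s + j)) ≤ k + b →
            2 * (j * b) ≤ suc s → k C s ≤ 2 * (k C (s + j))
C-halving k s b j k≤ ≤b small = *-cancelˡ-≤ (suc s) (+-cancelʳ-≤ (suc s * a) _ _ (begin
  suc s * a + suc s * a
    ≤⟨ +-mono-≤ dec dec ⟩
  (suc s * c + j * b * a) + (suc s * c + j * b * a)
    ≡⟨ regroup (suc s) c (j * b) a ⟩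
  suc s * (2 * c) + 2 * (j * b) * a
    ≤⟨ +-monoʳ-≤ _ (*-monoˡ-≤ a small) ⟩
  suc s * (2 * c) + suc s * a ∎))
  where
  open ≤-Reasoning
  a = k C s
  c = k C (s + j)
  dec = C-decay k s b j k≤ ≤b
  regroup : ∀ s c x a → (s * c + x * a) + (s * c + x * a) ≡ s * (2 * c) + 2 * x * a
  regroup = solve-∀

-- Growth of the cap probability with the weight

binomialTail-step₂ : ∀ k s → binomialTail (2 + k) (2 + s) + k C suc s ≡ 4 * binomialTail k (suc s) + k C s
binomialTail-step₂ k s = begin
  -- The four outcomes of the two extra choices: the two mixed ones ask for s + 1 successes among
  -- the other k as before, two successes also admit j = s, and two failures exclude j = s + 1. So
  -- only C(k,s) and C(k,s+1) separate the tail from four times the old one.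
  (t₂ + t₁) + (t₁ + t₀) + c₁
    ≡⟨ cong (λ t → (t₂ + t₁) + (t₁ + t) + c₁) (binomialTail-step k s) ⟩
  (t₂ + t₁) + (t₁ + (c₀ + t₁)) + c₁
    ≡⟨ regroup t₁ t₂ c₀ c₁ ⟩
  3 * t₁ + c₀ + (c₁ + t₂)
    ≡⟨ cong (3 * t₁ + c₀ +_) (binomialTail-step k (suc s)) ⟨
  3 * t₁ + c₀ + t₁
    ≡⟨ collect t₁ c₀ ⟩
  4 * t₁ + c₀ ∎
  where
  open ≡-Reasoning
  t₀ = binomialTail k s
  t₁ = binomialTail k (suc s)
  t₂ = binomialTail k (2 + s)
  c₀ = k C s
  c₁ = k C suc s
  regroup : ∀ t₁ t₂ c₀ c₁ → (t₂ + t₁) + (t₁ + (c₀ + t₁)) + c₁ ≡ 3 * t₁ + c₀ + (c₁ + t₂)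
  regroup = solve-∀
  collect : ∀ t c → 3 * t + c + t ≡ 4 * t + c
  collect = solve-∀

-- 4^{-κ} cap κ is the probability that 2κ fair signs sum to at least 2(w′ + 1).
module Caps (w′ : ℕ) where
  w = suc w′

  cap : ℕ → ℕ
  cap κ = binomialTail (κ + κ) (κ + w)

  private
    cap-suc : ∀ κ → cap (suc κ) ≡ binomialTail (2 + (κ + κ)) (2 + (κ + w′))
    cap-suc κ = cong₂ binomialTail (cong suc (+-suc κ κ)) (cong suc (+-suc κ w′))

    cap-eq : ∀ κ → cap κ ≡ binomialTail (κ + κ) (suc (κ + w′))
    cap-eq κ = cong (binomialTail (κ + κ)) (+-suc κ w′)

    below : ∀ κ → κ + κ ≤ suc ((κ + w′) + (κ + w′))
    below κ = m≤n⇒m≤1+n (+-mono-≤ (m≤m+n κ w′) (m≤m+n κ w′))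

    cap-step : ∀ κ → let s = κ + w′ in
      cap (suc κ) + (κ + κ) C suc s ≡ 4 * cap κ + (κ + κ) C s
    cap-step κ = trans (cong (_+ (κ + κ) C suc (κ + w′)) (cap-suc κ))
      (trans (binomialTail-step₂ (κ + κ) (κ + w′))
             (cong (λ t → 4 * t + (κ + κ) C (κ + w′)) (sym (cap-eq κ))))

  cap-lower : ∀ κ → 4 * cap κ ≤ cap (suc κ)
  cap-lower κ = +-cancelʳ-≤ ((κ + κ) C suc s) _ _ (begin
    4 * cap κ + (κ + κ) C suc s   ≤⟨ +-monoʳ-≤ _ (C-antitone (κ + κ) s (below κ)) ⟩
    4 * cap κ + (κ + κ) C s       ≡⟨ cap-step κ ⟨
    cap (suc κ) + (κ + κ) C suc s ∎)
    where
    open ≤-Reasoning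
    s = κ + w′

  -- Two more signs add e = C(k,s) - C(k,s+1) to 4 · `cap κ`, and by `C-drop` this is d/(s + 1) of
  -- C(k,s) with d < 2w. The tail has J terms of size at least C(k,s)/2 by `C-halving`. Hence e/(4 ·
  -- `cap κ`) is at most w/(Jκ). A is kept separate from Jκ so that one A can serve all later κ.
  cap-upper : ∀ J κ → 2 * (suc J * (2 * w + 2 * J + 1)) ≤ κ → ∀ A → A ≤ J * κ →
              A * cap (suc κ) ≤ 4 * (A + w) * cap κ
  cap-upper J κ small A A≤ with m≤n⇒∃[o]m+o≡n (C-antitone (κ + κ) (κ + w′) (below κ))
  ... | e , eq = begin
    A * cap (suc κ)
      ≡⟨ cong (A *_) grow ⟩
    A * (4 * cap κ + e)
      ≡⟨ *-distribˡ-+ A (4 * cap κ) e ⟩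
    A * (4 * cap κ) + A * e
      ≤⟨ +-monoʳ-≤ (A * (4 * cap κ)) A*e≤ ⟩
    A * (4 * cap κ) + w * (4 * cap κ)
      ≡⟨ regroup A w (cap κ) ⟩
    4 * (A + w) * cap κ ∎
    where
    open ≤-Reasoning
    k = κ + κ
    s = κ + w′
    -- The values of 2i + 1 - k at the two ends of the range, i = s for `d` and i = s + J + 1 for
    -- `b`.
    d = suc (w′ + w′)
    b = 2 * w + 2 * J + 1
    regroup : ∀ A w c → A * (4 * c) + w * (4 * c) ≡ 4 * (A + w) * c
    regroup = solve-∀
    grow : cap (suc κ) ≡ 4 * cap κ + e
    grow = +-cancelʳ-≡ (k C suc s) _ _ (begin-equality
      cap (suc κ) + k C suc s         ≡⟨ cap-step κ ⟩
      4 * cap κ + k C s               ≡⟨ cong (4 * cap κ +_) eq ⟨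
      4 * cap κ + (k C suc s + e)     ≡⟨ cong (4 * cap κ +_) (+-comm (k C suc s) e) ⟩
      4 * cap κ + (e + k C suc s)     ≡⟨ +-assoc (4 * cap κ) e _ ⟨
      4 * cap κ + e + k C suc s       ∎)
    k+d : k + d ≡ suc (s + s)
    k+d = shape κ w′
      where
      shape : ∀ κ w → κ + κ + suc (w + w) ≡ suc ((κ + w) + (κ + w))
      shape = solve-∀
    s*e : suc s * e ≡ d * (k C s)
    s*e = +-cancelˡ-≡ (suc s * (k C suc s)) _ _ (trans
      (sym (*-distribˡ-+ (suc s) (k C suc s) e))
      (trans (cong (suc s *_) eq) (C-drop k s d k+d)))
    half : k C s ≤ 2 * (k C (s + suc J))
    half = C-halving k s b (suc J) (below κ) (≤-reflexive (shape κ w′ J))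
      (≤-trans small (m≤n⇒m≤1+n (m≤m+n κ w′)))
      where
      shape : ∀ κ w J → suc ((κ + w + suc J) + (κ + w + suc J))
            ≡ κ + κ + (2 * suc w + 2 * J + 1)
      shape = solve-∀
    J*C≤ : J * (k C s) ≤ 2 * cap κ
    J*C≤ = begin
      J * (k C s)                   ≤⟨ *-monoʳ-≤ J half ⟩
      J * (2 * (k C (s + suc J)))   ≡⟨ swap J (k C (s + suc J)) ⟩
      2 * (J * (k C (s + suc J)))   ≡⟨ cong (λ i → 2 * (J * (k C i))) (+-suc s J) ⟩
      2 * (J * (k C (suc s + J)))   ≤⟨ *-monoʳ-≤ 2 (binomialTail-lower k (suc s) J
                                         (≤-trans (below κ) (s≤s (+-mono-≤ (n≤1+n s) (n≤1+n s))))) ⟩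
      2 * binomialTail k (suc s)            ≡⟨ cong (2 *_) (cap-eq κ) ⟨
      2 * cap κ ∎
      where
      swap : ∀ J x → J * (2 * x) ≡ 2 * (J * x)
      swap = solve-∀
    A*e≤ : A * e ≤ w * (4 * cap κ)
    A*e≤ = begin
      A * e                  ≤⟨ *-monoˡ-≤ e A≤ ⟩
      J * κ * e              ≤⟨ *-monoˡ-≤ e (*-monoʳ-≤ J (m≤n⇒m≤1+n (m≤m+n κ w′))) ⟩
      J * suc s * e          ≡⟨ *-assoc J (suc s) e ⟩
      J * (suc s * e)        ≡⟨ cong (J *_) s*e ⟩
      J * (d * (k C s))      ≡⟨ swap J d (k C s) ⟩
      d * (J * (k C s))      ≤⟨ *-mono-≤ (≤-by 1 (shape w′)) J*C≤ ⟩
      2 * w * (2 * cap κ)    ≡⟨ four w (cap κ) ⟩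
      w * (4 * cap κ)        ∎
      where
      swap : ∀ J d x → J * (d * x) ≡ d * (J * x)
      swap = solve-∀
      shape : ∀ w → suc (w + w) + 1 ≡ 2 * suc w
      shape = solve-∀
      four : ∀ w c → 2 * w * (2 * c) ≡ w * (4 * c)
      four = solve-∀

  module Window (J κ : ℕ) (small : 2 * (suc J * (2 * w + 2 * J + 1)) ≤ κ)
                (J*κ>0 : 0 < J * κ) where

    cap-lower-+ : ∀ j → 4 ^ j * cap κ ≤ cap (κ + j)
    cap-lower-+ zero    = ≤-reflexive (trans (*-identityˡ (cap κ)) (cong cap (sym (+-identityʳ κ))))
    cap-lower-+ (suc j) = begin
      4 ^ suc j * cap κ    ≡⟨ *-assoc 4 (4 ^ j) (cap κ) ⟩
      4 * (4 ^ j * cap κ)  ≤⟨ *-monoʳ-≤ 4 (cap-lower-+ j) ⟩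
      4 * cap (κ + j)      ≤⟨ cap-lower (κ + j) ⟩
      cap (suc (κ + j))    ≡⟨ cong cap (+-suc κ j) ⟨
      cap (κ + suc j)      ∎
      where open ≤-Reasoning

    private
      A = J * κ

      linear⇒double : ∀ j → 2 * (j * w) ≤ A → A * cap (κ + j) ≤ 4 ^ j * ((A + 2 * (j * w)) * cap κ) →
                      cap (κ + j) ≤ 2 * 4 ^ j * cap κ
      linear⇒double j jw≤ bound = *-cancelˡ-≤ A {{>-nonZero J*κ>0}} (begin
        A * cap (κ + j)                       ≤⟨ bound ⟩
        4 ^ j * ((A + 2 * (j * w)) * cap κ)   ≤⟨ *-monoʳ-≤ (4 ^ j) (*-monoˡ-≤ (cap κ) (+-monoʳ-≤ A jw≤)) ⟩
        4 ^ j * ((A + A) * cap κ)             ≡⟨ regroup (4 ^ j) A (cap κ) ⟩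
        A * (2 * 4 ^ j * cap κ)               ∎)
        where
        open ≤-Reasoning
        regroup : ∀ p a c → p * ((a + a) * c) ≡ a * (2 * p * c)
        regroup = solve-∀

      -- Bernoulli: the growth factors 1 + w/A compound at most linearly, by a factor of 2 in all.
      cap-linear : ∀ j → 2 * (j * w) ≤ A → A * cap (κ + j) ≤ 4 ^ j * ((A + 2 * (j * w)) * cap κ)
      cap-linear zero    _ = ≤-reflexive (trans (cong (λ i → A * cap i) (+-identityʳ κ)) (shape A (cap κ)))
        where
        shape : ∀ a c → a * c ≡ 1 * ((a + 0) * c)
        shape = solve-∀
      cap-linear (suc j) jw≤ = begin
        A * cap (κ + suc j)
          ≡⟨ cong (λ i → A * cap i) (+-suc κ j) ⟩
        A * cap (suc (κ + j))
          ≤⟨ cap-upper J (κ + j) (≤-trans small (m≤m+n κ j)) A (*-monoʳ-≤ J (m≤m+n κ j)) ⟩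
        4 * (A + w) * cap (κ + j)
          ≡⟨ expand A w (cap (κ + j)) ⟩
        4 * (A * cap (κ + j) + w * cap (κ + j))
          ≤⟨ *-monoʳ-≤ 4 (+-mono-≤ IH (*-monoʳ-≤ w (linear⇒double j jw≤′ IH))) ⟩
        4 * (4 ^ j * ((A + 2 * (j * w)) * cap κ) + w * (2 * 4 ^ j * cap κ))
          ≡⟨ regroup A j w (4 ^ j) (cap κ) ⟩
        4 ^ suc j * ((A + 2 * (suc j * w)) * cap κ) ∎
        where
        open ≤-Reasoning
        jw≤′ : 2 * (j * w) ≤ A
        jw≤′ = ≤-trans (*-monoʳ-≤ 2 (m≤n+m (j * w) w)) jw≤
        IH = cap-linear j jw≤′
        expand : ∀ a w c → 4 * (a + w) * c ≡ 4 * (a * c + w * c)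
        expand = solve-∀
        regroup : ∀ A j w p c → 4 * (p * ((A + 2 * (j * w)) * c) + w * (2 * p * c))
                ≡ 4 * p * ((A + 2 * (suc j * w)) * c)
        regroup = solve-∀

    cap-upper-+ : ∀ j → 2 * (j * w) ≤ A → cap (κ + j) ≤ 2 * 4 ^ j * cap κ
    cap-upper-+ j jw≤ = linear⇒double j jw≤ (cap-linear j jw≤)

    -- s = ⌊(k + 2w)/2⌋ is the number of agreements at the border of the cap for weight
    -- k = 2κ + δ.
    record Threshold (δ : ℕ) : Set where
      field
        s      : ℕ
        s+s≤   : s + s ≤ (κ + κ + δ) + (w + w)
        ≤s+s   : (κ + κ + δ) + (w + w) ≤ suc (s + s)
        lower  : 2 ^ δ * cap κ ≤ binomialTail (κ + κ + δ) s
        upper  : binomialTail (κ + κ + δ) s ≤ 4 * (2 ^ δ * cap κ)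

    private
      2^[j+j] : ∀ j → 2 ^ (j + j) ≡ 4 ^ j
      2^[j+j] j = trans (cong (2 ^_) (cong (j +_) (sym (+-identityʳ j)))) (sym (^-*-assoc 2 2 j))

      even : ∀ j → 2 * (suc j * w) ≤ A → Threshold (j + j)
      even j jw≤ = record
        { s     = s
        ; s+s≤  = ≤-reflexive (shape κ w j)
        ; ≤s+s  = ≤-trans (≤-reflexive (sym (shape κ w j))) (n≤1+n _)
        ; lower = begin
            2 ^ (j + j) * cap κ  ≡⟨ cong (_* cap κ) (2^[j+j] j) ⟩
            4 ^ j * cap κ        ≤⟨ cap-lower-+ j ⟩
            cap (κ + j)          ≡⟨ cong (λ i → binomialTail i s) (+-interchange κ j κ j) ⟩
            binomialTail (κ + κ + (j + j)) s ∎
        ; upper = begin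
            binomialTail (κ + κ + (j + j)) s   ≡⟨ cong (λ i → binomialTail i s) (+-interchange κ j κ j) ⟨
            cap (κ + j)                ≤⟨ cap-upper-+ j (≤-trans (*-monoʳ-≤ 2 (m≤n+m (j * w) w)) jw≤) ⟩
            2 * 4 ^ j * cap κ          ≤⟨ *-monoˡ-≤ (cap κ) (*-monoˡ-≤ (4 ^ j) {2} {4} (s≤s (s≤s z≤n))) ⟩
            4 * 4 ^ j * cap κ          ≡⟨ *-assoc 4 (4 ^ j) (cap κ) ⟩
            4 * (4 ^ j * cap κ)        ≡⟨ cong (λ p → 4 * (p * cap κ)) (2^[j+j] j) ⟨
            4 * (2 ^ (j + j) * cap κ)  ∎
        }
        where
        open ≤-Reasoning
        s = κ + j + w
        shape : ∀ κ w j → (κ + j + w) + (κ + j + w) ≡ κ + κ + (j + j) + (w + w)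
        shape = solve-∀

      -- An odd weight is squeezed between its even neighbours 2(κ + j) and 2(κ + j + 1). Passing to
      -- the upper one costs a factor 2 on top of the 2 from `cap-upper-+`, hence the 4 in `upper`;
      -- it also needs room for j + 1 steps.
      odd : ∀ j → 2 * (suc j * w) ≤ A → Threshold (suc (j + j))
      odd j jw≤ = record
        { s     = s
        ; s+s≤  = ≤-trans (n≤1+n _) (≤-reflexive (shape κ w j))
        ; ≤s+s  = ≤-reflexive (sym (shape κ w j))
        ; lower = begin
            2 ^ suc (j + j) * cap κ            ≡⟨ cong (λ p → 2 * p * cap κ) (2^[j+j] j) ⟩
            2 * 4 ^ j * cap κ                  ≡⟨ double (4 ^ j) (cap κ) ⟩
            4 ^ j * cap κ + 4 ^ j * cap κ      ≤⟨ +-mono-≤ (cap-lower-+ j) (cap-lower-+ j) ⟩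
            cap (κ + j) + cap (κ + j)          ≡⟨ cong (λ t → t + t) (cap-eq (κ + j)) ⟩
            binomialTail k (suc s′) + binomialTail k (suc s′)  ≤⟨ +-monoʳ-≤ (binomialTail k (suc s′)) (≤-by (k C s′)
                                                    (trans (+-comm _ (k C s′)) (sym (binomialTail-step k s′)))) ⟩
            binomialTail (suc k) (suc s′)              ≡⟨ cong₂ binomialTail k-eq (sym (+-suc (κ + j) w′)) ⟩
            binomialTail (κ + κ + suc (j + j)) s ∎
        ; upper = begin
            binomialTail (κ + κ + suc (j + j)) s                         ≡⟨ cong₂ binomialTail (sym k-eq) (+-suc (κ + j) w′) ⟩
            binomialTail (suc k) (suc s′)                                ≤⟨ m≤n+m (binomialTail (suc k) (suc s′)) (binomialTail (suc k) (suc (suc s′))) ⟩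
            binomialTail (suc k) (suc (suc s′)) + binomialTail (suc k) (suc s′)  ≡⟨ cap-suc (κ + j) ⟨
            cap (suc (κ + j))                                    ≡⟨ cong cap (+-suc κ j) ⟨
            cap (κ + suc j)                                      ≤⟨ cap-upper-+ (suc j) jw≤ ⟩
            2 * 4 ^ suc j * cap κ                                ≡⟨ quad (4 ^ j) (cap κ) ⟩
            4 * (2 * 4 ^ j * cap κ)                              ≡⟨ cong (λ p → 4 * (2 * p * cap κ)) (2^[j+j] j) ⟨
            4 * (2 ^ suc (j + j) * cap κ)                        ∎
        }
        where
        open ≤-Reasoning
        k = (κ + j) + (κ + j)
        s = κ + j + w
        s′ = κ + j + w′
        shape : ∀ κ w j → suc ((κ + j + w) + (κ + j + w)) ≡ κ + κ + suc (j + j) + (w + w)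
        shape = solve-∀
        k-eq : suc k ≡ κ + κ + suc (j + j)
        k-eq = trans (cong suc (+-interchange κ j κ j)) (sym (+-suc (κ + κ) (j + j)))
        double : ∀ p c → 2 * p * c ≡ p * c + p * c
        double = solve-∀
        quad : ∀ p c → 2 * (4 * p) * c ≡ 4 * (2 * p * c)
        quad = solve-∀

    threshold : ∀ δ → suc (suc δ) * w ≤ A → Threshold δ
    threshold δ δw≤ with halve δ
      where
      halve : ∀ δ → ∃[ j ] (δ ≡ j + j ⊎ δ ≡ suc (j + j))
      halve zero    = 0 , inj₁ refl
      halve (suc δ) with halve δ
      ... | j , inj₁ eq = j , inj₂ (cong suc eq)
      ... | j , inj₂ eq = suc j , inj₁ (cong suc (trans eq (sym (+-suc j j))))
    ... | j , inj₁ refl = even j (≤-trans (≤-reflexive (shape j w)) δw≤)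
      where
      shape : ∀ j w → 2 * (suc j * w) ≡ suc (suc (j + j)) * w
      shape = solve-∀
    ... | j , inj₂ refl = odd j (≤-trans (≤-by w (shape j w)) δw≤)
      where
      shape : ∀ j w → 2 * (suc j * w) + w ≡ suc (suc (suc (j + j))) * w
      shape = solve-∀

-- Sums over lists

private variable
  A B E : Set

sumOver : List A → (A → ℕ) → ℕ
sumOver []       f = 0
sumOver (x ∷ xs) f = f x + sumOver xs f

infix 6 sumOver
syntax sumOver xs (λ x → e) = ∑[ x ∈ xs ] e

∑-cong : ∀ (xs : List A) {f g : A → ℕ} → (∀ x → f x ≡ g x) → sumOver xs f ≡ sumOver xs g
∑-cong []       f≗g = refl
∑-cong (x ∷ xs) f≗g = cong₂ _+_ (f≗g x) (∑-cong xs f≗g)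

∑-mono : ∀ (xs : List A) {f g : A → ℕ} → (∀ x → f x ≤ g x) → sumOver xs f ≤ sumOver xs g
∑-mono []       f≤g = z≤n
∑-mono (x ∷ xs) f≤g = +-mono-≤ (f≤g x) (∑-mono xs f≤g)

∑-+ : ∀ (xs : List A) (f g : A → ℕ) → sumOver xs (λ x → f x + g x) ≡ sumOver xs f + sumOver xs g
∑-+ []       f g = refl
∑-+ (x ∷ xs) f g = trans (cong (f x + g x +_) (∑-+ xs f g)) (+-interchange (f x) (g x) _ _)

∑-const : ∀ (xs : List A) c → sumOver xs (λ _ → c) ≡ List.length xs * c
∑-const []       c = refl
∑-const (x ∷ xs) c = cong (c +_) (∑-const xs c)

∑-*ˡ : ∀ (xs : List A) c (f : A → ℕ) → sumOver xs (λ x → c * f x) ≡ c * sumOver xs f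
∑-*ˡ []       c f = sym (*-zeroʳ c)
∑-*ˡ (x ∷ xs) c f = trans (cong (c * f x +_) (∑-*ˡ xs c f)) (sym (*-distribˡ-+ c (f x) _))

∑-*ʳ : ∀ (xs : List A) c (f : A → ℕ) → sumOver xs (λ x → f x * c) ≡ sumOver xs f * c
∑-*ʳ xs c f = trans (∑-cong xs (λ x → *-comm (f x) c)) (trans (∑-*ˡ xs c f) (*-comm c _))

∑-swap : ∀ (xs : List A) (ys : List B) (f : A → B → ℕ) →
         ∑[ x ∈ xs ] ∑[ y ∈ ys ] f x y ≡ ∑[ y ∈ ys ] ∑[ x ∈ xs ] f x y
∑-swap []       ys f = sym (trans (∑-const ys 0) (*-zeroʳ (List.length ys)))
∑-swap (x ∷ xs) ys f = trans (cong (sumOver ys (f x) +_) (∑-swap xs ys f))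
                             (sym (∑-+ ys (f x) (λ y → sumOver xs (λ x′ → f x′ y))))

∑-++ : ∀ (xs ys : List A) (f : A → ℕ) → sumOver (xs ++ ys) f ≡ sumOver xs f + sumOver ys f
∑-++ []       ys f = refl
∑-++ (x ∷ xs) ys f = trans (cong (f x +_) (∑-++ xs ys f)) (sym (+-assoc (f x) _ _))

∑-map : ∀ (h : A → B) xs (f : B → ℕ) → sumOver (List.map h xs) f ≡ sumOver xs (f ∘ h)
∑-map h []       f = refl
∑-map h (x ∷ xs) f = cong (f (h x) +_) (∑-map h xs f)

∑-cartesian : ∀ (h : A → B → E) xs ys (f : E → ℕ) →
  sumOver (List.cartesianProductWith h xs ys) f ≡ ∑[ x ∈ xs ] ∑[ y ∈ ys ] f (h x y)
∑-cartesian h []       ys f = refl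
∑-cartesian h (x ∷ xs) ys f =
  trans (∑-++ (List.map (h x) ys) _ f)
        (cong₂ _+_ (∑-map (h x) ys f) (∑-cartesian h xs ys f))

∑-product : ∀ (xs : List A) (ys : List B) (f : A → ℕ) (g : B → ℕ) →
  ∑[ x ∈ xs ] ∑[ y ∈ ys ] f x * g y ≡ sumOver xs f * sumOver ys g
∑-product xs ys f g =
  trans (∑-cong xs (λ x → ∑-*ˡ ys (f x) g)) (∑-*ʳ xs (sumOver ys g) f)

diagonal≤ : ∀ (xs : List A) (f : A → A → ℕ) →
  ∑[ x ∈ xs ] f x x ≤ ∑[ x ∈ xs ] ∑[ y ∈ xs ] f x y
diagonal≤ []       f = z≤n
diagonal≤ (x ∷ xs) f = +-mono-≤ (m≤m+n (f x x) _) (begin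
  ∑[ y ∈ xs ] f y y
    ≤⟨ diagonal≤ xs f ⟩
  ∑[ y ∈ xs ] ∑[ z ∈ xs ] f y z
    ≤⟨ ∑-mono xs (λ y → m≤n+m _ (f y x)) ⟩
  ∑[ y ∈ xs ] (f y x + (∑[ z ∈ xs ] f y z)) ∎)
  where open ≤-Reasoning

above-average : ∀ c (f : A → ℕ) xs → 0 < List.length xs →
                List.length xs * c ≤ sumOver xs f → ∃[ x ] c ≤ f x
above-average c f (x ∷ xs) _ le with c ≤? f x
... | yes c≤fx = x , c≤fx
above-average c f (x ∷ [])         _ le | no c≰fx = contradiction
  (subst₂ _≤_ (*-identityˡ c) (+-identityʳ (f x)) le) c≰fx
above-average c f (x ∷ xs@(_ ∷ _)) _ le | no c≰fx =
  above-average c f xs (s≤s z≤n) (+-cancelˡ-≤ c _ _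
    (≤-trans le (+-monoˡ-≤ (sumOver xs f) (<⇒≤ (≰⇒> c≰fx)))))

-- Families of m entries, and how often they separate two predicates

tuples : List A → ∀ m → List (Vec A m)
tuples xs zero    = [] ∷ []
tuples xs (suc m) = List.cartesianProductWith _∷_ xs (tuples xs m)

∑-tuples : ∀ (xs : List A) m (f : Vec A (suc m) → ℕ) →
  sumOver (tuples xs (suc m)) f ≡ ∑[ x ∈ xs ] ∑[ v ∈ tuples xs m ] f (x ∷ v)
∑-tuples xs m f = ∑-cartesian _∷_ xs (tuples xs m) f

length≡∑ : ∀ (xs : List A) → List.length xs ≡ sumOver xs (λ _ → 1)
length≡∑ xs = sym (trans (∑-const xs 1) (*-identityʳ _))

length-tuples : ∀ (xs : List A) m → List.length (tuples xs m) ≡ List.length xs ^ m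
length-tuples xs zero    = refl
length-tuples xs (suc m) = begin
  List.length (tuples xs (suc m))
    ≡⟨ length≡∑ (tuples xs (suc m)) ⟩
  sumOver (tuples xs (suc m)) (λ _ → 1)
    ≡⟨ ∑-tuples xs m _ ⟩
  ∑[ x ∈ xs ] ∑[ v ∈ tuples xs m ] 1
    ≡⟨ ∑-cong xs (λ _ → trans (sym (length≡∑ (tuples xs m))) (length-tuples xs m)) ⟩
  ∑[ x ∈ xs ] List.length xs ^ m
    ≡⟨ ∑-const xs _ ⟩
  List.length xs * List.length xs ^ m ∎
  where open ≡-Reasoning

-- This is (1 - Q/N)^m ≥ 1 - mQ/N for N = Y + Q, multiplied by N^(m+1). It acts as a union bound:
-- mQ/N bounds the chance that one of m entries is among Q bad ones.
bernoulli : ∀ Y Q m → (Y + Q) * (Y + Q) ^ m ≤ (Y + Q) * Y ^ m + m * Q * (Y + Q) ^ m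
bernoulli Y Q zero    = ≤-reflexive (sym (+-identityʳ _))
bernoulli Y Q (suc m) = begin
  N * (N * N ^ m)
    ≤⟨ *-monoʳ-≤ N (bernoulli Y Q m) ⟩
  N * (N * Y ^ m + m * Q * N ^ m)
    ≡⟨ expand Y Q (Y ^ m) m (N ^ m) ⟩
  N * (Y * Y ^ m) + Q * (N * Y ^ m) + m * Q * (N * N ^ m)
    ≤⟨ +-monoˡ-≤ _ (+-monoʳ-≤ (N * (Y * Y ^ m))
         (*-monoʳ-≤ Q (*-monoʳ-≤ N (^-monoˡ-≤ m (m≤m+n Y Q))))) ⟩
  N * (Y * Y ^ m) + Q * (N * N ^ m) + m * Q * (N * N ^ m)
    ≡⟨ collect (N * (Y * Y ^ m)) Q (N * N ^ m) m ⟩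
  N * Y ^ suc m + suc m * Q * N ^ suc m ∎
  where
  open ≤-Reasoning
  N = Y + Q
  expand : ∀ Y Q y m p → (Y + Q) * ((Y + Q) * y + m * Q * p)
         ≡ (Y + Q) * (Y * y) + Q * ((Y + Q) * y) + m * Q * ((Y + Q) * p)
  expand = solve-∀
  collect : ∀ a Q p m → a + Q * p + m * Q * p ≡ a + suc m * Q * p
  collect = solve-∀

bernoulli-½ : ∀ Y Q m → 0 < Y + Q → 2 * (m * Q) ≤ Y + Q → (Y + Q) ^ m ≤ 2 * Y ^ m
bernoulli-½ Y Q m N>0 small = *-cancelˡ-≤ N {{>-nonZero N>0}} (+-cancelʳ-≤ (N * N ^ m) _ _ (begin
  N * N ^ m + N * N ^ m
    ≤⟨ +-mono-≤ (bernoulli Y Q m) (bernoulli Y Q m) ⟩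
  (N * Y ^ m + m * Q * N ^ m) + (N * Y ^ m + m * Q * N ^ m)
    ≡⟨ regroup N (Y ^ m) (m * Q) (N ^ m) ⟩
  N * (2 * Y ^ m) + 2 * (m * Q) * N ^ m
    ≤⟨ +-monoʳ-≤ _ (*-monoˡ-≤ (N ^ m) small) ⟩
  N * (2 * Y ^ m) + N * N ^ m ∎))
  where
  open ≤-Reasoning
  N = Y + Q
  regroup : ∀ N y q p → (N * y + q * p) + (N * y + q * p) ≡ N * (2 * y) + 2 * q * p
  regroup = solve-∀

avoids : (A → Bool) → ∀ {m} → Vec A m → Bool
avoids p []      = true
avoids p (v ∷ L) = not (p v) ∧ avoids p L

module _ (V : List A) (p p′ : A → Bool) where
  private
    N X Y Q : ℕ
    N = List.length V
    X = ∑[ v ∈ V ] 𝟙 (p v xor p′ v)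
    Y = ∑[ v ∈ V ] 𝟙 (not (p v ∨ p′ v))
    Q = ∑[ v ∈ V ] 𝟙 (p v ∨ p′ v)

    Y+Q≡N : Y + Q ≡ N
    Y+Q≡N = trans (sym (∑-+ V _ _))
      (trans (∑-cong V (λ v → compl (p v ∨ p′ v))) (sym (length≡∑ V)))
      where
      compl : ∀ b → 𝟙 (not b) + 𝟙 b ≡ 1
      compl true  = refl
      compl false = refl

    both : ∀ {m} → Vec A m → ℕ
    both L = 𝟙 (avoids p L ∧ avoids p′ L)

    differ : ∀ {m} → Vec A m → ℕ
    differ L = 𝟙 (avoids p L xor avoids p′ L)

    ∑both : ∀ m → sumOver (tuples V m) both ≡ Y ^ m
    ∑both zero    = refl
    ∑both (suc m) = begin
      sumOver (tuples V (suc m)) both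
        ≡⟨ ∑-tuples V m both ⟩
      ∑[ v ∈ V ] ∑[ L ∈ tuples V m ] both (v ∷ L)
        ≡⟨ ∑-cong V (λ v → ∑-cong (tuples V m) λ L →
             pointwise (p v) (p′ v) (avoids p L) (avoids p′ L)) ⟩
      ∑[ v ∈ V ] ∑[ L ∈ tuples V m ] 𝟙 (not (p v ∨ p′ v)) * both L
        ≡⟨ ∑-product V (tuples V m) _ both ⟩
      Y * sumOver (tuples V m) both
        ≡⟨ cong (Y *_) (∑both m) ⟩
      Y * Y ^ m ∎
      where
      open ≡-Reasoning
      pointwise : ∀ a a′ b b′ →
        𝟙 ((not a ∧ b) ∧ (not a′ ∧ b′)) ≡ 𝟙 (not (a ∨ a′)) * 𝟙 (b ∧ b′)
      pointwise true  a′    b     b′ = refl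
      pointwise false true  true  b′ = refl
      pointwise false true  false b′ = refl
      pointwise false false b     b′ = sym (+-identityʳ _)

    -- Two disjoint cases for the first entry: it separates the predicates and all others avoid
    -- both, or it avoids both and the others already differ. Iterated in `∑differ`, the separating
    -- entry gets m + 1 possible places, with nothing counted twice.
    ∑differ-suc : ∀ m → X * Y ^ m + Y * sumOver (tuples V m) differ ≤ sumOver (tuples V (suc m)) differ
    ∑differ-suc m = begin
      X * Y ^ m + Y * sumOver (tuples V m) differ
        ≡⟨ cong₂ _+_ (cong (X *_) (sym (∑both m))) refl ⟩
      X * sumOver (tuples V m) both + Y * sumOver (tuples V m) differ
        ≡⟨ cong₂ _+_ (∑-product V (tuples V m) _ both) (∑-product V (tuples V m) _ differ) ⟨
      (∑[ v ∈ V ] ∑[ L ∈ tuples V m ] 𝟙 (p v xor p′ v) * both L) +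
      (∑[ v ∈ V ] ∑[ L ∈ tuples V m ] 𝟙 (not (p v ∨ p′ v)) * differ L)
        ≡⟨ ∑-+ V _ _ ⟨
      ∑[ v ∈ V ] ((∑[ L ∈ tuples V m ] 𝟙 (p v xor p′ v) * both L) +
                  (∑[ L ∈ tuples V m ] 𝟙 (not (p v ∨ p′ v)) * differ L))
        ≡⟨ ∑-cong V (λ v → ∑-+ (tuples V m) _ _) ⟨
      ∑[ v ∈ V ] ∑[ L ∈ tuples V m ]
        (𝟙 (p v xor p′ v) * both L + 𝟙 (not (p v ∨ p′ v)) * differ L)
        ≤⟨ ∑-mono V (λ v → ∑-mono (tuples V m) λ L →
             pointwise (p v) (p′ v) (avoids p L) (avoids p′ L)) ⟩
      ∑[ v ∈ V ] ∑[ L ∈ tuples V m ] differ (v ∷ L)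
        ≡⟨ ∑-tuples V m differ ⟨
      sumOver (tuples V (suc m)) differ ∎
      where
      open ≤-Reasoning
      pointwise : ∀ a a′ b b′ →
        𝟙 (a xor a′) * 𝟙 (b ∧ b′) + 𝟙 (not (a ∨ a′)) * 𝟙 (b xor b′)
          ≤ 𝟙 ((not a ∧ b) xor (not a′ ∧ b′))
      pointwise true  true  b     b′    = z≤n
      pointwise true  false true  true  = s≤s z≤n
      pointwise true  false true  false = z≤n
      pointwise true  false false b′    = z≤n
      pointwise false true  true  true  = s≤s z≤n
      pointwise false true  true  false = z≤n
      pointwise false true  false b′    = z≤n
      pointwise false false b     b′    = ≤-reflexive (+-identityʳ _)

    ∑differ : ∀ m → suc m * (X * Y ^ m) ≤ sumOver (tuples V (suc m)) differ
    ∑differ zero    = ≤-trans (≤-reflexive (shape X Y)) (∑differ-suc 0)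
      where
      shape : ∀ X Y → 1 * (X * 1) ≡ X * 1 + Y * 0
      shape = solve-∀
    ∑differ (suc m) = begin
      suc (suc m) * (X * (Y * Y ^ m))
        ≡⟨ regroup m X Y (Y ^ m) ⟩
      X * (Y * Y ^ m) + Y * (suc m * (X * Y ^ m))
        ≤⟨ +-monoʳ-≤ _ (*-monoʳ-≤ Y (∑differ m)) ⟩
      X * Y ^ suc m + Y * sumOver (tuples V (suc m)) differ
        ≤⟨ ∑differ-suc (suc m) ⟩
      sumOver (tuples V (suc (suc m))) differ ∎
      where
      open ≤-Reasoning
      regroup : ∀ m X Y y → suc (suc m) * (X * (Y * y)) ≡ X * (Y * y) + Y * (suc m * (X * y))
      regroup = solve-∀

  -- Bounds the tuples in which one entry separates p from p′ and the others avoid both.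
  separating-tuples : ∀ m → 0 < N → 2 * (m * Q) ≤ N →
    m * X * N ^ m ≤ 2 * N * (∑[ L ∈ tuples V m ] 𝟙 (avoids p L xor avoids p′ L))
  separating-tuples zero    _   _     = z≤n
  separating-tuples (suc m) N>0 small = begin
    suc m * X * (N * N ^ m)
      ≤⟨ *-monoʳ-≤ (suc m * X) (*-monoʳ-≤ N N^m≤) ⟩
    suc m * X * (N * (2 * Y ^ m))
      ≡⟨ regroup m X N (Y ^ m) ⟩
    2 * N * (suc m * (X * Y ^ m))
      ≤⟨ *-monoʳ-≤ (2 * N) (∑differ m) ⟩
    2 * N * sumOver (tuples V (suc m)) differ ∎
    where
    open ≤-Reasoning
    regroup : ∀ m X N y → suc m * X * (N * (2 * y)) ≡ 2 * N * (suc m * (X * y))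
    regroup = solve-∀
    N^m≤ : N ^ m ≤ 2 * Y ^ m
    N^m≤ = subst (λ M → M ^ m ≤ 2 * Y ^ m) Y+Q≡N (bernoulli-½ Y Q m
      (subst (0 <_) (sym Y+Q≡N) N>0)
      (subst (2 * (m * Q) ≤_) (sym Y+Q≡N)
        (≤-trans (*-monoʳ-≤ 2 (m≤n+m (m * Q) Q)) small)))

-- Caps and the edges they cut

Signs : ℕ → Set
Signs = Vec Bool

bools : List Bool
bools = true ∷ false ∷ []

signs : ∀ n → List (Signs n)
signs = tuples bools

nonzero : Trit → ℕ
nonzero 0ᵗ = 0
nonzero _  = 1

weight zeros : ∀ {n} → Cube n → ℕ
weight []       = 0
weight (a ∷ x)  = nonzero a + weight x
zeros  []       = 0
zeros  (a ∷ x)  = (1 ∸ nonzero a) + zeros x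

match : Bool → Trit → ℕ
match true  1ᵗ  = 1
match false -1ᵗ = 1
match _     _   = 0

agree : ∀ {n} → Signs n → Cube n → ℕ
agree []      []      = 0
agree (b ∷ v) (a ∷ x) = match b a + agree v x

weight+zeros : ∀ {n} (x : Cube n) → weight x + zeros x ≡ n
weight+zeros []        = refl
weight+zeros (-1ᵗ ∷ x) = cong suc (weight+zeros x)
weight+zeros (0ᵗ ∷ x)  = trans (+-suc (weight x) (zeros x)) (cong suc (weight+zeros x))
weight+zeros (1ᵗ ∷ x)  = cong suc (weight+zeros x)

-- Points at distance 1 differ in one coordinate, where exactly one of them has a 0. Every edge
-- therefore has one orientation of this kind, from the 0 to the ±1.
data _⋖_ : ∀ {n} → Cube n → Cube n → Set where
  0⋖-1 : ∀ {n} {x : Cube n} → (0ᵗ ∷ x) ⋖ (-1ᵗ ∷ x)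
  0⋖1 : ∀ {n} {x : Cube n} → (0ᵗ ∷ x) ⋖ (1ᵗ ∷ x)
  _∷_ : ∀ {n} a {x x′ : Cube n} → x ⋖ x′ → (a ∷ x) ⋖ (a ∷ x′)

⋖-weight : ∀ {n} {x x′ : Cube n} → x ⋖ x′ → weight x′ ≡ suc (weight x)
⋖-weight 0⋖-1            = refl
⋖-weight 0⋖1            = refl
⋖-weight (_∷_ a {x} x⋖) = trans (cong (nonzero a +_) (⋖-weight x⋖)) (+-suc (nonzero a) (weight x))

∑-signs : ∀ n (f : Signs (suc n) → ℕ) → sumOver (signs (suc n)) f ≡
          (∑[ v ∈ signs n ] f (true ∷ v)) + (∑[ v ∈ signs n ] f (false ∷ v))
∑-signs n f = trans (∑-tuples bools n f)
  (cong ((∑[ v ∈ signs n ] f (true ∷ v)) +_) (+-identityʳ _))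

-- For random v the signs at the zeros of x are free, and each of the others agrees with x with
-- probability 1/2, so the number of agreements is binomial. This is why only the weight of x
-- matters.
∑-agree : ∀ {n} (x : Cube n) (f : ℕ → ℕ) →
          ∑[ v ∈ signs n ] f (agree v x) ≡ 2 ^ zeros x * binomialSum (weight x) f
∑-agree []            f = refl
∑-agree {suc n} (-1ᵗ ∷ x) f = trans (∑-signs n (λ v → f (agree v (-1ᵗ ∷ x))))
  (trans (cong₂ _+_ (∑-agree x f) (∑-agree x (f ∘ suc))) (sym (*-distribˡ-+ (2 ^ zeros x) _ _)))
∑-agree {suc n} (1ᵗ ∷ x)  f = trans (∑-signs n (λ v → f (agree v (1ᵗ ∷ x))))
  (trans (cong₂ _+_ (∑-agree x (f ∘ suc)) (∑-agree x f))
    (trans (+-comm (2 ^ zeros x * binomialSum (weight x) (f ∘ suc)) _)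
           (sym (*-distribˡ-+ (2 ^ zeros x) _ _))))
∑-agree {suc n} (0ᵗ ∷ x)  f = trans (∑-signs n (λ v → f (agree v (0ᵗ ∷ x))))
  (trans (cong₂ _+_ (∑-agree x f) (∑-agree x f)) (double (2 ^ zeros x) (binomialSum (weight x) f)))
  where
  double : ∀ p b → p * b + p * b ≡ 2 * p * b
  double = solve-∀

-- The sign of v in the changing coordinate is independent of `agree v x` and decides whether x′
-- gains an agreement. The two summands are its two values, so the power of 2 counts only the zeros
-- of x′.
∑-agree₂ : ∀ {n} {x x′ : Cube n} → x ⋖ x′ → (f : ℕ → ℕ → ℕ) →
  ∑[ v ∈ signs n ] f (agree v x) (agree v x′) ≡
  2 ^ zeros x′ * binomialSum (weight x) (λ j → f j j + f j (suc j))
∑-agree₂ {suc n} (0⋖-1 {x = x}) f =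
  trans (∑-signs n (λ v → f (agree v (0ᵗ ∷ x)) (agree v (-1ᵗ ∷ x))))
  (trans (sym (∑-+ (signs n) _ _)) (∑-agree x (λ j → f j j + f j (suc j))))
∑-agree₂ {suc n} (0⋖1 {x = x}) f =
  trans (∑-signs n (λ v → f (agree v (0ᵗ ∷ x)) (agree v (1ᵗ ∷ x))))
  (trans (+-comm (∑[ v ∈ signs n ] f (agree v x) (suc (agree v x))) _)
  (trans (sym (∑-+ (signs n) _ _)) (∑-agree x (λ j → f j j + f j (suc j)))))
∑-agree₂ {suc n} (_∷_ -1ᵗ {x} {x′} x⋖) f =
  trans (∑-signs n (λ v → f (agree v (-1ᵗ ∷ x)) (agree v (-1ᵗ ∷ x′))))
  (trans (cong₂ _+_ (∑-agree₂ x⋖ f) (∑-agree₂ x⋖ (λ i j → f (suc i) (suc j))))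
         (sym (*-distribˡ-+ (2 ^ zeros x′) _ _)))
∑-agree₂ {suc n} (_∷_ 1ᵗ {x} {x′} x⋖)  f =
  trans (∑-signs n (λ v → f (agree v (1ᵗ ∷ x)) (agree v (1ᵗ ∷ x′))))
  (trans (cong₂ _+_ (∑-agree₂ x⋖ (λ i j → f (suc i) (suc j))) (∑-agree₂ x⋖ f))
  (trans (+-comm (2 ^ zeros x′ * binomialSum (weight x) (λ j → f (suc j) (suc j) + f (suc j) (suc (suc j)))) _)
         (sym (*-distribˡ-+ (2 ^ zeros x′) _ _))))
∑-agree₂ {suc n} (_∷_ 0ᵗ {x} {x′} x⋖)  f =
  trans (∑-signs n (λ v → f (agree v (0ᵗ ∷ x)) (agree v (0ᵗ ∷ x′))))
  (trans (cong₂ _+_ (∑-agree₂ x⋖ f) (∑-agree₂ x⋖ f))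
         (double (2 ^ zeros x′) (binomialSum (weight x) (λ j → f j j + f j (suc j)))))
  where
  double : ∀ p b → p * b + p * b ≡ 2 * p * b
  double = solve-∀

length-signs : ∀ n → List.length (signs n) ≡ 2 ^ n
length-signs n = length-tuples bools n

-- Since agreements minus disagreements is 2 agree − weight, this says ⟨v, x⟩ ≥ t.
inCap : ∀ {n} → ℕ → Signs n → Cube n → Bool
inCap t v x = weight x + t ≤ᵇ agree v x + agree v x

≤ᵇ-true : ∀ {m n} → m ≤ n → (m ≤ᵇ n) ≡ true
≤ᵇ-true m≤n = Equivalence.to T-≡ (≤⇒≤ᵇ m≤n)

≤ᵇ-false : ∀ {m n} → ¬ m ≤ n → (m ≤ᵇ n) ≡ false
≤ᵇ-false {m} {n} m≰n with m ≤ᵇ n in eq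
... | true  = contradiction (≤ᵇ⇒≤ m n (Equivalence.from T-≡ eq)) m≰n
... | false = refl

module _ {n} {x x′ : Cube n} (x⋖x′ : x ⋖ x′) (t s : ℕ)
         (s+s≤ : s + s ≤ weight x + t) (≤s+s : weight x + t ≤ suc (s + s)) where
  private
    k = weight x

    zeros-eq : zeros x ≡ suc (zeros x′)
    zeros-eq = +-cancelˡ-≡ (weight x) _ _ (trans (weight+zeros x)
      (trans (sym (weight+zeros x′)) (trans (cong (_+ zeros x′) (⋖-weight x⋖x′))
        (sym (+-suc (weight x) (zeros x′))))))

    hit : ℕ → Bool
    hit j = k + t ≤ᵇ j + j

    hit′ : ℕ → Bool
    hit′ j = suc k + t ≤ᵇ j + j

    ∑-edge : (h : Bool → Bool → Bool) →
      ∑[ v ∈ signs n ] 𝟙 (h (inCap t v x) (inCap t v x′)) ≡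
      2 ^ zeros x′ * binomialSum k (λ j → 𝟙 (h (hit j) (hit′ j)) + 𝟙 (h (hit j) (hit′ (suc j))))
    ∑-edge h = trans
      (∑-cong (signs n) (λ v → cong (λ w → 𝟙 (h (inCap t v x) (w + t ≤ᵇ agree v x′ + agree v x′)))
                                    (⋖-weight x⋖x′)))
      (∑-agree₂ x⋖x′ (λ i j → 𝟙 (h (hit i) (hit′ j))))

    -- Even the extra agreement does not bring x′ into the cap: 2(j + 1) ≤ 2s ≤ k + t < (k + 1) + t.
    -- Thus the tail at s, defined from x alone, also bounds the caps that meet only x′.
    miss : ∀ j → j < s → hit j ≡ false × hit′ j ≡ false × hit′ (suc j) ≡ false
    miss j j<s =
        ≤ᵇ-false (<⇒≱ 2j<)
      , ≤ᵇ-false (<⇒≱ (m<n⇒m<1+n 2j<))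
      , ≤ᵇ-false (<⇒≱ (s≤s (≤-trans (+-mono-≤ j<s j<s) s+s≤)))
      where
      2j< : j + j < k + t
      2j< = <-≤-trans (+-mono-< j<s j<s) s+s≤

  touched-upper : ∑[ v ∈ signs n ] 𝟙 (inCap t v x ∨ inCap t v x′) ≤ 2 ^ zeros x * binomialTail k s
  touched-upper = begin
    ∑[ v ∈ signs n ] 𝟙 (inCap t v x ∨ inCap t v x′)
      ≡⟨ ∑-edge _∨_ ⟩
    2 ^ zeros x′ * binomialSum k (λ j → 𝟙 (hit j ∨ hit′ j) + 𝟙 (hit j ∨ hit′ (suc j)))
      ≤⟨ *-monoʳ-≤ (2 ^ zeros x′) (binomialSum-mono k pointwise) ⟩
    2 ^ zeros x′ * binomialSum k (λ j → 𝟙 (not (j <ᵇ s)) + 𝟙 (not (j <ᵇ s)))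
      ≡⟨ cong (2 ^ zeros x′ *_) (binomialSum-+ k _ _) ⟩
    2 ^ zeros x′ * (binomialTail k s + binomialTail k s)
      ≡⟨ double (2 ^ zeros x′) (binomialTail k s) ⟩
    2 ^ suc (zeros x′) * binomialTail k s
      ≡⟨ cong (λ z → 2 ^ z * binomialTail k s) zeros-eq ⟨
    2 ^ zeros x * binomialTail k s ∎
    where
    open ≤-Reasoning
    double : ∀ p a → p * (a + a) ≡ 2 * p * a
    double = solve-∀
    pointwise : ∀ j → 𝟙 (hit j ∨ hit′ j) + 𝟙 (hit j ∨ hit′ (suc j))
                    ≤ 𝟙 (not (j <ᵇ s)) + 𝟙 (not (j <ᵇ s))
    pointwise j with j <ᵇ s in eq
    ... | false = +-mono-≤ (𝟙≤1 (hit j ∨ hit′ j)) (𝟙≤1 (hit j ∨ hit′ (suc j)))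
    ... | true with miss j (<ᵇ⇒< j s (Equivalence.from T-≡ eq))
    ... | e₁ , e₂ , e₃ rewrite e₁ | e₂ | e₃ = z≤n

  -- A vector with agree v x = s has x on the border of its cap, and exactly one of
  -- the two possible signs of v in the changing coordinate makes it cut the edge.
  crossing-lower : 2 ^ zeros x * (k C s) ≤ 2 * (∑[ v ∈ signs n ] 𝟙 (inCap t v x xor inCap t v x′))
  crossing-lower = begin
    2 ^ zeros x * (k C s)
      ≡⟨ cong (λ z → 2 ^ z * (k C s)) zeros-eq ⟩
    2 * 2 ^ zeros x′ * (k C s)
      ≡⟨ *-assoc 2 (2 ^ zeros x′) (k C s) ⟩
    2 * (2 ^ zeros x′ * (k C s))
      ≡⟨ cong (λ c → 2 * (2 ^ zeros x′ * c)) (binomialSum-point k s) ⟨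
    2 * (2 ^ zeros x′ * binomialSum k (λ j → 𝟙 (j ≡ᵇ s)))
      ≤⟨ *-monoʳ-≤ 2 (*-monoʳ-≤ (2 ^ zeros x′) (binomialSum-mono k pointwise)) ⟩
    2 * (2 ^ zeros x′ * binomialSum k (λ j → 𝟙 (hit j xor hit′ j) + 𝟙 (hit j xor hit′ (suc j))))
      ≡⟨ cong (2 *_) (∑-edge _xor_) ⟨
    2 * (∑[ v ∈ signs n ] 𝟙 (inCap t v x xor inCap t v x′)) ∎
    where
    open ≤-Reasoning
    -- By parity: if k + t = 2s, the cap contains x and loses x′ when the changing coordinate
    -- disagrees. If k + t = 2s + 1, it just misses x and gains x′ when that coordinate agrees.
    at-s : 1 ≤ 𝟙 (hit s xor hit′ s) + 𝟙 (hit s xor hit′ (suc s))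
    at-s with k + t ≤? s + s
    ... | yes le rewrite ≤ᵇ-true le | ≤ᵇ-false (<⇒≱ (s≤s s+s≤)) = s≤s z≤n
    ... | no ¬le rewrite ≤ᵇ-false ¬le
                       | ≤ᵇ-true {suc k + t} {suc s + suc s}
                           (s≤s (≤-trans ≤s+s (≤-reflexive (sym (+-suc s s))))) = m≤n+m 1 _
    pointwise : ∀ j → 𝟙 (j ≡ᵇ s) ≤ 𝟙 (hit j xor hit′ j) + 𝟙 (hit j xor hit′ (suc j))
    pointwise j with j ≡ᵇ s in eq
    ... | false = z≤n
    ... | true with ≡ᵇ⇒≡ j s (Equivalence.from T-≡ eq)
    ... | refl = at-s

-- How many families cut a given edge

outside : ∀ {n m} → ℕ → Vec (Signs n) m → Cube n → Bool
outside t L x = avoids (λ v → inCap t v x) L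

module _ (w′ : ℕ) where
  open Caps w′

  module EdgeBound (n J κ e : ℕ) (n≡ : n ≡ κ + κ + e)
           (small : 2 * (suc J * (2 * w + 2 * J + 1)) ≤ κ) (J*κ>0 : 0 < J * κ)
           (w+w≤n : w + w ≤ n)
           (m : ℕ) (m-upper : 8 * (m * (2 ^ e * cap κ)) ≤ 2 ^ n)
           (m-lower : 2 ^ n ≤ 16 * (m * (2 ^ e * cap κ))) where
    open Window J κ small J*κ>0

    -- By `m-lower` the expected number m z τ / N of tail caps is at least 1/16, the border term c
    -- has a share of at least w/n in the tail τ, and half of the border caps cut the edge. The
    -- constant 64 is 16 · 2 · 2, with one 2 from `crossing-lower` and one from `separating-tuples`.
    -- `m-upper` keeps the other caps of the family away from the edge often enough.
    edge-bound : ∀ {x x′ : Cube n} → x ⋖ x′ → ∀ δ → weight x ≡ κ + κ + δ → Threshold δ →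
      w * (2 ^ n) ^ m ≤ 64 * n * (∑[ L ∈ tuples (signs n) m ] 𝟙 (outside (w + w) L x xor outside (w + w) L x′))
    edge-bound {x} {x′} x⋖x′ δ k≡ th =
      *-cancelˡ-≤ N {{m^n≢0 2 n}} (begin
      N * (w * P)
        ≤⟨ *-monoˡ-≤ (w * P) m-lower ⟩
      16 * (m * G) * (w * P)
        ≤⟨ *-monoˡ-≤ (w * P) (*-monoʳ-≤ 16 (*-monoʳ-≤ m G≤)) ⟩
      16 * (m * (z * τ)) * (w * P)
        ≡⟨ regroup₁ m z τ w P ⟩
      16 * (m * z) * P * (w * τ)
        ≤⟨ *-monoʳ-≤ (16 * (m * z) * P) w*τ≤ ⟩
      16 * (m * z) * P * (n * c)
        ≡⟨ regroup₂ m z P n c ⟩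
      16 * n * (m * (z * c) * P)
        ≤⟨ *-monoʳ-≤ (16 * n) (*-monoˡ-≤ P (*-monoʳ-≤ m (crossing-lower x⋖x′ (w + w) s s+s≤′ ≤s+s′))) ⟩
      16 * n * (m * (2 * X) * P)
        ≡⟨ regroup₃ n m X P ⟩
      32 * n * (m * X * P)
        ≤⟨ *-monoʳ-≤ (32 * n) separate ⟩
      32 * n * (2 * N * D)
        ≡⟨ regroup₄ n N D ⟩
      N * (64 * n * D) ∎)
      where
      open ≤-Reasoning
      open Threshold th
      N = 2 ^ n
      P = N ^ m
      G = 2 ^ e * cap κ
      k = weight x
      z = 2 ^ zeros x
      τ = binomialTail k s
      c = k C s
      X = ∑[ v ∈ signs n ] 𝟙 (inCap (w + w) v x xor inCap (w + w) v x′)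
      Q = ∑[ v ∈ signs n ] 𝟙 (inCap (w + w) v x ∨ inCap (w + w) v x′)
      D = ∑[ L ∈ tuples (signs n) m ] 𝟙 (outside (w + w) L x xor outside (w + w) L x′)
      regroup₁ : ∀ m z τ w P → 16 * (m * (z * τ)) * (w * P) ≡ 16 * (m * z) * P * (w * τ)
      regroup₁ = solve-∀
      regroup₂ : ∀ m z P n c → 16 * (m * z) * P * (n * c) ≡ 16 * n * (m * (z * c) * P)
      regroup₂ = solve-∀
      regroup₃ : ∀ n m X P → 16 * n * (m * (2 * X) * P) ≡ 32 * n * (m * X * P)
      regroup₃ = solve-∀
      regroup₄ : ∀ n N D → 32 * n * (2 * N * D) ≡ N * (64 * n * D)
      regroup₄ = solve-∀
      s+s≤′ : s + s ≤ k + (w + w)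
      s+s≤′ = subst (λ i → s + s ≤ i + (w + w)) (sym k≡) s+s≤
      ≤s+s′ : k + (w + w) ≤ suc (s + s)
      ≤s+s′ = subst (λ i → i + (w + w) ≤ suc (s + s)) (sym k≡) ≤s+s
      k≤n : k ≤ n
      k≤n = ≤-by (zeros x) (weight+zeros x)
      e≡ : e ≡ δ + zeros x
      e≡ = +-cancelˡ-≡ (κ + κ) _ _ (trans (sym n≡) (trans (sym (weight+zeros x))
        (trans (cong (_+ zeros x) k≡) (+-assoc (κ + κ) δ (zeros x)))))
      G≡ : G ≡ z * (2 ^ δ * cap κ)
      G≡ = trans (cong (λ i → 2 ^ i * cap κ) e≡)
        (trans (cong (_* cap κ) (^-distribˡ-+-* 2 δ (zeros x))) (shape (2 ^ δ) z (cap κ)))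
        where
        shape : ∀ a b c → a * b * c ≡ b * (a * c)
        shape = solve-∀
      τ-lower : 2 ^ δ * cap κ ≤ τ
      τ-lower = subst (λ i → 2 ^ δ * cap κ ≤ binomialTail i s) (sym k≡) lower
      τ-upper : τ ≤ 4 * (2 ^ δ * cap κ)
      τ-upper = subst (λ i → binomialTail i s ≤ 4 * (2 ^ δ * cap κ)) (sym k≡) upper
      G≤ : G ≤ z * τ
      G≤ = ≤-trans (≤-reflexive G≡) (*-monoʳ-≤ z τ-lower)
      s≤n : s ≤ n
      s≤n = *-cancelˡ-≤ 2 (begin
        2 * s            ≡⟨ cong (s +_) (+-identityʳ s) ⟩
        s + s            ≤⟨ s+s≤′ ⟩
        k + (w + w)      ≤⟨ +-mono-≤ k≤n w+w≤n ⟩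
        n + n            ≡⟨ cong (n +_) (+-identityʳ n) ⟨
        2 * n            ∎)
      -- From k + 2w ≤ 2s + 1 follows 2s - k ≥ 2w - 1 ≥ w, so the factor 2s - k of
      -- `binomialTail-upper` is w + d for some d.
      w*τ≤ : w * τ ≤ n * c
      w*τ≤ with m≤n⇒∃[o]m+o≡n (≤-pred (≤-trans (≤-by w′ (shape k w′)) ≤s+s′))
        where
        shape : ∀ k w → suc (k + suc w) + w ≡ k + (suc w + suc w)
        shape = solve-∀
      ... | d , eq = begin
        w * τ        ≤⟨ *-monoˡ-≤ τ (m≤m+n w d) ⟩
        (w + d) * τ  ≤⟨ binomialTail-upper k s (w + d) (trans (sym (+-assoc k w d)) eq) ⟩
        s * c        ≤⟨ *-monoˡ-≤ c s≤n ⟩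
        n * c        ∎
      separate : m * X * P ≤ 2 * N * D
      separate = subst (λ M → m * X * M ^ m ≤ 2 * M * D) (length-signs n)
        (separating-tuples (signs n) (λ v → inCap (w + w) v x) (λ v → inCap (w + w) v x′) m
          (subst (0 <_) (sym (length-signs n)) (m^n>0 2 n))
          (subst (2 * (m * Q) ≤_) (sym (length-signs n)) (begin
            2 * (m * Q)
              ≤⟨ *-monoʳ-≤ 2 (*-monoʳ-≤ m (touched-upper x⋖x′ (w + w) s s+s≤′ ≤s+s′)) ⟩
            2 * (m * (z * τ))
              ≤⟨ *-monoʳ-≤ 2 (*-monoʳ-≤ m (*-monoʳ-≤ z τ-upper)) ⟩
            2 * (m * (z * (4 * (2 ^ δ * cap κ))))
              ≡⟨ shape m z (2 ^ δ * cap κ) ⟩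
            8 * (m * (z * (2 ^ δ * cap κ)))
              ≡⟨ cong (λ g → 8 * (m * g)) G≡ ⟨
            8 * (m * G)
              ≤⟨ m-upper ⟩
            N ∎)))
        where
        shape : ∀ m z g → 2 * (m * (z * (4 * g))) ≡ 8 * (m * (z * g))
        shape = solve-∀

-- The boundary as a sum over the cube

length-filter-filter : ∀ {P Q : A → Set} (P? : Decidable P) (Q? : Decidable Q) xs →
  List.length (List.filter P? (List.filter Q? xs)) ≡
  ∑[ x ∈ xs ] 𝟙 (does (Q? x) ∧ does (P? x))
length-filter-filter P? Q? []       = refl
length-filter-filter P? Q? (x ∷ xs) with does (Q? x)
... | false = length-filter-filter P? Q? xs
... | true with does (P? x)
... | false = length-filter-filter P? Q? xs
... | true  = cong suc (length-filter-filter P? Q? xs)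

cut : ∀ {n} → CubeSubset n → Cube n × Cube n → ℕ
cut S (x , y) = 𝟙 (does (dist x y ≟ 1) ∧ (S x xor S y))

length-boundary : ∀ {n} (S : CubeSubset n) →
  List.length (boundary S) ≡ sumOver (pairs (points n)) (cut S)
length-boundary {n} S = trans
  (length-filter-filter (λ (u , v) → ¬? (S u Bool.≟ S v)) (λ (x , y) → dist x y ≟ 1) (pairs (points n)))
  (∑-cong (pairs (points n)) λ (x , y) → cong (λ b → 𝟙 (does (dist x y ≟ 1) ∧ b)) (neq (S x) (S y)))
  where
  neq : ∀ a b → not (does (a Bool.≟ b)) ≡ a xor b
  neq true  true  = refl
  neq true  false = refl
  neq false true  = refl
  neq false false = refl

∑-pairs-++ : ∀ (xs ys : List A) (f : A × A → ℕ) →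
  sumOver (pairs (xs ++ ys)) f ≡
  sumOver (pairs xs) f + (∑[ x ∈ xs ] ∑[ y ∈ ys ] f (x , y)) + sumOver (pairs ys) f
∑-pairs-++ []       ys f = refl
∑-pairs-++ (x ∷ xs) ys f = begin
  sumOver (List.map (x ,_) (xs ++ ys) ++ pairs (xs ++ ys)) f
    ≡⟨ ∑-++ (List.map (x ,_) (xs ++ ys)) _ f ⟩
  sumOver (List.map (x ,_) (xs ++ ys)) f + sumOver (pairs (xs ++ ys)) f
    ≡⟨ cong₂ _+_ (trans (∑-map (x ,_) (xs ++ ys) f) (∑-++ xs ys _)) (∑-pairs-++ xs ys f) ⟩
  (a + b) + (c + d + e)
    ≡⟨ regroup a b c d e ⟩
  (a + c) + (b + d) + e
    ≡⟨ cong (λ m → m + (b + d) + e) (trans (cong (_+ c) (sym (∑-map (x ,_) xs f)))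
         (sym (∑-++ (List.map (x ,_) xs) (pairs xs) f))) ⟩
  sumOver (pairs (x ∷ xs)) f + (b + d) + e ∎
  where
  open ≡-Reasoning
  a = ∑[ y ∈ xs ] f (x , y)
  b = ∑[ y ∈ ys ] f (x , y)
  c = sumOver (pairs xs) f
  d = ∑[ x ∈ xs ] ∑[ y ∈ ys ] f (x , y)
  e = sumOver (pairs ys) f
  regroup : ∀ a b c d e → (a + b) + (c + d + e) ≡ (a + c) + (b + d) + e
  regroup = solve-∀

∑-pairs-map : ∀ (h : A → B) xs (f : B × B → ℕ) →
  sumOver (pairs (List.map h xs)) f ≡ sumOver (pairs xs) (f ∘ Product.map h h)
∑-pairs-map h []       f = refl
∑-pairs-map h (x ∷ xs) f = begin
  sumOver (List.map (h x ,_) (List.map h xs) ++ pairs (List.map h xs)) f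
    ≡⟨ ∑-++ (List.map (h x ,_) (List.map h xs)) _ f ⟩
  sumOver (List.map (h x ,_) (List.map h xs)) f + sumOver (pairs (List.map h xs)) f
    ≡⟨ cong₂ _+_ (trans (∑-map (h x ,_) (List.map h xs) f) (trans (∑-map h xs _)
                   (sym (∑-map (x ,_) xs (f ∘ Product.map h h))))) (∑-pairs-map h xs f) ⟩
  sumOver (List.map (x ,_) xs) (f ∘ Product.map h h) + sumOver (pairs xs) (f ∘ Product.map h h)
    ≡⟨ ∑-++ (List.map (x ,_) xs) _ _ ⟨
  sumOver (pairs (x ∷ xs)) (f ∘ Product.map h h) ∎
  where open ≡-Reasoning

∑-points : ∀ n (f : Cube (suc n) → ℕ) → sumOver (points (suc n)) f ≡
  (∑[ x ∈ points n ] f (-1ᵗ ∷ x)) + ((∑[ x ∈ points n ] f (0ᵗ ∷ x)) + (∑[ x ∈ points n ] f (1ᵗ ∷ x)))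
∑-points n f = trans (∑-cartesian _∷_ (-1ᵗ ∷ 0ᵗ ∷ 1ᵗ ∷ []) (points n) f)
  (cong (λ s → (∑[ x ∈ points n ] f (-1ᵗ ∷ x)) + ((∑[ x ∈ points n ] f (0ᵗ ∷ x)) + s)) (+-identityʳ _))

-- The list of points consists of three layers by first coordinate. Only the pairs inside a layer
-- and the parallel pairs between adjacent layers are kept, since these contain all edges.
∑-pairs-points : ∀ n (f : Cube (suc n) × Cube (suc n) → ℕ) →
  let restrict a = sumOver (pairs (points n)) (λ (x , y) → f (a ∷ x , a ∷ y)) in
  (restrict -1ᵗ + (∑[ x ∈ points n ] f (-1ᵗ ∷ x , 0ᵗ ∷ x))) +
  ((restrict 0ᵗ + (∑[ x ∈ points n ] f (0ᵗ ∷ x , 1ᵗ ∷ x))) + restrict 1ᵗ)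
  ≤ sumOver (pairs (points (suc n))) f
∑-pairs-points n f = begin
  (restrict -1ᵗ + (∑[ x ∈ P ] f (-1ᵗ ∷ x , 0ᵗ ∷ x))) +
  ((restrict 0ᵗ + (∑[ x ∈ P ] f (0ᵗ ∷ x , 1ᵗ ∷ x))) + restrict 1ᵗ)
    ≤⟨ +-mono-≤ (+-mono-≤ (≤-reflexive (sym (∑-pairs-map (-1ᵗ ∷_) P f)))
                          (≤-trans (between -1ᵗ 0ᵗ) (fst≤ -1ᵗ 0ᵗ (layer 1ᵗ ++ []))))
         (+-mono-≤ (+-mono-≤ (≤-reflexive (sym (∑-pairs-map (0ᵗ ∷_) P f)))
                             (≤-trans (between 0ᵗ 1ᵗ) (fst≤ 0ᵗ 1ᵗ [])))
                   (≤-trans (≤-reflexive (sym (∑-pairs-map (1ᵗ ∷_) P f)))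
                     (≤-trans (≤-trans (m≤m+n _ _) (m≤m+n _ _))
                       (≤-reflexive (sym (∑-pairs-++ (layer 1ᵗ) [] f)))))) ⟩
  (sumOver (pairs (layer -1ᵗ)) f + (∑[ x ∈ layer -1ᵗ ] ∑[ y ∈ layer 0ᵗ ++ (layer 1ᵗ ++ []) ] f (x , y))) +
  ((sumOver (pairs (layer 0ᵗ)) f + (∑[ x ∈ layer 0ᵗ ] ∑[ y ∈ layer 1ᵗ ++ [] ] f (x , y)))
    + sumOver (pairs (layer 1ᵗ ++ [])) f)
    ≡⟨ cong (λ s → (sumOver (pairs (layer -1ᵗ)) f +
         (∑[ x ∈ layer -1ᵗ ] ∑[ y ∈ layer 0ᵗ ++ (layer 1ᵗ ++ []) ] f (x , y))) + s)
         (∑-pairs-++ (layer 0ᵗ) (layer 1ᵗ ++ []) f) ⟨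
  (sumOver (pairs (layer -1ᵗ)) f + (∑[ x ∈ layer -1ᵗ ] ∑[ y ∈ layer 0ᵗ ++ (layer 1ᵗ ++ []) ] f (x , y))) +
  sumOver (pairs (layer 0ᵗ ++ (layer 1ᵗ ++ []))) f
    ≡⟨ ∑-pairs-++ (layer -1ᵗ) (layer 0ᵗ ++ (layer 1ᵗ ++ [])) f ⟨
  sumOver (pairs (points (suc n))) f ∎
  where
  open ≤-Reasoning
  P = points n
  layer : Trit → List (Cube (suc n))
  layer a = List.map (a ∷_) P
  restrict : Trit → ℕ
  restrict a = sumOver (pairs P) (λ (x , y) → f (a ∷ x , a ∷ y))
  between : ∀ a b → ∑[ x ∈ P ] f (a ∷ x , b ∷ x) ≤ ∑[ x ∈ layer a ] ∑[ y ∈ layer b ] f (x , y)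
  between a b = ≤-trans (diagonal≤ P (λ x y → f (a ∷ x , b ∷ y)))
    (≤-reflexive (sym (trans (∑-map (a ∷_) P _) (∑-cong P (λ x → ∑-map (b ∷_) P (λ y → f (a ∷ x , y)))))))
  fst≤ : ∀ a b ys → ∑[ x ∈ layer a ] ∑[ y ∈ layer b ] f (x , y)
                  ≤ ∑[ x ∈ layer a ] ∑[ y ∈ layer b ++ ys ] f (x , y)
  fst≤ a b ys = ∑-mono (layer a) λ x →
    ≤-trans (m≤m+n _ _) (≤-reflexive (sym (∑-++ (layer b) ys (λ y → f (x , y)))))

-- Each zero of x can become -1 or 1, which gives two edges to higher weight. In `points`, -1 comes
-- before 0 and 0 before 1, so an edge to -1 is listed with its heavier end first; hence a
-- hypothesis for either order.
edges-by-weight : ∀ n (f : Cube n × Cube n → ℕ) (F : ℕ → ℕ) →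
  (∀ {x x′} → x ⋖ x′ → F (weight x) ≤ f (x , x′)) →
  (∀ {x x′} → x ⋖ x′ → F (weight x) ≤ f (x′ , x)) →
  ∑[ x ∈ points n ] zeros x * (2 * F (weight x)) ≤ sumOver (pairs (points n)) f
edges-by-weight zero    f F up down = z≤n
edges-by-weight (suc n) f F up down = begin
  ∑[ x ∈ points (suc n) ] zeros x * (2 * F (weight x))
    ≡⟨ ∑-points n _ ⟩
  a₁ + ((∑[ x ∈ P ] suc (zeros x) * (2 * F (weight x))) + a₁)
    ≡⟨ cong (λ s → a₁ + (s + a₁)) (trans (∑-cong P (λ x → peel (zeros x) (F (weight x))))
         (trans (∑-+ P _ _) (cong (_+ a₀) (∑-+ P _ _)))) ⟩
  a₁ + (((b + b) + a₀) + a₁)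
    ≡⟨ regroup a₁ b a₀ ⟩
  (a₁ + b) + ((a₀ + b) + a₁)
    ≤⟨ +-mono-≤ (+-mono-≤ (edges-by-weight n _ (F ∘ suc) (up ∘ (-1ᵗ ∷_)) (down ∘ (-1ᵗ ∷_)))
                          (∑-mono P (λ x → down 0⋖-1)))
         (+-mono-≤ (+-mono-≤ (edges-by-weight n _ F (up ∘ (0ᵗ ∷_)) (down ∘ (0ᵗ ∷_)))
                             (∑-mono P (λ x → up 0⋖1)))
                   (edges-by-weight n _ (F ∘ suc) (up ∘ (1ᵗ ∷_)) (down ∘ (1ᵗ ∷_)))) ⟩
  (sumOver (pairs P) (λ (x , y) → f (-1ᵗ ∷ x , -1ᵗ ∷ y)) + (∑[ x ∈ P ] f (-1ᵗ ∷ x , 0ᵗ ∷ x))) +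
  ((sumOver (pairs P) (λ (x , y) → f (0ᵗ ∷ x , 0ᵗ ∷ y)) + (∑[ x ∈ P ] f (0ᵗ ∷ x , 1ᵗ ∷ x))) +
   sumOver (pairs P) (λ (x , y) → f (1ᵗ ∷ x , 1ᵗ ∷ y)))
    ≤⟨ ∑-pairs-points n f ⟩
  sumOver (pairs (points (suc n))) f ∎
  where
  open ≤-Reasoning
  P = points n
  a₀ = ∑[ x ∈ P ] zeros x * (2 * F (weight x))
  a₁ = ∑[ x ∈ P ] zeros x * (2 * F (suc (weight x)))
  b  = ∑[ x ∈ P ] F (weight x)
  peel : ∀ z g → suc z * (2 * g) ≡ (g + g) + z * (2 * g)
  peel = solve-∀
  regroup : ∀ a b c → a + (((b + b) + c) + a) ≡ (a + b) + ((c + b) + a)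
  regroup = solve-∀

dist-refl : ∀ {n} (x : Cube n) → dist x x ≡ 0
dist-refl []        = refl
dist-refl (-1ᵗ ∷ x) = dist-refl x
dist-refl (0ᵗ ∷ x)  = dist-refl x
dist-refl (1ᵗ ∷ x)  = dist-refl x

⋖-dist : ∀ {n} {x x′ : Cube n} → x ⋖ x′ → dist x x′ ≡ 1 × dist x′ x ≡ 1
⋖-dist (0⋖-1 {x = x}) = cong suc (dist-refl x) , cong suc (dist-refl x)
⋖-dist (0⋖1 {x = x}) = cong suc (dist-refl x) , cong suc (dist-refl x)
⋖-dist (-1ᵗ ∷ x⋖)    = ⋖-dist x⋖
⋖-dist (0ᵗ ∷ x⋖)     = ⋖-dist x⋖
⋖-dist (1ᵗ ∷ x⋖)     = ⋖-dist x⋖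

length-points : ∀ n → List.length (points n) ≡ 3 ^ n
length-points zero    = refl
length-points (suc n) = begin
  List.length (points (suc n))
    ≡⟨ length≡∑ (points (suc n)) ⟩
  sumOver (points (suc n)) (λ _ → 1)
    ≡⟨ ∑-points n (λ _ → 1) ⟩
  l + (l + l)
    ≡⟨ cong (λ m → m + (m + m)) (trans (sym (length≡∑ (points n))) (length-points n)) ⟩
  3 ^ n + (3 ^ n + 3 ^ n)
    ≡⟨ cong (λ s → 3 ^ n + (3 ^ n + s)) (+-identityʳ (3 ^ n)) ⟨
  3 ^ suc n ∎
  where
  open ≡-Reasoning
  l = sumOver (points n) (λ _ → 1)

-- Concentration of the weight

deviation : ℕ → ℕ → ℤ
deviation n k = pos (3 * k) ℤ.- pos (2 * n)

∣i∣²≡i² : ∀ i → pos (∣ i ∣ * ∣ i ∣) ≡ i ℤ.* i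
∣i∣²≡i² (pos n)  = ℤ.pos-* n n
∣i∣²≡i² -[1+ n ] = refl

-- A coordinate changes 3k - 2n by 1 for two of its values and by -2 for the third: mean 0, second
-- moment 2. So the cross terms cancel and the variance is 2n.
∑-deviation² : ∀ n → let d x = ∣ deviation n (weight x) ∣ in
               ∑[ x ∈ points n ] d x * d x ≡ 2 * n * 3 ^ n
∑-deviation² zero    = refl
∑-deviation² (suc n) = begin
  ∑[ x ∈ points (suc n) ] sq (deviation (suc n) (weight x))
    ≡⟨ ∑-points n _ ⟩
  up + (stay + up)
    ≡⟨ cong (up +_) (∑-+ P _ _) ⟨
  up + (∑[ x ∈ P ] (sq (deviation (suc n) (weight x)) + sq (deviation (suc n) (suc (weight x)))))
    ≡⟨ ∑-+ P _ _ ⟨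
  ∑[ x ∈ P ] (sq (deviation (suc n) (suc (weight x))) +
             (sq (deviation (suc n) (weight x)) + sq (deviation (suc n) (suc (weight x)))))
    ≡⟨ ∑-cong P (λ x → step (weight x)) ⟩
  ∑[ x ∈ P ] (3 * sq (deviation n (weight x)) + 6)
    ≡⟨ trans (∑-+ P _ _) (cong₂ _+_ (∑-*ˡ P 3 _) (∑-const P 6)) ⟩
  3 * (∑[ x ∈ P ] sq (deviation n (weight x))) + List.length P * 6
    ≡⟨ cong₂ (λ s l → 3 * s + l * 6) (∑-deviation² n) (length-points n) ⟩
  3 * (2 * n * 3 ^ n) + 3 ^ n * 6
    ≡⟨ collect n (3 ^ n) ⟩
  2 * suc n * 3 ^ suc n ∎
  where
  open ≡-Reasoning
  P = points n
  sq : ℤ → ℕ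
  sq i = ∣ i ∣ * ∣ i ∣
  up   = ∑[ x ∈ P ] sq (deviation (suc n) (suc (weight x)))
  stay = ∑[ x ∈ P ] sq (deviation (suc n) (weight x))
  collect : ∀ n p → 3 * (2 * n * p) + p * 6 ≡ 2 * suc n * (3 * p)
  collect = solve-∀
  squares : ∀ i → (ℤ.1ℤ ℤ.+ i) ℤ.* (ℤ.1ℤ ℤ.+ i) ℤ.+
      ((i ℤ.- pos 2) ℤ.* (i ℤ.- pos 2) ℤ.+ (ℤ.1ℤ ℤ.+ i) ℤ.* (ℤ.1ℤ ℤ.+ i))
    ≡ pos 3 ℤ.* (i ℤ.* i) ℤ.+ pos 6
  squares = ℤ-Ring.solve-∀
  shift₁ : ∀ a b → (pos 3 ℤ.+ a) ℤ.- (pos 2 ℤ.+ b) ≡ ℤ.1ℤ ℤ.+ (a ℤ.- b)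
  shift₁ = ℤ-Ring.solve-∀
  shift₀ : ∀ a b → a ℤ.- (pos 2 ℤ.+ b) ≡ (a ℤ.- b) ℤ.- pos 2
  shift₀ = ℤ-Ring.solve-∀
  dev₁ : ∀ k → deviation (suc n) (suc k) ≡ ℤ.1ℤ ℤ.+ deviation n k
  dev₁ k = trans (cong₂ (λ a b → pos a ℤ.- pos b) (*-suc 3 k) (*-suc 2 n)) (shift₁ (pos (3 * k)) (pos (2 * n)))
  dev₀ : ∀ k → deviation (suc n) k ≡ deviation n k ℤ.- pos 2
  dev₀ k = trans (cong (λ b → pos (3 * k) ℤ.- pos b) (*-suc 2 n)) (shift₀ (pos (3 * k)) (pos (2 * n)))
  step : ∀ k → sq (deviation (suc n) (suc k)) + (sq (deviation (suc n) k) + sq (deviation (suc n) (suc k)))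
             ≡ 3 * sq (deviation n k) + 6
  step k = ℤ.+-injective (begin
    pos (sq u + (sq v + sq u))
      ≡⟨ cong₂ ℤ._+_ (∣i∣²≡i² u) (cong₂ ℤ._+_ (∣i∣²≡i² v) (∣i∣²≡i² u)) ⟩
    u ℤ.* u ℤ.+ (v ℤ.* v ℤ.+ u ℤ.* u)
      ≡⟨ cong₂ (λ a b → a ℤ.* a ℤ.+ (b ℤ.* b ℤ.+ a ℤ.* a)) (dev₁ k) (dev₀ k) ⟩
    _
      ≡⟨ squares i ⟩
    pos 3 ℤ.* (i ℤ.* i) ℤ.+ pos 6
      ≡⟨ cong (λ a → pos 3 ℤ.* a ℤ.+ pos 6) (∣i∣²≡i² i) ⟨
    pos 3 ℤ.* pos (sq i) ℤ.+ pos 6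
      ≡⟨ cong (ℤ._+ pos 6) (ℤ.pos-* 3 (sq i)) ⟨
    pos (3 * sq i + 6) ∎)
    where
    i = deviation n k
    u = deviation (suc n) (suc k)
    v = deviation (suc n) k

central : ℕ → ℕ → ℕ → Bool
central n M k = ∣ deviation n k ∣ ≤ᵇ M

chebyshev : ∀ n M → 0 < n → 4 * n ≤ M * M →
            3 ^ n ≤ 2 * (∑[ x ∈ points n ] 𝟙 (central n M (weight x)))
chebyshev n M n>0 4n≤ = +-cancelʳ-≤ (2 * out) _ _ (begin
  3 ^ n + 2 * out
    ≤⟨ +-monoʳ-≤ (3 ^ n) 2out≤ ⟩
  3 ^ n + 3 ^ n
    ≡⟨ cong (λ m → m + m) total ⟨
  (inn + out) + (inn + out)
    ≡⟨ regroup inn out ⟩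
  2 * inn + 2 * out ∎)
  where
  open ≤-Reasoning
  P = points n
  d : Cube n → ℕ
  d x = ∣ deviation n (weight x) ∣
  inn = ∑[ x ∈ P ] 𝟙 (d x ≤ᵇ M)
  out = ∑[ x ∈ P ] 𝟙 (not (d x ≤ᵇ M))
  regroup : ∀ i o → (i + o) + (i + o) ≡ 2 * i + 2 * o
  regroup = solve-∀
  total : inn + out ≡ 3 ^ n
  total = trans (sym (∑-+ P _ _)) (trans (∑-cong P (λ x → compl (d x ≤ᵇ M)))
    (trans (sym (length≡∑ P)) (length-points n)))
    where
    compl : ∀ b → 𝟙 b + 𝟙 (not b) ≡ 1
    compl true  = refl
    compl false = refl
  markov : ∀ e → M * M * 𝟙 (not (e ≤ᵇ M)) ≤ e * e
  markov e with e ≤ᵇ M in eq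
  ... | true  = ≤-trans (≤-reflexive (*-zeroʳ (M * M))) z≤n
  ... | false = ≤-trans (≤-reflexive (*-identityʳ (M * M))) (*-mono-≤ M≤e M≤e)
    where
    M≤e : M ≤ e
    M≤e = ≮⇒≥ λ e<M → contradiction (trans (sym eq) (≤ᵇ-true (<⇒≤ e<M))) λ ()
  2out≤ : 2 * out ≤ 3 ^ n
  2out≤ = *-cancelˡ-≤ (2 * n) {{m*n≢0 2 n {{_}} {{>-nonZero n>0}}}} (begin
    2 * n * (2 * out)
      ≡⟨ shape n out ⟩
    4 * n * out
      ≤⟨ *-monoˡ-≤ out 4n≤ ⟩
    M * M * out
      ≡⟨ ∑-*ˡ P (M * M) _ ⟨
    ∑[ x ∈ P ] M * M * 𝟙 (not (d x ≤ᵇ M))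
      ≤⟨ ∑-mono P (λ x → markov (d x)) ⟩
    ∑[ x ∈ P ] d x * d x
      ≡⟨ ∑-deviation² n ⟩
    2 * n * 3 ^ n ∎)
    where
    shape : ∀ n o → 2 * n * (2 * o) ≡ 4 * n * o
    shape = solve-∀

∣a-b∣≤⇒a≤b+ : ∀ a b M → ∣ pos a ℤ.- pos b ∣ ≤ M → a ≤ M + b
∣a-b∣≤⇒a≤b+ a b M le = begin
  a                            ≡⟨ cong ∣_∣ (shape (pos a) (pos b)) ⟩
  ∣ (pos a ℤ.- pos b) ℤ.+ pos b ∣    ≤⟨ ℤ.∣i+j∣≤∣i∣+∣j∣ (pos a ℤ.- pos b) (pos b) ⟩
  ∣ pos a ℤ.- pos b ∣ + b          ≤⟨ +-monoˡ-≤ b le ⟩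
  M + b ∎
  where
  open ≤-Reasoning
  shape : ∀ a b → a ≡ (a ℤ.- b) ℤ.+ b
  shape = ℤ-Ring.solve-∀

central-upper : ∀ n M k → central n M k ≡ true → 3 * k ≤ M + 2 * n
central-upper n M k c = ∣a-b∣≤⇒a≤b+ (3 * k) (2 * n) M (≤ᵇ⇒≤ _ M (Equivalence.from T-≡ c))

central-lower : ∀ n M k → central n M k ≡ true → 2 * n ≤ M + 3 * k
central-lower n M k c = ∣a-b∣≤⇒a≤b+ (2 * n) (3 * k) M (subst (_≤ M)
  (ℤ.∣i-j∣≡∣j-i∣ (pos (3 * k)) (pos (2 * n))) (≤ᵇ⇒≤ _ M (Equivalence.from T-≡ c)))

-- Convexity of sets cut out by affine functions

Seq : Set
Seq = ℕ → ℚ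

infix 4 _≋_

-- Records, so that the sequences can be inferred from a proof.
record _≋_ (f g : Seq) : Set where
  constructor mk≋
  field
    close : ∀ ε → 0ℚ ℚ.< ε → Eventually λ n → ℚ.∣ f n ℚ.- g n ∣ ℚ.≤ ε

record Nonneg (f : Seq) : Set where
  constructor mkNonneg
  field
    almost : ∀ ε → 0ℚ ℚ.< ε → Eventually λ n → 0ℚ ℚ.≤ f n ℚ.+ ε

open _≋_
open Nonneg

eventually-× : ∀ {P Q} → Eventually P → Eventually Q → Eventually λ n → P n × Q n
eventually-× (M , p) (N , q) = M ℕ.⊔ N , λ n ≤n → p n (⊔-lub₁ ≤n) , q n (⊔-lub₂ {M} ≤n)

eventually-map : ∀ {P Q : ℕ → Set} → (∀ n → P n → Q n) → Eventually P → Eventually Q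
eventually-map h (N , p) = N , λ n ≤n → h n (p n ≤n)

always : ∀ {P : ℕ → Set} → (∀ n → P n) → Eventually P
always p = 0 , λ n _ → p n

shrink : ∀ B → 0ℚ ℚ.< B → ∀ ε → 0ℚ ℚ.< ε → ∃[ δ ] 0ℚ ℚ.< δ × B ℚ.* δ ≡ ε
shrink B 0<B ε 0<ε = δ , ℚ.positive⁻¹ δ , (begin
  B ℚ.* (ε ℚ.* ℚ.1/ B)    ≡⟨ cong (B ℚ.*_) (ℚ.*-comm ε (ℚ.1/ B)) ⟩
  B ℚ.* (ℚ.1/ B ℚ.* ε)    ≡⟨ ℚ.*-assoc B (ℚ.1/ B) ε ⟨
  B ℚ.* ℚ.1/ B ℚ.* ε      ≡⟨ cong (ℚ._* ε) (ℚ.*-inverseʳ B) ⟩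
  1ℚ ℚ.* ε                ≡⟨ ℚ.*-identityˡ ε ⟩
  ε                       ∎)
  where
  open ≡-Reasoning
  instance
    B>0 : ℚ.Positive B
    B>0 = ℚ.positive 0<B
    B≢0 : ℚ.NonZero B
    B≢0 = ℚ.pos⇒nonZero B
  δ = ε ℚ.* ℚ.1/ B
  instance
    δ>0 : ℚ.Positive δ
    δ>0 = ℚ.pos*pos⇒pos ε {{ℚ.positive 0<ε}} (ℚ.1/ B) {{ℚ.1/pos⇒pos B}}

≗⇒≋ : ∀ {f g} → (∀ n → f n ≡ g n) → f ≋ g
≗⇒≋ {f} {g} f≗g = mk≋ λ ε 0<ε → always λ n → subst (ℚ._≤ ε)
  (sym (cong ℚ.∣_∣ (trans (cong (ℚ._- g n) (f≗g n)) (ℚ.+-inverseʳ (g n))))) (ℚ.<⇒≤ 0<ε)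

≋-trans : ∀ {f g h} → f ≋ g → g ≋ h → f ≋ h
≋-trans {f} {g} {h} f≋g g≋h = mk≋ λ ε 0<ε →
  eventually-map
    (λ n (p , q) → begin
      ℚ.∣ f n ℚ.- h n ∣
        ≡⟨ cong ℚ.∣_∣ (insert (f n) (g n) (h n)) ⟩
      ℚ.∣ (f n ℚ.- g n) ℚ.+ (g n ℚ.- h n) ∣
        ≤⟨ ℚ.∣p+q∣≤∣p∣+∣q∣ (f n ℚ.- g n) (g n ℚ.- h n) ⟩
      ℚ.∣ f n ℚ.- g n ∣ ℚ.+ ℚ.∣ g n ℚ.- h n ∣
        ≤⟨ ℚ.+-mono-≤ p q ⟩
      ½ ℚ.* ε ℚ.+ ½ ℚ.* ε
        ≡⟨ half+half ε ⟩
      ε ∎)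
    (eventually-× (close f≋g _ (half-pos 0<ε)) (close g≋h _ (half-pos 0<ε)))
  where
  open ℚ.≤-Reasoning
  insert : ∀ a b c → a ℚ.- c ≡ (a ℚ.- b) ℚ.+ (b ℚ.- c)
  insert = solve 3 (λ a b c → a :- c := (a :- b) :+ (b :- c)) refl
    where open ℚ-Solver

≋-+ : ∀ {f f′ g g′} → f ≋ f′ → g ≋ g′ → (λ n → f n ℚ.+ g n) ≋ (λ n → f′ n ℚ.+ g′ n)
≋-+ {f} {f′} {g} {g′} p q = mk≋ λ ε 0<ε →
  eventually-map
    (λ n (p , q) → begin
      ℚ.∣ (f n ℚ.+ g n) ℚ.- (f′ n ℚ.+ g′ n) ∣
        ≡⟨ cong ℚ.∣_∣ (+-diff (f n) (g n) (f′ n) (g′ n)) ⟩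
      ℚ.∣ (f n ℚ.- f′ n) ℚ.+ (g n ℚ.- g′ n) ∣
        ≤⟨ ℚ.∣p+q∣≤∣p∣+∣q∣ (f n ℚ.- f′ n) (g n ℚ.- g′ n) ⟩
      ℚ.∣ f n ℚ.- f′ n ∣ ℚ.+ ℚ.∣ g n ℚ.- g′ n ∣
        ≤⟨ ℚ.+-mono-≤ p q ⟩
      ½ ℚ.* ε ℚ.+ ½ ℚ.* ε
        ≡⟨ half+half ε ⟩
      ε ∎)
    (eventually-× (close p _ (half-pos 0<ε)) (close q _ (half-pos 0<ε)))
  where open ℚ.≤-Reasoning

≋-* : ∀ {f g} (x : ℝ) → f ≋ g → (λ n → seq x n ℚ.* f n) ≋ (λ n → seq x n ℚ.* g n)
≋-* {f} {g} x f≋g = mk≋ λ ε 0<ε →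
  let B , 0<B , x≤B  = bounded x
      δ , 0<δ , Bδ≡ε = shrink B 0<B ε 0<ε
  in eventually-map
    (λ n (p , q) → begin
      ℚ.∣ seq x n ℚ.* f n ℚ.- seq x n ℚ.* g n ∣
        ≡⟨ cong ℚ.∣_∣ (factor (seq x n) (f n) (g n)) ⟩
      ℚ.∣ seq x n ℚ.* (f n ℚ.- g n) ∣
        ≡⟨ ℚ.∣p*q∣≡∣p∣*∣q∣ (seq x n) (f n ℚ.- g n) ⟩
      ℚ.∣ seq x n ∣ ℚ.* ℚ.∣ f n ℚ.- g n ∣
        ≤⟨ *-mono-≤-nonNeg 0≤∣ f n ℚ.- g n ∣ (ℚ.<⇒≤ 0<B) p q ⟩
      B ℚ.* δ
        ≡⟨ Bδ≡ε ⟩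
      ε ∎)
    (eventually-× x≤B (close f≋g δ 0<δ))
  where
  open ℚ.≤-Reasoning
  factor : ∀ x a b → x ℚ.* a ℚ.- x ℚ.* b ≡ x ℚ.* (a ℚ.- b)
  factor = solve 3 (λ x a b → x :* a :- x :* b := x :* (a :- b)) refl
    where open ℚ-Solver

nonneg-+ : ∀ {f g} → Nonneg f → Nonneg g → Nonneg (λ n → f n ℚ.+ g n)
nonneg-+ {f} {g} p q = mkNonneg λ ε 0<ε → eventually-map
  (λ n (p , q) → subst (0ℚ ℚ.≤_)
    (trans (regroup (f n) (g n) (½ ℚ.* ε)) (cong (f n ℚ.+ g n ℚ.+_) (half+half ε)))
    (ℚ.+-mono-≤ p q))
  (eventually-× (almost p _ (half-pos 0<ε)) (almost q _ (half-pos 0<ε)))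
  where
  regroup : ∀ a b h → (a ℚ.+ h) ℚ.+ (b ℚ.+ h) ≡ a ℚ.+ b ℚ.+ (h ℚ.+ h)
  regroup = solve 3 (λ a b h → (a :+ h) :+ (b :+ h) := a :+ b :+ (h :+ h)) refl
    where open ℚ-Solver

nonneg-*ʳ : ∀ {f} q → 0ℚ ℚ.≤ q → Nonneg f → Nonneg (λ n → f n ℚ.* q)
nonneg-*ʳ {f} q 0≤q p = mkNonneg λ ε 0<ε →
  let δ , 0<δ , eq = shrink (1ℚ ℚ.+ q) (ℚ.+-mono-<-≤ (ℚ.positive⁻¹ 1ℚ) 0≤q) ε 0<ε
  in eventually-map
  (λ n 0≤ → begin
    0ℚ
      ≡⟨ ℚ.*-zeroˡ q ⟨
    0ℚ ℚ.* q
      ≤⟨ ℚ.*-monoʳ-≤-nonNeg q {{ℚ.nonNegative 0≤q}} 0≤ ⟩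
    (f n ℚ.+ δ) ℚ.* q
      ≡⟨ ℚ.+-identityʳ _ ⟨
    (f n ℚ.+ δ) ℚ.* q ℚ.+ 0ℚ
      ≤⟨ ℚ.+-monoʳ-≤ ((f n ℚ.+ δ) ℚ.* q) (ℚ.<⇒≤ 0<δ) ⟩
    (f n ℚ.+ δ) ℚ.* q ℚ.+ δ
      ≡⟨ regroup (f n) δ q ⟩
    f n ℚ.* q ℚ.+ (1ℚ ℚ.+ q) ℚ.* δ
      ≡⟨ cong (f n ℚ.* q ℚ.+_) eq ⟩
    f n ℚ.* q ℚ.+ ε ∎)
  (almost p δ 0<δ)
  where
  open ℚ.≤-Reasoning
  regroup : ∀ a d q → (a ℚ.+ d) ℚ.* q ℚ.+ d ≡ a ℚ.* q ℚ.+ (1ℚ ℚ.+ q) ℚ.* d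
  regroup = solve 3 (λ a d q → (a :+ d) :* q :+ d := a :* q :+ (con 1ℚ :+ q) :* d) refl
    where open ℚ-Solver

p≤∣p∣ : ∀ p → p ℚ.≤ ℚ.∣ p ∣
p≤∣p∣ p with 0ℚ ℚ.≤? p
... | yes 0≤p = ℚ.≤-reflexive (sym (ℚ.0≤p⇒∣p∣≡p 0≤p))
... | no  0≰p = ℚ.≤-trans (ℚ.<⇒≤ (ℚ.≰⇒> 0≰p)) 0≤∣ p ∣

-- The weights of a convex combination are arbitrary reals, but r is rational, so the sign of r is
-- decidable. If r < 0, put h = -r/2: at a late index f is at least -h/2 and at most r + h/2, whence
-- 0 ≤ r + h = -h.
nonneg-limit : ∀ {f r} → Nonneg f → f ≋ (λ _ → r) → 0ℚ ℚ.≤ r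
nonneg-limit {f} {r} p f≋r with 0ℚ ℚ.≤? r
... | yes 0≤r = 0≤r
... | no  0≰r = contradiction (ℚ.≤-<-trans 0≤-h (ℚ.neg-antimono-< h>0)) (ℚ.<-irrefl refl)
  where
  open ℚ.≤-Reasoning
  h = ½ ℚ.* (ℚ.- r)
  h>0 : 0ℚ ℚ.< h
  h>0 = half-pos (ℚ.neg-antimono-< (ℚ.≰⇒> 0≰r))
  at : Eventually λ n → 0ℚ ℚ.≤ f n ℚ.+ ½ ℚ.* h × ℚ.∣ f n ℚ.- r ∣ ℚ.≤ ½ ℚ.* h
  at = eventually-× (almost p _ (half-pos h>0)) (close f≋r _ (half-pos h>0))
  N = proj₁ at
  regroup : ∀ r d → r ℚ.+ d ℚ.+ d ≡ r ℚ.+ (d ℚ.+ d)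
  regroup = solve 2 (λ r d → r :+ d :+ d := r :+ (d :+ d)) refl
    where open ℚ-Solver
  cancel : ∀ r → r ℚ.+ ½ ℚ.* (ℚ.- r) ≡ ℚ.- (½ ℚ.* (ℚ.- r))
  cancel = solve 1 (λ r → r :+ con ½ :* (:- r) := :- (con ½ :* (:- r))) refl
    where open ℚ-Solver
  0≤-h : 0ℚ ℚ.≤ ℚ.- h
  0≤-h = begin
    0ℚ
      ≤⟨ proj₁ (proj₂ at N ℕ.≤-refl) ⟩
    f N ℚ.+ ½ ℚ.* h
      ≡⟨ cong (ℚ._+ ½ ℚ.* h) (split (f N) r) ⟩
    r ℚ.+ (f N ℚ.- r) ℚ.+ ½ ℚ.* h
      ≤⟨ ℚ.+-monoˡ-≤ (½ ℚ.* h) (ℚ.+-monoʳ-≤ r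
           (ℚ.≤-trans (p≤∣p∣ (f N ℚ.- r)) (proj₂ (proj₂ at N ℕ.≤-refl)))) ⟩
    r ℚ.+ ½ ℚ.* h ℚ.+ ½ ℚ.* h
      ≡⟨ trans (regroup r (½ ℚ.* h)) (cong (r ℚ.+_) (half+half h)) ⟩
    r ℚ.+ h
      ≡⟨ cancel r ⟩
    ℚ.- h ∎

∑ℚ : ∀ {k} → Vector ℚ k → ℚ
∑ℚ = Vector.foldr ℚ._+_ 0ℚ

seq-∑ : ∀ {k} (u : Vector ℝ k) n → seq (∑ u) n ≡ ∑ℚ (λ j → seq (u j) n)
seq-∑ {zero}  u n = refl
seq-∑ {suc k} u n = cong (seq (u Fin.zero) n ℚ.+_) (seq-∑ (u ∘ Fin.suc) n)

∑ℚ-≋ : ∀ {k} {f g : Fin k → Seq} → (∀ j → f j ≋ g j) →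
       (λ n → ∑ℚ (λ j → f j n)) ≋ (λ n → ∑ℚ (λ j → g j n))
∑ℚ-≋ {zero}  f≋g = ≗⇒≋ λ _ → refl
∑ℚ-≋ {suc k} f≋g = ≋-+ (f≋g Fin.zero) (∑ℚ-≋ (f≋g ∘ Fin.suc))

∑ℚ-nonneg : ∀ {k} {f : Fin k → Seq} → (∀ j → Nonneg (f j)) → Nonneg (λ n → ∑ℚ (λ j → f j n))
∑ℚ-nonneg {zero}  p = mkNonneg λ ε 0<ε → always λ _ → ℚ.≤-trans (ℚ.<⇒≤ 0<ε) (ℚ.≤-reflexive (sym (ℚ.+-identityˡ ε)))
∑ℚ-nonneg {suc k} p = nonneg-+ (p Fin.zero) (∑ℚ-nonneg (p ∘ Fin.suc))

∑ℚ-linear : ∀ {k} (w q q′ : Vector ℚ k) c c′ →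
  ∑ℚ (λ j → w j ℚ.* (c ℚ.* q j ℚ.+ c′ ℚ.* q′ j)) ≡
  c ℚ.* ∑ℚ (λ j → w j ℚ.* q j) ℚ.+ c′ ℚ.* ∑ℚ (λ j → w j ℚ.* q′ j)
∑ℚ-linear {zero}  w q q′ c c′ =
  sym (trans (cong₂ ℚ._+_ (ℚ.*-zeroʳ c) (ℚ.*-zeroʳ c′)) (ℚ.+-identityˡ 0ℚ))
∑ℚ-linear {suc k} w q q′ c c′ = trans
  (cong (w Fin.zero ℚ.* (c ℚ.* q Fin.zero ℚ.+ c′ ℚ.* q′ Fin.zero) ℚ.+_)
    (∑ℚ-linear (w ∘ Fin.suc) (q ∘ Fin.suc) (q′ ∘ Fin.suc) c c′))
  (regroup (w Fin.zero) (q Fin.zero) (q′ Fin.zero) c c′ _ _)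
  where
  regroup : ∀ w q q′ c c′ s s′ →
    w ℚ.* (c ℚ.* q ℚ.+ c′ ℚ.* q′) ℚ.+ (c ℚ.* s ℚ.+ c′ ℚ.* s′) ≡
    c ℚ.* (w ℚ.* q ℚ.+ s) ℚ.+ c′ ℚ.* (w ℚ.* q′ ℚ.+ s′)
  regroup = solve 7 (λ w q q′ c c′ s s′ →
    w :* (c :* q :+ c′ :* q′) :+ (c :* s :+ c′ :* s′) :=
    c :* (w :* q :+ s) :+ c′ :* (w :* q′ :+ s′)) refl
    where open ℚ-Solver

value : Trit → ℚ
value a = ⟦ a ⟧ ℚ./ 1

dot : ∀ {n} → Vec ℚ n → Cube n → ℚ
dot []      []      = 0ℚ
dot (c ∷ v) (a ∷ x) = c ℚ.* value a ℚ.+ dot v x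

module _ {k} (w : Vector ℝ k) where

  Averages : Vector ℚ k → ℚ → Set
  Averages q r = (λ n → ∑ℚ (λ j → seq (w j) n ℚ.* q j)) ≋ (λ _ → r)

  averages-linear : ∀ {q q′ r r′} c c′ → Averages q r → Averages q′ r′ →
    Averages (λ j → c ℚ.* q j ℚ.+ c′ ℚ.* q′ j) (c ℚ.* r ℚ.+ c′ ℚ.* r′)
  averages-linear {q} {q′} c c′ p p′ = ≋-trans
    (≗⇒≋ λ n → ∑ℚ-linear (λ j → seq (w j) n) q q′ c c′)
    (≋-+ (≋-* (fromℚ c) p) (≋-* (fromℚ c′) p′))

  averages-cong : ∀ {q q′ r r′} → (∀ j → q j ≡ q′ j) → r ≡ r′ → Averages q r → Averages q′ r′
  averages-cong {q} {q′} q≗ refl = ≋-trans (∑ℚ-≋ λ j → ≗⇒≋ λ n → cong (seq (w j) n ℚ.*_) (sym (q≗ j)))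

  averages-dot : ∀ {n} (s : Fin k → Cube n) (x : Cube n) →
    (∀ i → Averages (λ j → value (Vec.lookup (s j) i)) (value (Vec.lookup x i))) →
    (v : Vec ℚ n) → Averages (λ _ → 0ℚ) 0ℚ → Averages (λ j → dot v (s j)) (dot v x)
  averages-dot s [] p [] z = averages-cong (λ j → nil (s j)) refl z
    where
    nil : ∀ (x : Cube 0) → 0ℚ ≡ dot [] x
    nil [] = refl
  averages-dot s (a ∷ x) p (c ∷ v) z = averages-cong
    (λ j → trans (cong (c ℚ.* value (Vec.head (s j)) ℚ.+_) (ℚ.*-identityˡ _)) (uncons (s j)))
    (cong (c ℚ.* value a ℚ.+_) (ℚ.*-identityˡ _))
    (averages-linear c 1ℚ
      (averages-cong (λ j → cong value (head-lookup (s j))) refl (p Fin.zero))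
      (averages-dot (Vec.tail ∘ s) x
        (λ i → averages-cong (λ j → cong value (tail-lookup (s j) i)) refl (p (Fin.suc i))) v z))
    where
    uncons : ∀ y → c ℚ.* value (Vec.head y) ℚ.+ dot v (Vec.tail y) ≡ dot (c ∷ v) y
    uncons (_ ∷ _) = refl
    head-lookup : ∀ {n} (y : Cube (suc n)) → Vec.lookup y Fin.zero ≡ Vec.head y
    head-lookup (_ ∷ _) = refl
    tail-lookup : ∀ {n} (y : Cube (suc n)) i → Vec.lookup y (Fin.suc i) ≡ Vec.lookup (Vec.tail y) i
    tail-lookup (_ ∷ _) i = refl

module _ {n} {S : CubeSubset n} {x : Cube n} (v : Vec ℚ n) (b : ℚ)
         (below : ∀ s → S s ≡ true → dot v s ℚ.≤ b) where

  -- The weights average the nonnegative numbers b - ⟨v, s_j⟩ to b - ⟨v, x⟩. The points of the hull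
  -- may first be replaced by the cube points s_j that they equal, after which the weights are the
  -- only reals left.
  hull-below : Conv (image S) (embed x) → dot v x ℚ.≤ b
  hull-below (k , w , p , w≥0 , ∑w≈1 , p∈S , ∑wp≈x) =
    subst (ℚ._≤ b) (ℚ.+-identityʳ _) dot≤b
    where
    s : Fin k → Cube n
    s j = proj₁ (p∈S j)
    ones : Averages w (λ _ → 1ℚ) 1ℚ
    ones = ≋-trans (≗⇒≋ λ m → trans (∑ℚ-≗ λ j → ℚ.*-identityʳ (seq (w j) m)) (sym (seq-∑ w m))) (mk≋ ∑w≈1)
      where
      ∑ℚ-≗ : ∀ {k} {f g : Vector ℚ k} → (∀ j → f j ≡ g j) → ∑ℚ f ≡ ∑ℚ g
      ∑ℚ-≗ {zero}  f≗g = refl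
      ∑ℚ-≗ {suc k} f≗g = cong₂ ℚ._+_ (f≗g Fin.zero) (∑ℚ-≗ (f≗g ∘ Fin.suc))
    coords : ∀ i → Averages w (λ j → value (Vec.lookup (s j) i)) (value (Vec.lookup x i))
    coords i = ≋-trans (∑ℚ-≋ λ j → ≋-* (w j) (≋-sym (mk≋ (proj₂ (proj₂ (p∈S j)) i))))
      (≋-trans (≗⇒≋ λ m → sym (seq-∑ (λ j → w j *ᴿ p j i) m)) (mk≋ (∑wp≈x i)))
      where
      ≋-sym : ∀ {f g} → f ≋ g → g ≋ f
      ≋-sym {f} {g} f≋g = mk≋ λ ε 0<ε → eventually-map
        (λ m → subst (ℚ._≤ ε) (trans (sym (ℚ.∣-p∣≡∣p∣ (f m ℚ.- g m))) (cong ℚ.∣_∣ (flip (f m) (g m)))))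
        (close f≋g ε 0<ε)
        where
        flip : ∀ a b → ℚ.- (a ℚ.- b) ≡ b ℚ.- a
        flip = solve 2 (λ a b → :- (a :- b) := b :- a) refl
          where open ℚ-Solver
    zeroes : Averages w (λ _ → 0ℚ) 0ℚ
    zeroes = averages-linear w 0ℚ 0ℚ ones ones
    slack : Averages w (λ j → b ℚ.* 1ℚ ℚ.+ (ℚ.- 1ℚ) ℚ.* dot v (s j))
                       (b ℚ.* 1ℚ ℚ.+ (ℚ.- 1ℚ) ℚ.* dot v x)
    slack = averages-linear w b (ℚ.- 1ℚ) ones (averages-dot w s x coords v zeroes)
    shape : ∀ b d → b ℚ.* 1ℚ ℚ.+ (ℚ.- 1ℚ) ℚ.* d ≡ b ℚ.- d
    shape = solve 2 (λ b d → b :* con 1ℚ :+ (:- con 1ℚ) :* d := b :- d) refl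
      where open ℚ-Solver
    0≤slack : 0ℚ ℚ.≤ b ℚ.* 1ℚ ℚ.+ (ℚ.- 1ℚ) ℚ.* dot v x
    0≤slack = nonneg-limit (∑ℚ-nonneg λ j → nonneg-*ʳ {seq (w j)} _
      (subst (0ℚ ℚ.≤_) (sym (shape b (dot v (s j))))
        (subst (ℚ._≤ b ℚ.- dot v (s j)) (ℚ.+-inverseʳ (dot v (s j)))
          (ℚ.+-monoˡ-≤ (ℚ.- dot v (s j)) (below (s j) (proj₁ (proj₂ (p∈S j)))))))
      (mkNonneg (w≥0 j))) slack
    dot≤b : dot v x ℚ.+ 0ℚ ℚ.≤ b
    dot≤b = ℚ.≤-trans (ℚ.+-monoʳ-≤ (dot v x) 0≤slack) (ℚ.≤-reflexive (cancel (dot v x) b))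
      where
      cancel : ∀ d b → d ℚ.+ (b ℚ.* 1ℚ ℚ.+ (ℚ.- 1ℚ) ℚ.* d) ≡ b
      cancel = solve 2 (λ d b → d :+ (b :* con 1ℚ :+ (:- con 1ℚ) :* d) := b) refl
        where open ℚ-Solver

separated⇒convex : ∀ {n} (S : CubeSubset n) →
  (∀ x → S x ≡ false → Σ[ v ∈ Vec ℚ n ] ∃[ b ]
    (∀ s → S s ≡ true → dot v s ℚ.≤ b) × b ℚ.< dot v x) →
  Convex S
separated⇒convex {n} S separate x = mk⇔ point-hull (hull-point (S x) refl)
  where
  point-hull : S x ≡ true → Conv (image S) (embed x)
  point-hull Sx = 1 , (λ _ → 1ᴿ) , (λ _ → embed x)
    , (λ _ ε 0<ε → always λ _ → ℚ.≤-trans (ℚ.<⇒≤ (ℚ.positive⁻¹ 1ℚ))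
        (ℚ.≤-trans (ℚ.≤-reflexive (sym (ℚ.+-identityʳ 1ℚ))) (ℚ.+-monoʳ-≤ 1ℚ (ℚ.<⇒≤ 0<ε))))
    , close (≗⇒≋ λ _ → ℚ.+-identityʳ 1ℚ)
    , (λ _ → x , Sx , λ i → close (≗⇒≋ {seq (embed x i)} λ _ → refl))
    , λ i → close (≗⇒≋ {g = seq (embed x i)} λ _ → trans (ℚ.+-identityʳ _) (ℚ.*-identityˡ _))

  hull-point : ∀ b → S x ≡ b → Conv (image S) (embed x) → S x ≡ true
  hull-point true  Sx _    = Sx
  hull-point false Sx hull =
    let v , b , below , above = separate x Sx
    in contradiction (ℚ.<-≤-trans above (hull-below v b below hull)) (ℚ.<-irrefl refl)

-- Convexity of the complement of the caps

toℚ : ℕ → ℚ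
toℚ n = pos n ℚ./ 1

toℚ-suc : ∀ n → toℚ (suc n) ≡ 1ℚ ℚ.+ toℚ n
toℚ-suc n = trans (suc-/ n 0) (ℚ.+-comm (toℚ n) 1ℚ)

toℚ-+ : ∀ m n → toℚ (m ℕ.+ n) ≡ toℚ m ℚ.+ toℚ n
toℚ-+ zero    n = sym (ℚ.+-identityˡ (toℚ n))
toℚ-+ (suc m) n = begin
  toℚ (suc (m ℕ.+ n))         ≡⟨ toℚ-suc (m ℕ.+ n) ⟩
  1ℚ ℚ.+ toℚ (m ℕ.+ n)        ≡⟨ cong (1ℚ ℚ.+_) (toℚ-+ m n) ⟩
  1ℚ ℚ.+ (toℚ m ℚ.+ toℚ n)    ≡⟨ ℚ.+-assoc 1ℚ (toℚ m) (toℚ n) ⟨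
  1ℚ ℚ.+ toℚ m ℚ.+ toℚ n      ≡⟨ cong (ℚ._+ toℚ n) (toℚ-suc m) ⟨
  toℚ (suc m) ℚ.+ toℚ n       ∎
  where open ≡-Reasoning

toℚ-mono : ∀ {m n} → m ℕ.≤ n → toℚ m ℚ.≤ toℚ n
toℚ-mono {m} {n} m≤n = /-≤ m 0 n 0 (ℕ.*-monoˡ-≤ 1 m≤n)

sign : Bool → ℚ
sign true  = 1ℚ
sign false = ℚ.- 1ℚ

dot-sign : ∀ {n} (v : Signs n) (x : Cube n) →
  dot (Vec.map sign v) x ℚ.+ toℚ (weight x) ≡ toℚ (agree v x ℕ.+ agree v x)
dot-sign []      []      = refl
dot-sign (b ∷ v) (a ∷ x) = begin
  sign b ℚ.* value a ℚ.+ d ℚ.+ toℚ (nonzero a ℕ.+ weight x)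
    ≡⟨ cong (sign b ℚ.* value a ℚ.+ d ℚ.+_) (toℚ-+ (nonzero a) (weight x)) ⟩
  sign b ℚ.* value a ℚ.+ d ℚ.+ (toℚ (nonzero a) ℚ.+ toℚ (weight x))
    ≡⟨ exchange (sign b ℚ.* value a) d (toℚ (nonzero a)) (toℚ (weight x)) ⟩
  sign b ℚ.* value a ℚ.+ toℚ (nonzero a) ℚ.+ (d ℚ.+ toℚ (weight x))
    ≡⟨ cong₂ ℚ._+_ (coordinate b a) (dot-sign v x) ⟩
  toℚ (m ℕ.+ m) ℚ.+ toℚ (agree v x ℕ.+ agree v x)
    ≡⟨ toℚ-+ (m ℕ.+ m) (agree v x ℕ.+ agree v x) ⟨
  toℚ ((m ℕ.+ m) ℕ.+ (agree v x ℕ.+ agree v x))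
    ≡⟨ cong toℚ (+-interchange m m (agree v x) (agree v x)) ⟩
  toℚ (agree (b ∷ v) (a ∷ x) ℕ.+ agree (b ∷ v) (a ∷ x)) ∎
  where
  open ≡-Reasoning
  m = match b a
  d = dot (Vec.map sign v) x
  exchange : ∀ p q r s → p ℚ.+ q ℚ.+ (r ℚ.+ s) ≡ p ℚ.+ r ℚ.+ (q ℚ.+ s)
  exchange = solve 4 (λ p q r s → p :+ q :+ (r :+ s) := p :+ r :+ (q :+ s)) refl
    where open ℚ-Solver
  coordinate : ∀ b a → sign b ℚ.* value a ℚ.+ toℚ (nonzero a) ≡ toℚ (match b a ℕ.+ match b a)
  coordinate true  -1ᵗ = refl
  coordinate true  0ᵗ  = refl
  coordinate true  1ᵗ  = refl
  coordinate false -1ᵗ = refl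
  coordinate false 0ᵗ  = refl
  coordinate false 1ᵗ  = refl

module _ {n} (t : ℕ) (v : Signs n) where
  private
    u = Vec.map sign v

  -- ⟨v, x⟩ is an integer, so missing t means at most t - 1. The resulting gap provides the strict
  -- inequality on the other side that separation requires.
  outside-cap : ∀ x → inCap t v x ≡ false → dot u x ℚ.≤ toℚ t ℚ.- 1ℚ
  outside-cap x ∉ = begin
    dot u x
      ≡⟨ insert (dot u x) W ⟩
    dot u x ℚ.+ W ℚ.- W
      ≡⟨ cong (ℚ._- W) (dot-sign v x) ⟩
    toℚ 2a ℚ.- W
      ≡⟨ shift (toℚ 2a) W ⟩
    1ℚ ℚ.+ toℚ 2a ℚ.+ (ℚ.- 1ℚ ℚ.- W)
      ≡⟨ cong (ℚ._+ (ℚ.- 1ℚ ℚ.- W)) (toℚ-suc 2a) ⟨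
    toℚ (suc 2a) ℚ.+ (ℚ.- 1ℚ ℚ.- W)
      ≤⟨ ℚ.+-monoˡ-≤ (ℚ.- 1ℚ ℚ.- W) (toℚ-mono 2a<) ⟩
    toℚ (weight x ℕ.+ t) ℚ.+ (ℚ.- 1ℚ ℚ.- W)
      ≡⟨ cong (ℚ._+ (ℚ.- 1ℚ ℚ.- W)) (toℚ-+ (weight x) t) ⟩
    W ℚ.+ toℚ t ℚ.+ (ℚ.- 1ℚ ℚ.- W)
      ≡⟨ collect W (toℚ t) ⟩
    toℚ t ℚ.- 1ℚ ∎
    where
    open ℚ.≤-Reasoning
    open ℚ-Solver
    W = toℚ (weight x)
    2a = agree v x ℕ.+ agree v x
    2a< : 2a ℕ.< weight x ℕ.+ t
    2a< = ℕ.≰⇒> λ le → contradiction (trans (sym ∉) (≤ᵇ-true le)) λ ()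
    insert : ∀ d w → d ≡ d ℚ.+ w ℚ.- w
    insert = solve 2 (λ d w → d := d :+ w :- w) refl
    shift : ∀ a w → a ℚ.- w ≡ 1ℚ ℚ.+ a ℚ.+ (ℚ.- 1ℚ ℚ.- w)
    shift = solve 2 (λ a w → a :- w := con 1ℚ :+ a :+ (:- con 1ℚ :- w)) refl
    collect : ∀ w t → w ℚ.+ t ℚ.+ (ℚ.- 1ℚ ℚ.- w) ≡ t ℚ.- 1ℚ
    collect = solve 2 (λ w t → w :+ t :+ (:- con 1ℚ :- w) := t :- con 1ℚ) refl

  inside-cap : ∀ x → inCap t v x ≡ true → toℚ t ℚ.- 1ℚ ℚ.< dot u x
  inside-cap x ∈ = begin-strict
    toℚ t ℚ.- 1ℚ
      <⟨ ℚ.+-monoʳ-< (toℚ t) (ℚ.negative⁻¹ (ℚ.- 1ℚ)) ⟩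
    toℚ t ℚ.+ 0ℚ
      ≡⟨ insert (toℚ t) W ⟩
    W ℚ.+ toℚ t ℚ.- W
      ≡⟨ cong (ℚ._- W) (toℚ-+ (weight x) t) ⟨
    toℚ (weight x ℕ.+ t) ℚ.- W
      ≤⟨ ℚ.+-monoˡ-≤ (ℚ.- W) (toℚ-mono {weight x ℕ.+ t} (ℕ.≤ᵇ⇒≤ _ (agree v x ℕ.+ agree v x) (Equivalence.from T-≡ ∈))) ⟩
    toℚ (agree v x ℕ.+ agree v x) ℚ.- W
      ≡⟨ cong (ℚ._- W) (dot-sign v x) ⟨
    dot u x ℚ.+ W ℚ.- W
      ≡⟨ cancel (dot u x) W ⟩
    dot u x ∎
    where
    open ℚ.≤-Reasoning
    open ℚ-Solver
    W = toℚ (weight x)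
    insert : ∀ t w → t ℚ.+ 0ℚ ≡ w ℚ.+ t ℚ.- w
    insert = solve 2 (λ t w → t :+ con 0ℚ := w :+ t :- w) refl
    cancel : ∀ d w → d ℚ.+ w ℚ.- w ≡ d
    cancel = solve 2 (λ d w → d :+ w :- w := d) refl

unavoided : ∀ {A B : Set} (p : B → A → Bool) {m} (L : Vec A m) x → avoids (p x) L ≡ false →
  ∃[ v ] p x v ≡ true × (∀ s → avoids (p s) L ≡ true → p s v ≡ false)
unavoided p (v ∷ L) x eq with p x v in pxv
... | true  = v , pxv , λ s all → not-first (p s v) all
  where
  not-first : ∀ b {c} → not b ∧ c ≡ true → b ≡ false
  not-first false _ = refl
... | false with unavoided p L x eq
... | v′ , pxv′ , others = v′ , pxv′ , λ s all → others s (rest (p s v) all)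
  where
  rest : ∀ b {c} → not b ∧ c ≡ true → c ≡ true
  rest false eq = eq

-- An omitted point lies in some cap of the family, and the sign vector of that cap separates it
-- from the whole set.
outside-convex : ∀ {n m} t (L : Vec (Signs n) m) → Convex (outside t L)
outside-convex t L = separated⇒convex (outside t L) λ x x∉S →
  let v , x∈cap , below = unavoided (λ x v → inCap t v x) L x x∉S
  in Vec.map sign v , toℚ t ℚ.- 1ℚ
   , (λ s s∈S → outside-cap t v s (below s s∈S))
   , inside-cap t v x x∈cap

-- Choice of the parameters

guarded : ∀ b {X Y} → (b ≡ true → X ≤ Y) → 𝟙 b * X ≤ Y
guarded false h = z≤n
guarded true  h = ≤-trans (≤-reflexive (*-identityˡ _)) (h refl)

-- M bounds |3k − 2n| for at least half of the points because M² ≥ 4n, and κ is chosen so that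
-- these weights k are at least 2κ.
module Scale (q : ℕ) where

  q² q³ q⁴ M : ℕ
  q² = q * q
  q³ = q * q²
  q⁴ = q² * q²
  -- 512² = 4 · 65536, so 4n ≤ M² is exactly what n ≤ 65536 q⁴ gives.
  M  = 512 * q²

  module Parameters (n κ ρ : ℕ) (512≤q : 512 ≤ q)
    (n-lower : 4096 * q⁴ ≤ n) (n-upper : n ≤ 65536 * q⁴)
    (n≡ : n ≡ 3 * κ + 288 * q² + ρ) (ρ≤2 : ρ ≤ 2) where
    open ≤-Reasoning

    1≤q : 1 ≤ q
    1≤q = ≤-trans (s≤s z≤n) 512≤q

    1≤q² : 1 ≤ q²
    1≤q² = *-mono-≤ 1≤q 1≤q

    q²≤q⁴ : q² ≤ q⁴
    q²≤q⁴ = ≤-trans (≤-reflexive (sym (*-identityʳ q²))) (*-monoʳ-≤ q² 1≤q²)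

    1≤q⁴ : 1 ≤ q⁴
    1≤q⁴ = *-mono-≤ 1≤q² 1≤q²

    q≤q³ : q ≤ q³
    q≤q³ = ≤-trans (≤-reflexive (sym (*-identityʳ q))) (*-monoʳ-≤ q 1≤q²)

    1≤q³ : 1 ≤ q³
    1≤q³ = *-mono-≤ 1≤q 1≤q²

    q³≤q⁴ : q³ ≤ q⁴
    q³≤q⁴ = begin
      q * q²           ≡⟨ *-comm q q² ⟩
      q² * q           ≡⟨ cong (q² *_) (*-identityʳ q) ⟨
      q² * (q * 1)     ≤⟨ *-monoʳ-≤ q² (*-monoʳ-≤ q 1≤q) ⟩
      q⁴ ∎

    κ-lower : 1024 * q⁴ ≤ κ
    κ-lower = *-cancelˡ-≤ 3 (+-cancelʳ-≤ (290 * q⁴) _ _ (begin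
      3 * (1024 * q⁴) + 290 * q⁴    ≤⟨ ≤-by (734 * q⁴) (shape q⁴) ⟩
      4096 * q⁴                     ≤⟨ n-lower ⟩
      n                             ≡⟨ n≡ ⟩
      3 * κ + 288 * q² + ρ          ≤⟨ +-mono-≤ (+-monoʳ-≤ (3 * κ) (*-monoʳ-≤ 288 q²≤q⁴))
                                         (≤-trans ρ≤2 (*-monoʳ-≤ 2 1≤q⁴)) ⟩
      3 * κ + 288 * q⁴ + 2 * q⁴     ≡⟨ shape′ (3 * κ) q⁴ ⟩
      3 * κ + 290 * q⁴              ∎))
      where
      shape : ∀ x → 3 * (1024 * x) + 290 * x + 734 * x ≡ 4096 * x
      shape = solve-∀
      shape′ : ∀ k x → k + 288 * x + 2 * x ≡ k + 290 * x
      shape′ = solve-∀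

    q³≤κ : q³ ≤ κ
    q³≤κ = ≤-trans q³≤q⁴ (≤-trans (m≤n*m q⁴ 1024) κ-lower)

    3κ≤n : 3 * κ ≤ n
    3κ≤n = ≤-by (288 * q² + ρ) (trans (sym (+-assoc (3 * κ) (288 * q²) ρ)) (sym n≡))

    2κ≤n : κ + κ ≤ n
    2κ≤n = ≤-trans (≤-by κ (shape κ)) 3κ≤n
      where
      shape : ∀ k → k + k + k ≡ 3 * k
      shape = solve-∀

    κ>0 : 0 < κ
    κ>0 = ≤-trans 1≤q³ q³≤κ

    n>0 : 0 < n
    n>0 = <-≤-trans κ>0 (≤-trans (m≤m+n κ κ) 2κ≤n)

    w′ : ℕ
    w′ = pred q³

    w≡ : suc w′ ≡ q³
    w≡ = suc-pred q³ {{>-nonZero 1≤q³}}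

    open Caps w′

    small : 2 * (suc q * (2 * w + 2 * q + 1)) ≤ κ
    small = begin
      2 * (suc q * (2 * w + 2 * q + 1))
        ≡⟨ cong (λ i → 2 * (suc q * (2 * i + 2 * q + 1))) w≡ ⟩
      2 * ((1 + q) * (2 * q³ + 2 * q + 1))
        ≤⟨ *-monoʳ-≤ 2 (*-mono-≤ (+-monoˡ-≤ q 1≤q)
             (+-mono-≤ (+-monoʳ-≤ (2 * q³) (*-monoʳ-≤ 2 q≤q³)) 1≤q³)) ⟩
      2 * ((q + q) * (2 * q³ + 2 * q³ + q³))
        ≡⟨ shape q ⟩
      20 * q⁴
        ≤⟨ *-monoˡ-≤ q⁴ {20} {1024} (≤-by 1004 refl) ⟩
      1024 * q⁴
        ≤⟨ κ-lower ⟩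
      κ ∎
      where
      shape : ∀ q → 2 * ((q + q) * (2 * (q * (q * q)) + 2 * (q * (q * q)) + q * (q * q)))
            ≡ 20 * ((q * q) * (q * q))
      shape = solve-∀

    w+w≤n : w + w ≤ n
    w+w≤n = ≤-trans (+-mono-≤ w≤κ w≤κ) 2κ≤n
      where
      w≤κ : w ≤ κ
      w≤κ = subst (_≤ κ) (sym w≡) q³≤κ

    cap>0 : 0 < cap κ
    cap>0 = binomialTail>0 (κ + κ) (κ + w) (+-monoʳ-≤ κ (subst (_≤ κ) (sym w≡) q³≤κ))

    -- The bound 512 ≤ q has its origin here: 8 · 65536 = 2 · 512².
    8n≤2w² : 8 * n ≤ w * (2 * w)
    8n≤2w² = begin
      8 * n                        ≤⟨ *-monoʳ-≤ 8 n-upper ⟩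
      8 * (65536 * q⁴)             ≡⟨ shape q⁴ ⟩
      2 * (262144 * q⁴)            ≤⟨ *-monoʳ-≤ 2 (*-monoˡ-≤ q⁴ {262144} {q²} (*-mono-≤ 512≤q 512≤q)) ⟩
      2 * (q² * q⁴)                ≡⟨ shape′ q ⟩
      q³ * (2 * q³)                ≡⟨ cong (λ i → i * (2 * i)) w≡ ⟨
      w * (2 * w)                  ∎
      where
      shape : ∀ x → 8 * (65536 * x) ≡ 2 * (262144 * x)
      shape = solve-∀
      shape′ : ∀ q → 2 * (q * q * ((q * q) * (q * q))) ≡ q * (q * q) * (2 * (q * (q * q)))
      shape′ = solve-∀

    -- This makes the quotient m positive. With c = C(2κ, κ + w), the tail satisfies 2w · `cap κ` ≤
    -- (κ + w) c, while w c ≤ 4^κ because the w terms from the middle up to κ + w are no smaller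
    -- than c.
    cap-small : 8 * cap κ ≤ 2 ^ (κ + κ)
    cap-small = *-cancelˡ-≤ n {{>-nonZero n>0}} (begin
      n * (8 * cap κ)
        ≡⟨ shape n (cap κ) ⟩
      8 * n * cap κ
        ≤⟨ *-monoˡ-≤ (cap κ) 8n≤2w² ⟩
      w * (2 * w) * cap κ
        ≡⟨ *-assoc w (2 * w) (cap κ) ⟩
      w * (2 * w * cap κ)
        ≤⟨ *-monoʳ-≤ w (binomialTail-upper (κ + κ) (κ + w) (2 * w) (shape′ κ w)) ⟩
      w * ((κ + w) * c)
        ≤⟨ *-monoʳ-≤ w (*-monoˡ-≤ c κ+w≤n) ⟩
      w * (n * c)
        ≡⟨ swap w n c ⟩
      n * (w * c)
        ≤⟨ *-monoʳ-≤ n (≤-trans (binomialTail-lower (κ + κ) κ w (n≤1+n _)) (binomialTail≤2^ (κ + κ) κ)) ⟩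
      n * 2 ^ (κ + κ) ∎)
      where
      c = (κ + κ) C (κ + w)
      shape : ∀ n c → n * (8 * c) ≡ 8 * n * c
      shape = solve-∀
      shape′ : ∀ k w → k + k + 2 * w ≡ (k + w) + (k + w)
      shape′ = solve-∀
      swap : ∀ w n c → w * (n * c) ≡ n * (w * c)
      swap = solve-∀
      κ+w≤n : κ + w ≤ n
      κ+w≤n = ≤-trans (+-monoʳ-≤ κ (subst (_≤ κ) (sym w≡) q³≤κ)) 2κ≤n

    e : ℕ
    e = n ∸ (κ + κ)

    n≡2κ+e : n ≡ κ + κ + e
    n≡2κ+e = sym (m+[n∸m]≡n 2κ≤n)

    G : ℕ
    G = 2 ^ e * cap κ

    instance
      8G≢0 : NonZero (8 * G)
      8G≢0 = >-nonZero (*-mono-≤ {1} {8} (s≤s z≤n) (*-mono-≤ (m^n>0 2 e) cap>0))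

    8G≤ : 8 * G ≤ 2 ^ n
    8G≤ = begin
      8 * (2 ^ e * cap κ)      ≡⟨ swap (2 ^ e) (cap κ) ⟩
      8 * cap κ * 2 ^ e        ≤⟨ *-monoˡ-≤ (2 ^ e) cap-small ⟩
      2 ^ (κ + κ) * 2 ^ e      ≡⟨ ^-distribˡ-+-* 2 (κ + κ) e ⟨
      2 ^ (κ + κ + e)          ≡⟨ cong (2 ^_) n≡2κ+e ⟨
      2 ^ n                    ∎
      where
      swap : ∀ a b → 8 * (a * b) ≡ 8 * b * a
      swap = solve-∀

    -- The expected number of caps containing a point of weight 2κ lies between 1/16 and 1/8.
    m : ℕ
    m = 2 ^ n / (8 * G)

    m-upper : 8 * (m * G) ≤ 2 ^ n
    m-upper = subst (_≤ 2 ^ n) (shape m G) (m/n*n≤m (2 ^ n) (8 * G))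
      where
      shape : ∀ m g → m * (8 * g) ≡ 8 * (m * g)
      shape = solve-∀

    m-lower : 2 ^ n ≤ 16 * (m * G)
    m-lower = begin
      2 ^ n                          ≡⟨ m≡m%n+[m/n]*n (2 ^ n) (8 * G) ⟩
      2 ^ n % (8 * G) + m * (8 * G)  ≤⟨ +-monoˡ-≤ (m * (8 * G)) (<⇒≤ (m%n<n (2 ^ n) (8 * G))) ⟩
      -- Rounding the quotient down loses less than 8G, which is at most m · 8G as m ≥ 1; so the
      -- loss is a factor 2.
      8 * G + m * (8 * G)            ≤⟨ +-monoˡ-≤ (m * (8 * G)) (≤-trans (≤-reflexive (sym (*-identityˡ (8 * G))))
                                          (*-monoˡ-≤ (8 * G) (m≥n⇒m/n>0 8G≤))) ⟩
      m * (8 * G) + m * (8 * G)      ≡⟨ shape m G ⟩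
      16 * (m * G)                   ∎
      where
      shape : ∀ m g → m * (8 * g) + m * (8 * g) ≡ 16 * (m * g)
      shape = solve-∀

    J*κ>0 : 0 < q * κ
    J*κ>0 = *-mono-≤ 1≤q κ>0

    open EdgeBound w′ n q κ e n≡2κ+e small J*κ>0 w+w≤n m m-upper m-lower
    open Window q κ small J*κ>0

    -- With w = q³ the last condition is (δ + 2) q² ≤ κ. It holds because δ is O(q²) for central
    -- weights and κ ≥ 1024 q⁴.
    central-window : ∀ k → central n M k ≡ true → ∃[ δ ] k ≡ κ + κ + δ × suc (suc δ) * w ≤ q * κ
    central-window k c =
      let δ , eq = m≤n⇒∃[o]m+o≡n 2κ≤k
      in δ , sym eq , offset δ eq
      where
      shape : ∀ k s r → 3 * (k + k) + (512 * s + 64 * s + 2 * r) ≡ 2 * (3 * k + 288 * s + r)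
      shape = solve-∀
      -- The coefficient 288 has to be at least M/(2q²) = 256: then 2n - M ≥ 6κ, with 64 q² to
      -- spare.
      2κ≤k : κ + κ ≤ k
      2κ≤k = *-cancelˡ-≤ 3 (+-cancelʳ-≤ M _ _ (begin
        3 * (κ + κ) + M                          ≤⟨ +-monoʳ-≤ (3 * (κ + κ)) (m≤m+n M (64 * q² + 2 * ρ)) ⟩
        3 * (κ + κ) + (M + (64 * q² + 2 * ρ))    ≡⟨ cong (3 * (κ + κ) +_) (+-assoc M (64 * q²) (2 * ρ)) ⟨
        3 * (κ + κ) + (M + 64 * q² + 2 * ρ)      ≡⟨ shape κ q² ρ ⟩
        2 * (3 * κ + 288 * q² + ρ)               ≡⟨ cong (2 *_) n≡ ⟨
        2 * n                                    ≤⟨ central-lower n M k c ⟩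
        M + 3 * k                                ≡⟨ +-comm M (3 * k) ⟩
        3 * k + M                                ∎))
      offset : ∀ δ → κ + κ + δ ≡ k → suc (suc δ) * w ≤ q * κ
      offset δ eq = begin
        (2 + δ) * w        ≡⟨ cong ((2 + δ) *_) w≡ ⟩
        (2 + δ) * q³       ≡⟨ shape₁ δ q ⟩
        q * ((2 + δ) * q²) ≤⟨ *-monoʳ-≤ q (*-cancelˡ-≤ 3 3[2+δ]q²≤) ⟩
        q * κ              ∎
        where
        shape₁ : ∀ d q → (2 + d) * (q * (q * q)) ≡ q * ((2 + d) * (q * q))
        shape₁ = solve-∀
        -- 1088 = 512 + 2 · 288, and the 4 is twice the bound on ρ.
        3δ≤ : 3 * δ ≤ 1088 * q² + 4
        3δ≤ = +-cancelˡ-≤ (3 * (κ + κ)) _ _ (begin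
          3 * (κ + κ) + 3 * δ                ≡⟨ *-distribˡ-+ 3 (κ + κ) δ ⟨
          3 * (κ + κ + δ)                    ≡⟨ cong (3 *_) eq ⟩
          3 * k                              ≤⟨ central-upper n M k c ⟩
          M + 2 * n                          ≡⟨ cong (λ i → M + 2 * i) n≡ ⟩
          M + 2 * (3 * κ + 288 * q² + ρ)     ≤⟨ +-monoʳ-≤ M (*-monoʳ-≤ 2 (+-monoʳ-≤ (3 * κ + 288 * q²) ρ≤2)) ⟩
          M + 2 * (3 * κ + 288 * q² + 2)     ≡⟨ shape₂ κ q² ⟩
          3 * (κ + κ) + (1088 * q² + 4)      ∎)
          where
          shape₂ : ∀ k s → 512 * s + 2 * (3 * k + 288 * s + 2) ≡ 3 * (k + k) + (1088 * s + 4)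
          shape₂ = solve-∀
        3[2+δ]q²≤ : 3 * ((2 + δ) * q²) ≤ 3 * κ
        3[2+δ]q²≤ = begin
          3 * ((2 + δ) * q²)                 ≡⟨ shape₃ δ q² ⟩
          (6 + 3 * δ) * q²                   ≤⟨ *-monoˡ-≤ q² (+-monoʳ-≤ 6 3δ≤) ⟩
          (6 + (1088 * q² + 4)) * q²         ≡⟨ shape₄ q² ⟩
          1088 * q⁴ + 10 * q²                ≤⟨ +-monoʳ-≤ (1088 * q⁴) (*-monoʳ-≤ 10 q²≤q⁴) ⟩
          1088 * q⁴ + 10 * q⁴                ≤⟨ ≤-by (1974 * q⁴) (shape₅ q⁴) ⟩
          3 * (1024 * q⁴)                    ≤⟨ *-monoʳ-≤ 3 κ-lower ⟩
          3 * κ                              ∎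
          where
          shape₃ : ∀ d s → 3 * ((2 + d) * s) ≡ (6 + 3 * d) * s
          shape₃ = solve-∀
          shape₄ : ∀ s → (6 + (1088 * s + 4)) * s ≡ 1088 * (s * s) + 10 * s
          shape₄ = solve-∀
          shape₅ : ∀ x → 1088 * x + 10 * x + 1974 * x ≡ 3 * (1024 * x)
          shape₅ = solve-∀

    many-zeros : ∀ (x : Cube n) → central n M (weight x) ≡ true → n ≤ 4 * zeros x
    many-zeros x c = *-cancelˡ-≤ 3 (+-cancelʳ-≤ n _ _ (begin
      3 * n + n                            ≡⟨ shape n ⟩
      4 * n                                ≤⟨ *-monoʳ-≤ 4 n≤ ⟩
      4 * (M + 3 * zeros x)                ≡⟨ shape′ q² (zeros x) ⟩
      3 * (4 * zeros x) + 2048 * q²        ≤⟨ +-monoʳ-≤ (3 * (4 * zeros x)) (≤-trans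
                                                (*-mono-≤ {2048} {4096} (≤-by 2048 refl) q²≤q⁴) n-lower) ⟩
      3 * (4 * zeros x) + n                ∎))
      where
      shape : ∀ n → 3 * n + n ≡ 4 * n
      shape = solve-∀
      shape′ : ∀ s z → 4 * (512 * s + 3 * z) ≡ 3 * (4 * z) + 2048 * s
      shape′ = solve-∀
      n≤ : n ≤ M + 3 * zeros x
      n≤ = +-cancelʳ-≤ (2 * n) _ _ (begin
        n + 2 * n                          ≡⟨ cong (3 *_) (weight+zeros x) ⟨
        3 * (weight x + zeros x)           ≡⟨ *-distribˡ-+ 3 (weight x) (zeros x) ⟩
        3 * weight x + 3 * zeros x         ≤⟨ +-monoˡ-≤ (3 * zeros x) (central-upper n M (weight x) c) ⟩
        M + 2 * n + 3 * zeros x            ≡⟨ shape″ M (2 * n) (3 * zeros x) ⟩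
        M + 3 * zeros x + 2 * n            ∎)
        where
        shape″ : ∀ a b c → a + b + c ≡ a + c + b
        shape″ = solve-∀

    P : ℕ
    P = (2 ^ n) ^ m

    Ls : List (Vec (Signs n) m)
    Ls = tuples (signs n) m

    size : Vec (Signs n) m → ℕ
    size L = List.length (boundary (outside (w + w) L))

    F : ℕ → ℕ
    F k = 𝟙 (central n M k) * (w * P)

    cuts : Cube n × Cube n → ℕ
    cuts p = 64 * n * (∑[ L ∈ Ls ] cut (outside (w + w) L) p)

    F≤ : ∀ {x x′} → x ⋖ x′ → ∀ y y′ → dist y y′ ≡ 1 →
         (∀ L → outside (w + w) L x xor outside (w + w) L x′ ≡ outside (w + w) L y xor outside (w + w) L y′) →
         F (weight x) ≤ cuts (y , y′)
    F≤ {x} {x′} x⋖x′ y y′ d≡1 same = guarded (central n M (weight x)) λ c →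
      let δ , k≡ , δ≤ = central-window (weight x) c in begin
      w * P
        ≤⟨ edge-bound x⋖x′ δ k≡ (threshold δ δ≤) ⟩
      64 * n * (∑[ L ∈ Ls ] 𝟙 (outside (w + w) L x xor outside (w + w) L x′))
        ≡⟨ cong (64 * n *_) (∑-cong Ls λ L → cong₂ (λ b b′ → 𝟙 (b ∧ b′))
             (cong (λ d → does (d ≟ 1)) (sym d≡1)) (same L)) ⟩
      cuts (y , y′) ∎

    -- The pairs of a family and an edge that it cuts are counted in both orders. At least half of
    -- the points are central, each has n/4 zeros or more, and every zero gives two edges. The half
    -- cancels the two, and 256 = 4 · 64.
    total-boundary : w * P * 3 ^ n ≤ 256 * sumOver Ls size
    total-boundary = *-cancelˡ-≤ n {{>-nonZero n>0}} (begin
      n * (w * P * 3 ^ n)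
        ≤⟨ *-monoʳ-≤ n (*-monoʳ-≤ (w * P) (chebyshev n M n>0 4n≤M²)) ⟩
      n * (w * P * (2 * C))
        ≡⟨ shape₁ n (w * P) C ⟩
      2 * n * (w * P) * C
        ≡⟨ ∑-*ˡ (points n) (2 * n * (w * P)) _ ⟨
      ∑[ x ∈ points n ] 2 * n * (w * P) * 𝟙 (central n M (weight x))
        ≤⟨ ∑-mono (points n) pointwise ⟩
      ∑[ x ∈ points n ] 4 * (zeros x * (2 * F (weight x)))
        ≡⟨ ∑-*ˡ (points n) 4 _ ⟩
      4 * (∑[ x ∈ points n ] zeros x * (2 * F (weight x)))
        ≤⟨ *-monoʳ-≤ 4 (edges-by-weight n cuts F
             (λ {x} {x′} x⋖x′ → F≤ x⋖x′ x x′ (proj₁ (⋖-dist x⋖x′)) (λ L → refl))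
             (λ {x} {x′} x⋖x′ → F≤ x⋖x′ x′ x (proj₂ (⋖-dist x⋖x′))
                (λ L → xor-comm (outside (w + w) L x) (outside (w + w) L x′)))) ⟩
      4 * sumOver (pairs (points n)) cuts
        ≡⟨ cong (4 *_) (trans (∑-*ˡ (pairs (points n)) (64 * n) _)
             (cong (64 * n *_) (trans (∑-swap (pairs (points n)) Ls _)
               (∑-cong Ls λ L → sym (length-boundary (outside (w + w) L)))))) ⟩
      4 * (64 * n * sumOver Ls size)
        ≡⟨ shape₂ n (sumOver Ls size) ⟩
      n * (256 * sumOver Ls size) ∎)
      where
      C = ∑[ x ∈ points n ] 𝟙 (central n M (weight x))
      shape₁ : ∀ n p c → n * (p * (2 * c)) ≡ 2 * n * p * c
      shape₁ = solve-∀
      shape₂ : ∀ n s → 4 * (64 * n * s) ≡ n * (256 * s)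
      shape₂ = solve-∀
      4n≤M² : 4 * n ≤ M * M
      4n≤M² = ≤-trans (*-monoʳ-≤ 4 n-upper) (≤-reflexive
        (trans (sym (*-assoc 4 65536 q⁴)) (sym ([m*n]*[o*p]≡[m*o]*[n*p] 512 q² 512 q²))))
      pointwise : ∀ x → 2 * n * (w * P) * 𝟙 (central n M (weight x)) ≤ 4 * (zeros x * (2 * F (weight x)))
      pointwise x = begin
        2 * n * (w * P) * b              ≡⟨ shape₄ n (w * P) b ⟩
        b * n * (2 * (w * P))            ≤⟨ *-monoˡ-≤ (2 * (w * P)) (begin
          b * n                            ≡⟨ idempotent (central n M (weight x)) n ⟩
          b * (b * n)                      ≤⟨ *-monoʳ-≤ b (guarded (central n M (weight x)) (many-zeros x)) ⟩
          b * (4 * zeros x)                ∎) ⟩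
        b * (4 * zeros x) * (2 * (w * P)) ≡⟨ shape₅ b (zeros x) (w * P) ⟩
        4 * (zeros x * (2 * (b * (w * P)))) ∎
        where
        b = 𝟙 (central n M (weight x))
        idempotent : ∀ b n → 𝟙 b * n ≡ 𝟙 b * (𝟙 b * n)
        idempotent true  n = sym (*-identityˡ (1 * n))
        idempotent false n = refl
        shape₄ : ∀ n p b → 2 * n * p * b ≡ b * n * (2 * p)
        shape₄ = solve-∀
        shape₅ : ∀ b z p → b * (4 * z) * (2 * p) ≡ 4 * (z * (2 * (b * p)))
        shape₅ = solve-∀

    large-boundary : Σ[ T ∈ CubeSubset n ] Convex T × q³ * 3 ^ n ≤ 256 * List.length (boundary T)
    large-boundary =
      let L , large = above-average (q³ * 3 ^ n) (λ L → 256 * size L) Ls Ls>0 average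
      in outside (w + w) L , outside-convex (w + w) L , large
      where
      length-Ls : List.length Ls ≡ P
      length-Ls = trans (length-tuples (signs n) m) (cong (_^ m) (length-signs n))
      Ls>0 : 0 < List.length Ls
      Ls>0 = subst (0 <_) (sym length-Ls) (m^n>0 (2 ^ n) {{m^n≢0 2 n}} m)
      shape : ∀ p q t → p * (q * t) ≡ q * p * t
      shape = solve-∀
      average : List.length Ls * (q³ * 3 ^ n) ≤ sumOver Ls (λ L → 256 * size L)
      average = begin
        List.length Ls * (q³ * 3 ^ n)  ≡⟨ cong (_* (q³ * 3 ^ n)) length-Ls ⟩
        P * (q³ * 3 ^ n)               ≡⟨ shape P q³ (3 ^ n) ⟩
        q³ * P * 3 ^ n                 ≡⟨ cong (λ i → i * P * 3 ^ n) w≡ ⟨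
        w * P * 3 ^ n                  ≤⟨ total-boundary ⟩
        256 * sumOver Ls size          ≡⟨ ∑-*ˡ Ls 256 size ⟨
        sumOver Ls (λ L → 256 * size L) ∎

  module Large (n : ℕ) (512≤q : 512 ≤ q) (8q≤ : (8 * q) ^ 4 ≤ n) (n<16q^4 : n < (16 * q) ^ 4) where
    open ≤-Reasoning

    private
      1≤q : 1 ≤ q
      1≤q = ≤-trans (s≤s z≤n) 512≤q

    q^4≡ : q ^ 4 ≡ q⁴
    q^4≡ = trans (cong (λ i → q * (q * (q * i))) (*-identityʳ q)) (shape q)
      where
      shape : ∀ q → q * (q * (q * q)) ≡ (q * q) * (q * q)
      shape = solve-∀

    n-lower : 4096 * q⁴ ≤ n
    n-lower = begin
      4096 * q⁴      ≡⟨ cong (4096 *_) q^4≡ ⟨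
      4096 * q ^ 4   ≡⟨ *-^4 8 q ⟨
      (8 * q) ^ 4    ≤⟨ 8q≤ ⟩
      n              ∎

    n-upper : n ≤ 65536 * q⁴
    n-upper = begin
      n               ≤⟨ <⇒≤ n<16q^4 ⟩
      (16 * q) ^ 4    ≡⟨ *-^4 16 q ⟩
      65536 * q ^ 4   ≡⟨ cong (65536 *_) q^4≡ ⟩
      65536 * q⁴      ∎

    288q²≤n : 288 * q² ≤ n
    288q²≤n = ≤-trans (*-mono-≤ {288} {4096} (≤-by 3808 refl)
      (≤-trans (≤-reflexive (sym (*-identityʳ q²))) (*-monoʳ-≤ q² (*-mono-≤ 1≤q 1≤q)))) n-lower

    n≡ : n ≡ 3 * ((n ∸ 288 * q²) / 3) + 288 * q² + (n ∸ 288 * q²) % 3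
    n≡ = trans (sym (m+[n∸m]≡n 288q²≤n))
      (trans (cong (λ i → 288 * q² + i) (m≡m%n+[m/n]*n (n ∸ 288 * q²) 3))
             (shape (288 * q²) ((n ∸ 288 * q²) % 3) ((n ∸ 288 * q²) / 3)))
      where
      shape : ∀ a b c → a + (b + c * 3) ≡ 3 * c + a + b
      shape = solve-∀

    open Parameters n ((n ∸ 288 * q²) / 3) ((n ∸ 288 * q²) % 3) 512≤q n-lower n-upper n≡
      (≤-pred (m%n<n (n ∸ 288 * q²) 3)) using (large-boundary)

    n³-root : ∀ k → ⌊∜ n ^ 3 * suc k ^ 4 ⌋ ≤ 4096 * q³ * suc k
    n³-root k = ≤-pred (^4-cancel-< (begin-strict
      ⌊∜ n ^ 3 * suc k ^ 4 ⌋ ^ 4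
        ≤⟨ ⌊∜⌋-lower (n ^ 3 * suc k ^ 4) ⟩
      n ^ 3 * suc k ^ 4
        ≤⟨ *-monoˡ-≤ (suc k ^ 4) (^-monoˡ-≤ 3 (<⇒≤ n<16q^4)) ⟩
      ((16 * q) ^ 4) ^ 3 * suc k ^ 4
        ≡⟨ cong (_* suc k ^ 4) (trans (^-*-assoc (16 * q) 4 3) (sym (^-*-assoc (16 * q) 3 4))) ⟩
      ((16 * q) ^ 3) ^ 4 * suc k ^ 4
        ≡⟨ *-^4 ((16 * q) ^ 3) (suc k) ⟨
      ((16 * q) ^ 3 * suc k) ^ 4
        ≡⟨ cong (λ i → (i * suc k) ^ 4) cube ⟩
      (4096 * q³ * suc k) ^ 4
        <⟨ ^-monoˡ-< 4 (n<1+n (4096 * q³ * suc k)) ⟩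
      suc (4096 * q³ * suc k) ^ 4 ∎))
      where
      cube : (16 * q) ^ 3 ≡ 4096 * q³
      cube = trans (cong (λ i → 16 * q * (16 * q * i)) (*-identityʳ (16 * q))) (shape q)
        where
        shape : ∀ q → 16 * q * (16 * q * (16 * q)) ≡ 4096 * (q * (q * q))
        shape = solve-∀

    -- 1048576 = 4096 · 256, where 4096 q³ = (16q)³ bounds n^(3/4). The inequality holds for every
    -- approximation of n^(3/4), so no limit has to be taken afterwards.
    large-influence : Σ[ T ∈ CubeSubset n ] Convex T × (∀ k →
      ⌊∜ n ^ 3 * suc k ^ 4 ⌋ * 3 ^ n ≤ List.length (boundary T) * (1048576 * suc k))
    large-influence = let T , convex , large = large-boundary in T , convex , λ k → begin
      ⌊∜ n ^ 3 * suc k ^ 4 ⌋ * 3 ^ n                     ≤⟨ *-monoˡ-≤ (3 ^ n) (n³-root k) ⟩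
      4096 * q³ * suc k * 3 ^ n                          ≡⟨ shape₁ q³ (suc k) (3 ^ n) ⟩
      4096 * suc k * (q³ * 3 ^ n)                        ≤⟨ *-monoʳ-≤ (4096 * suc k) large ⟩
      4096 * suc k * (256 * List.length (boundary T))    ≡⟨ shape₂ (suc k) (List.length (boundary T)) ⟩
      List.length (boundary T) * (1048576 * suc k)       ∎
      where
      shape₁ : ∀ x s t → 4096 * x * s * t ≡ 4096 * s * (x * t)
      shape₁ = solve-∀
      shape₂ : ∀ s b → 4096 * s * (256 * b) ≡ b * (1048576 * s)
      shape₂ s b = trans ([m*n]*[o*p]≡[m*o]*[n*p] 4096 s 256 b)
        (trans (sym (*-assoc 1048576 s b)) (*-comm (1048576 * s) b))

-- q is an eighth of the fourth root of n, rounded down; as q ≥ 1, rounding costs at most a factor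
-- 2. The bound 4096 = 8 · 512 ensures 512 ≤ q.
scale : ∀ n → 4096 ^ 4 ≤ n → ∃[ q ] 512 ≤ q × (8 * q) ^ 4 ≤ n × n < (16 * q) ^ 4
scale n n≥ = q
  , 512≤q
  , ≤-trans (^-monoˡ-≤ 4 (subst (_≤ r) (*-comm q 8) (m/n*n≤m r 8))) (⌊∜⌋-lower n)
  , <-≤-trans (⌊∜⌋-upper n) (^-monoˡ-≤ 4 r<16q)
  where
  open ≤-Reasoning
  r = ⌊∜ n ⌋
  q = r / 8
  512≤q : 512 ≤ q
  512≤q = /-monoˡ-≤ 8 (≤-pred (^4-cancel-< {4096} {suc r} (≤-<-trans n≥ (⌊∜⌋-upper n))))
  shape : ∀ q → 8 * q + q * 8 ≡ 16 * q
  shape = solve-∀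
  r<16q : suc r ≤ 16 * q
  r<16q = begin
    suc r                  ≡⟨ cong suc (m≡m%n+[m/n]*n r 8) ⟩
    suc (r % 8) + q * 8    ≤⟨ +-monoˡ-≤ (q * 8) (m%n<n r 8) ⟩
    8 + q * 8              ≤⟨ +-monoˡ-≤ (q * 8) (*-monoʳ-≤ 8 (≤-trans (s≤s z≤n) 512≤q)) ⟩
    8 * q + q * 8          ≡⟨ shape q ⟩
    16 * q                 ∎

-- From the count of boundary edges to the inequality between reals

scaled-/-≤ : ∀ d a k b M .{{_ : NonZero M}} → a * M ≤ b * (suc d * suc k) →
             (1ℤ ℚ./ suc d) ℚ.* (pos a ℚ./ suc k) ℚ.≤ pos b ℚ./ M
scaled-/-≤ d a k b (suc e) le = ℚ.toℚᵘ-cancel-≤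
  (ℚᵘ.≤-respˡ-≃ (ℚᵘ.≃-sym product)
  (ℚᵘ.≤-respʳ-≃ (ℚᵘ.≃-sym (ℚ.toℚᵘ-fromℚᵘ (ℚᵘ.mkℚᵘ (pos b) e)))
  (ℚᵘ.*≤* (subst₂ ℤ._≤_ (trans (ℤ.pos-* a (suc e)) (cong (ℤ._* pos (suc e)) (sym (ℤ.*-identityˡ (pos a)))))
                        (ℤ.pos-* b (suc d * suc k)) (ℤ.+≤+ le)))))
  where
  product : ℚ.toℚᵘ ((1ℤ ℚ./ suc d) ℚ.* (pos a ℚ./ suc k)) ℚᵘ.≃
            ℚᵘ.mkℚᵘ 1ℤ d ℚᵘ.* ℚᵘ.mkℚᵘ (pos a) k
  product = ℚᵘ.≃-trans (ℚ.toℚᵘ-homo-* (1ℤ ℚ./ suc d) (pos a ℚ./ suc k))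
    (ℚᵘ.*-cong (ℚ.toℚᵘ-fromℚᵘ (ℚᵘ.mkℚᵘ 1ℤ d)) (ℚ.toℚᵘ-fromℚᵘ (ℚᵘ.mkℚᵘ (pos a) k)))

1/d>0 : ∀ d → 0ℚ ℚ.< 1ℤ ℚ./ suc d
1/d>0 d = ℚ.positive⁻¹ (1ℤ ℚ./ suc d) {{ℚ.normalize-pos 1 (suc d)}}

theorem1p3 : Σ[ c ∈ ℝ ] 0ᴿ <ᴿ c ×
    (∃[ N ] ∀ n → n ≥ N →
    Σ[ S ∈ CubeSubset n ] Convex S × c *ᴿ (n ^¾) ≤ᴿ fromℚ (influence S))
theorem1p3 = fromℚ c
  , (c , 1/d>0 1048575 , 0 , λ _ _ → ℚ.≤-reflexive (ℚ.+-identityˡ c))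
  , 4096 ^ 4 , bound
  where
  c : ℚ
  c = 1ℤ ℚ./ suc 1048575
  bound : ∀ n → n ≥ 4096 ^ 4 →
    Σ[ S ∈ CubeSubset n ] Convex S × fromℚ c *ᴿ (n ^¾) ≤ᴿ fromℚ (influence S)
  bound n n≥ =
    let q , 512≤q , 8q≤ , n<       = scale n n≥
        S , S-convex , S-influence = Scale.Large.large-influence q n 512≤q 8q≤ n<
    in S , S-convex , λ ε 0<ε → 0 , λ k _ → ℚ.≤-trans
      (scaled-/-≤ 1048575 ⌊∜ n ^ 3 * suc k ^ 4 ⌋ k (List.length (boundary S)) (3 ^ n) {{m^n≢0 3 n}}
        (S-influence k))
      (ℚ.≤-trans (ℚ.≤-reflexive (sym (ℚ.+-identityʳ (influence S))))
                 (ℚ.+-monoʳ-≤ (influence S) (ℚ.<⇒≤ 0<ε)))
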